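{- Let $\alpha \in \mathbb{Z}[n_1,n_2,n_3,n_4,k]$ satisfy $\alpha(m\boldsymbol{n}, mk) = m^2\alpha(\boldsymbol{n},k)$ (identically) and $\alpha(\boldsymbol{0},k) = k^2$, where $\boldsymbol{n}=(n_1,n_2,n_3,n_4)$. For $\boldsymbol{n}\in\mathbb{Z}_{\ge0}^4$ define \[ A_q^{(\alpha)}(\boldsymbol{n}) = \sum_{k\in\mathbb{Z}} q^{\alpha(\boldsymbol{n},k)}\binom{n_1}{k}_q\binom{n_3}{k}_q\binom{n_1+n_2-k}{n_1}_q\binom{n_3+n_4-k}{n_3}_q . \] Then for every positive integer $m$ and every $\boldsymbol{n}\in\mathbb{Z}_{\ge0}^4$, \[ A_q^{(\alpha)}(m\boldsymbol{n}) \equiv A^{(\alpha)}_{q^{m^2}}(\boldsymbol{n}) - \frac{m^2-1}{12}(q^m-1)^2 R(\boldsymbol{n}) \pmod{\Phi_m(q)^3}, \] where $A^{(\alpha)}_{q^{m^2}}(\boldsymbol{n})$ is $A^{(\alpha)}_q(\boldsymbol{n})$ with $q$ replaced by $q^{m^2}$, and \[ R(\boldsymbol{n}) = \frac{n_1n_2+n_3n_4}{2} A_1^{(\alpha)}(\boldsymbol{n}), \] with $A_1^{(\alpha)}(\boldsymbol{n}) = \sum_{k}\binom{n_1}{k}\binom{n_3}{k}\binom{n_1+n_2-k}{n_1}\binom{n_3+n_4-k}{n_3}$ the value at $q=1$.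
   Context: $[n]_q = 1+q+\cdots+q^{n-1}$, $[n]_q! = [n]_q\cdots[1]_q$, and $\binom{n}{k}_q = \frac{[n]_q!}{[k]_q![n-k]_q!}$ for $0\le k\le n$, with $\binom{n}{k}_q=0$ if $k<0$ or $k>n$ (so the sum over $k$ is finite). $\Phi_m(q)$ is the $m$th cyclotomic polynomial. A congruence $f\equiv g \pmod{\varphi(q)}$ means $f-g = h\varphi$ for some $h\in\mathbb{Q}[q^{\pm1}]$. -}

module Defs where

open import Data.Nat as ℕ using (ℕ; zero; suc; _∸_; _≤?_)
open import Data.Nat.Divisibility using (_∣?_)
open import Data.Nat.Combinatorics using (_C_)
open import Data.Integer as ℤ using (ℤ; +_; -[1+_])
open import Data.Rational as ℚ using (ℚ; 0ℚ; 1ℚ)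
open import Data.List using (List; []; _∷_; reverse; dropWhile; replicate; _++_; length; lookup; upTo; map; foldr; last)
open import Data.Maybe using (Maybe; just; nothing)
open import Data.Vec using (Vec; []; _∷_)
open import Data.Product using (_×_; _,_; ∃)
open import Relation.Nullary using (yes; no; does)
open import Relation.Binary.PropositionalEquality using (_≡_)

-- Ordinary polynomials in q over ℚ: coefficient lists, lowest degree first.

Poly : Set
Poly = List ℚ

infixl 6 _+ₚ_
infixl 7 _*ₚ_

_+ₚ_ : Poly → Poly → Poly
[] +ₚ g = g
(a ∷ f) +ₚ [] = a ∷ f
(a ∷ f) +ₚ (b ∷ g) = (a ℚ.+ b) ∷ (f +ₚ g)

scaleₚ : ℚ → Poly → Poly
scaleₚ c = map (c ℚ.*_)

_*ₚ_ : Poly → Poly → Poly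
[] *ₚ g = []
(a ∷ f) *ₚ g = scaleₚ a g +ₚ (0ℚ ∷ (f *ₚ g))

oneₚ : Poly
oneₚ = 1ℚ ∷ []

prodₚ : List Poly → Poly
prodₚ = foldr _*ₚ_ oneₚ

trim : Poly → Poly
trim f = reverse (dropWhile (λ c → c ℚ.≟ 0ℚ) (reverse f))

-- Exact division by a monic polynomial g (long division, quotient only).
-- Works on reversed lists (leading coefficient first); gt = g without its
-- leading coefficient 1.
divRev : ℕ → List ℚ → List ℚ → List ℚ
divRev zero F gt = []
divRev (suc k) [] gt = []
divRev (suc k) (c ∷ F) gt = c ∷ divRev k (F +ₚ scaleₚ (ℚ.- c) gt) gt

divMonic : Poly → Poly → Poly
divMonic f g with reverse (trim f) | reverse (trim g)
... | F | [] = []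
... | F | (_ ∷ gt) = reverse (divRev (suc (length F) ∸ suc (length gt)) F gt)

-- Cyclotomic polynomials, by the standard recursion
--   q^m - 1 = ∏_{d ∣ m} Φ_d(q),  i.e.  Φ_m = (q^m - 1) / ∏_{d ∣ m, d < m} Φ_d.

-- q^m - 1 for m ≥ 1
qm-1 : ℕ → Poly
qm-1 m = ℚ.- 1ℚ ∷ (replicate (m ∸ 1) 0ℚ ++ (1ℚ ∷ []))

-- table m = [Φ_1, …, Φ_m]
newCyclo : ℕ → List Poly → Poly
newCyclo m prev = divMonic (qm-1 m) (prodₚ (go 1 prev))
  where
  go : ℕ → List Poly → List Poly
  go d [] = []
  go d (p ∷ ps) with d ∣? m
  ... | yes _ = p ∷ go (suc d) ps
  ... | no  _ = go (suc d) ps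

cycloTable : ℕ → List Poly
cycloTable zero = []
cycloTable (suc n) = cycloTable n ++ (newCyclo (suc n) (cycloTable n) ∷ [])

-- Φ m = the m-th cyclotomic polynomial (m ≥ 1; Φ 0 is a dummy value 1)
Φ : ℕ → Poly
Φ m with last (cycloTable m)
... | just p = p
... | nothing = oneₚ

-- Laurent polynomials in q over ℚ:  mkL s f  represents  q^s · f(q).

record LPoly : Set where
  constructor mkL
  field
    low  : ℤ
    body : Poly
open LPoly public

coeff : LPoly → ℤ → ℚ
coeff (mkL s f) i with i ℤ.- s
... | + n = lookupD f n
  where
  lookupD : Poly → ℕ → ℚ
  lookupD [] _ = 0ℚ
  lookupD (a ∷ _) zero = a
  lookupD (_ ∷ g) (suc n) = lookupD g n
... | -[1+ _ ] = 0ℚ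

infix 4 _≈L_
_≈L_ : LPoly → LPoly → Set
f ≈L g = ∀ i → coeff f i ≡ coeff g i

fromPoly : Poly → LPoly
fromPoly f = mkL (+ 0) f

constL : ℚ → LPoly
constL c = fromPoly (c ∷ [])

qpow : ℤ → LPoly
qpow e = mkL e (1ℚ ∷ [])

infixl 6 _⊕_ _⊖_
infixl 7 _⊗_

_⊕_ : LPoly → LPoly → LPoly
mkL s f ⊕ mkL t g =
  mkL (s ℤ.⊓ t)
      ((replicate ℤ.∣ s ℤ.- (s ℤ.⊓ t) ∣ 0ℚ ++ f) +ₚ
       (replicate ℤ.∣ t ℤ.- (s ℤ.⊓ t) ∣ 0ℚ ++ g))

negL : LPoly → LPoly
negL (mkL s f) = mkL s (scaleₚ (ℚ.- 1ℚ) f)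

_⊖_ : LPoly → LPoly → LPoly
f ⊖ g = f ⊕ negL g

_⊗_ : LPoly → LPoly → LPoly
mkL s f ⊗ mkL t g = mkL (s ℤ.+ t) (f *ₚ g)

zeroL : LPoly
zeroL = mkL (+ 0) []

sumL : List LPoly → LPoly
sumL = foldr _⊕_ zeroL

-- substitution q ↦ q^M  (M ≥ 1)
spread : ℕ → Poly → Poly
spread M [] = []
spread M (a ∷ f) = a ∷ (replicate (M ∸ 1) 0ℚ ++ spread M f)

substL : ℕ → LPoly → LPoly
substL M (mkL s f) = mkL (+ M ℤ.* s) (spread M f)

CongMod : LPoly → LPoly → LPoly → Set
CongMod f g φ = ∃ λ h → (f ⊖ g) ≈L (h ⊗ φ)

-- q-integers, q-factorials, q-binomials (as the exact quotient of
-- q-factorials; 0 outside 0 ≤ k ≤ n).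

qint : ℕ → Poly
qint n = replicate n 1ℚ

qfact : ℕ → Poly
qfact zero = oneₚ
qfact (suc n) = qint (suc n) *ₚ qfact n

qbinom : ℕ → ℕ → Poly
qbinom n k with k ≤? n
... | yes _ = divMonic (qfact n) (qfact k *ₚ qfact (n ∸ k))
... | no  _ = []

-- Integer polynomials in the 5 variables (n₁,n₂,n₃,n₄,k):
-- a list of monomials  (coefficient , exponent vector).

IntPoly5 : Set
IntPoly5 = List (ℤ × Vec ℕ 5)

eval5 : IntPoly5 → ℤ → ℤ → ℤ → ℤ → ℤ → ℤ
eval5 [] _ _ _ _ _ = + 0
eval5 ((c , (e₁ ∷ e₂ ∷ e₃ ∷ e₄ ∷ e₅ ∷ [])) ∷ ms) n₁ n₂ n₃ n₄ k =
  c ℤ.* (n₁ ℤ.^ e₁) ℤ.* (n₂ ℤ.^ e₂) ℤ.* (n₃ ℤ.^ e₃) ℤ.* (n₄ ℤ.^ e₄) ℤ.* (k ℤ.^ e₅)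
  ℤ.+ eval5 ms n₁ n₂ n₃ n₄ k

Homogeneous2 : IntPoly5 → Set
Homogeneous2 α = ∀ (m n₁ n₂ n₃ n₄ k : ℤ) →
  eval5 α (m ℤ.* n₁) (m ℤ.* n₂) (m ℤ.* n₃) (m ℤ.* n₄) (m ℤ.* k)
    ≡ (m ℤ.* m) ℤ.* eval5 α n₁ n₂ n₃ n₄ k

BaseCond : IntPoly5 → Set
BaseCond α = ∀ (k : ℤ) → eval5 α (+ 0) (+ 0) (+ 0) (+ 0) k ≡ k ℤ.* k

-- A_q^{(α)}(n) as a Laurent polynomial in q.  Terms with k < 0 or k > n₁
-- vanish (binom(n₁,k) = 0), so the sum runs over k = 0 … n₁.

Aq : IntPoly5 → ℕ → ℕ → ℕ → ℕ → LPoly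
Aq α n₁ n₂ n₃ n₄ = sumL (map term (upTo (suc n₁)))
  where
  term : ℕ → LPoly
  term k = qpow (eval5 α (+ n₁) (+ n₂) (+ n₃) (+ n₄) (+ k))
           ⊗ fromPoly (qbinom n₁ k *ₚ qbinom n₃ k
                       *ₚ qbinom (n₁ ℕ.+ n₂ ∸ k) n₁ *ₚ qbinom (n₃ ℕ.+ n₄ ∸ k) n₃)

A1 : ℕ → ℕ → ℕ → ℕ → ℕ
A1 n₁ n₂ n₃ n₄ = foldr ℕ._+_ 0 (map term (upTo (suc n₁)))
  where
  term : ℕ → ℕ
  term k = (n₁ C k) ℕ.* (n₃ C k) ℕ.* ((n₁ ℕ.+ n₂ ∸ k) C n₁) ℕ.* ((n₃ ℕ.+ n₄ ∸ k) C n₃)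

Rn : ℕ → ℕ → ℕ → ℕ → ℚ
Rn n₁ n₂ n₃ n₄ = ((+ (n₁ ℕ.* n₂ ℕ.+ n₃ ℕ.* n₄)) ℚ./ 2) ℚ.* ((+ A1 n₁ n₂ n₃ n₄) ℚ./ 1)

{-# OPTIONS --safe #-}
module Submission where

{-
Put x = q^m - 1 and work in R = ℚ[q]/Φ_m(q)³, where q is a unit, x³ = 0 and q^r - 1 is a unit for
0 < r < m; the Laurent polynomial congruence is an identity in R.  Here
  * modulo x, binom(ma, mb)_q is binom(a, b), and binom(ma + r, mb)_q as well for 0 ≤ r < m;
  * modulo x², (q^r - 1) binom(ma, mb - r)_q is ± q^(-r(r-1)/2) b binom(a, b) x for 0 < r < m;
  * modulo x³, the q-Vandermonde identity and the previous two facts give Straub's congruence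
      binom(ma, mb)_q ≡ binom(a, b)_{q^(m²)} - b (a - b) binom(a, b) (m² - 1)/24 x²,
    because Σ_{0<r<m} q^r / (q^r - 1)² ≡ -(m² - 1)/12 modulo x.
The terms of A_q(mn) with k = mK follow from Straub's congruence.  Those with k = mK - r, 0 < r < m,
are multiples of x²: as α(mn, k) ≡ r² modulo m, the signs and triangular powers of q cancel and they
add up to -(m² - 1)/12 K² T(K) x², where T(K) is the K-th term of A_1(n).  Altogether each T(K) gets
the coefficient -(m² - 1)/24 (n₁n₂ + n₃n₄) x².
-}

open import Defs
open import Algebra.Bundles using (CommutativeRing)
import Algebra.Properties.Ring as RingProperties
import Algebra.Solver.Ring as RingSolver
open import Algebra.Solver.Ring.AlmostCommutativeRing using (fromCommutativeRing; _-Raw-AlmostCommutative⟶_)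
open import Data.Empty using (⊥-elim)
open import Data.Integer as ℤ using (ℤ; +_; -[1+_])
import Data.Integer.Properties as ℤₚ
open import Data.List using (List; []; _∷_; applyUpTo; dropWhile; foldr; last; length; map; replicate; reverse; upTo; _++_)
import Data.List.Properties as Listₚ
open import Data.Maybe as Maybe using (Maybe; just)
open import Data.Nat as ℕ using (ℕ; zero; suc; s≤s; z≤n; _∸_)
open import Data.Nat.Combinatorics using (_C_; nCk+nC[k+1]≡[n+1]C[k+1]; k>n⇒nCk≡0; nCk≡nC[n∸k]; nCn≡1)
open import Data.Nat.Divisibility using (_∣?_)
import Data.Nat.Divisibility as ℕ-Div
open import Data.Nat.DivMod using (m%n<n; m≡m%n+[m/n]*n)
import Data.Nat.Properties as ℕₚ
open import Data.Nat.Tactic.RingSolver using (solve-∀)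
open import Data.Product using (_×_; _,_; proj₁; proj₂; ∃)
open import Data.Rational as ℚ using (ℚ; 0ℚ; 1ℚ)
import Data.Rational.Properties as ℚₚ
import Data.Rational.Unnormalised as ℚᵘ
import Data.Rational.Unnormalised.Properties as ℚᵘₚ
open import Data.Sum using (_⊎_; inj₁; inj₂)
open import Data.Vec using ([]; _∷_)
open import Level using (_⊔_)
open import Relation.Binary.Bundles using (Setoid)
open import Relation.Binary.Definitions using (tri<; tri≈; tri>)
open import Relation.Binary.PropositionalEquality as ≡ using (_≡_)
open import Relation.Binary.Structures using (IsEquivalence)
open import Relation.Nullary using (¬_; contradiction)
open import Relation.Nullary.Decidable using (yes; no; dec⇒maybe)

-- Equalities modulo x and modulo x³ have to be mixed freely. A quotient ring here keeps the carrier
-- and the operations of R and coarsens only its equality, so no reduction map occurs, and behind a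
-- factor x² an equality modulo x may be used inside R. The level x² gets no ring of its own: x is
-- nilpotent and cannot be divided out, so a multiple of x is carried together with its cofactor,
-- which is known modulo x. The sum over r is evaluated by discrete Fourier transform: 2m q^r / (q^r
-- - 1)² is the transform of i (m - i), whose total m (m² - 1)/6 produces the constant. The 24 in
-- Straub's congruence is 2 times 12: the interior Vandermonde terms enter Pascal's rule with weight
-- b + 1 over 12, and b (a - b)/2 solves the resulting recursion. All identities are kept multiplied
-- by 12 or 24 until the very end. Two facts about Φ_m reach the main argument. It divides q^m - 1,
-- whence x³ = 0; and it satisfies a Bézout identity with q^r - 1 for 0 < r < m, which makes q^r - 1
-- a unit modulo Φ_m and then, by nilpotence, modulo Φ_m³.

module Ops {a} {A : Set a} (_+_ _*_ : A → A → A) (-_ : A → A) (0# 1# : A) where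

  pow : A → ℕ → A
  pow x zero    = 1#
  pow x (suc n) = x * pow x n

  nat : ℕ → A
  nat zero    = 0#
  nat (suc n) = 1# + nat n

  Σ< : ℕ → (ℕ → A) → A
  Σ< zero    f = 0#
  Σ< (suc n) f = f 0 + Σ< n (λ i → f (suc i))

  -- Gaussian binomials by Pascal's rule instead of factorials: in the rings of interest the
  -- q-factorials need not be invertible.
  qbin : A → ℕ → ℕ → A
  qbin q n       zero    = 1#
  qbin q zero    (suc k) = 0#
  qbin q (suc n) (suc k) = qbin q n k + (pow q (suc k) * qbin q n (suc k))

  -- `w` is meant to be the inverse of `z`, which the ring operations cannot supply.
  zpow : A → A → ℤ → A
  zpow z w (+ n)      = pow z n
  zpow z w (-[1+ n ]) = pow w (suc n)

  -- sgn q (suc r) = (-1)^r q^(r(r+1)/2)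
  sgn : A → ℕ → A
  sgn q zero    = - 1#
  sgn q (suc r) = - (pow q r * sgn q r)

-- Arithmetic, finite sums and units in a commutative ring

module RingTheory {c ℓ} (R : CommutativeRing c ℓ) where

  open CommutativeRing R public
  open Ops _+_ _*_ -_ 0# 1# public
  open import Relation.Binary.Reasoning.Setoid setoid public
  open RingProperties ring using (-‿distribˡ-*; -‿distribʳ-*; -0#≈0#; -‿involutive; -‿+-comm; x[y-z]≈xy-xz)

  ≡⇒≈ : ∀ {a b} → a ≡ b → a ≈ b
  ≡⇒≈ ≡.refl = refl

  nat-+ : ∀ m n → nat (m ℕ.+ n) ≈ nat m + nat n
  nat-+ zero    n = sym (+-identityˡ _)
  nat-+ (suc m) n = trans (+-congˡ (nat-+ m n)) (sym (+-assoc _ _ _))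

  nat-* : ∀ m n → nat (m ℕ.* n) ≈ nat m * nat n
  nat-* zero    n = sym (zeroˡ _)
  nat-* (suc m) n = begin
    nat (n ℕ.+ m ℕ.* n)         ≈⟨ nat-+ n (m ℕ.* n) ⟩
    nat n + nat (m ℕ.* n)       ≈⟨ +-cong (sym (*-identityˡ _)) (nat-* m n) ⟩
    1# * nat n + nat m * nat n  ≈⟨ distribʳ _ _ _ ⟨
    (1# + nat m) * nat n        ∎

  int : ℤ → Carrier
  int (+ n)      = nat n
  int (-[1+ n ]) = - nat (suc n)

  int-neg : ∀ i → int (ℤ.- i) ≈ - int i
  int-neg (+ zero)    = sym -0#≈0#
  int-neg (+ suc n)   = refl
  int-neg (-[1+ n ])  = sym (-‿involutive _)

  int-⊖ : ∀ m n → int (m ℤ.⊖ n) ≈ nat m - nat n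
  int-⊖ m       zero    = trans (sym (+-identityʳ _)) (+-congˡ (sym -0#≈0#))
  int-⊖ zero    (suc n) = sym (+-identityˡ _)
  int-⊖ (suc m) (suc n) = begin
    int (suc m ℤ.⊖ suc n)               ≈⟨ ≡⇒≈ (≡.cong int (ℤₚ.[1+m]⊖[1+n]≡m⊖n m n)) ⟩
    int (m ℤ.⊖ n)                       ≈⟨ int-⊖ m n ⟩
    nat m - nat n                       ≈⟨ +-congʳ (trans (sym (+-identityʳ _)) (+-congˡ (sym (-‿inverseʳ 1#)))) ⟩
    (nat m + (1# - 1#)) - nat n         ≈⟨ +-congʳ (trans (sym (+-assoc _ _ _)) (+-congʳ (+-comm _ _))) ⟩
    ((1# + nat m) - 1#) - nat n         ≈⟨ +-assoc _ _ _ ⟩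
    (1# + nat m) + (- 1# - nat n)       ≈⟨ +-congˡ (-‿+-comm _ _) ⟩
    (1# + nat m) - (1# + nat n)         ∎

  int-+ : ∀ i j → int (i ℤ.+ j) ≈ int i + int j
  int-+ (+ m)      (+ n)      = nat-+ m n
  int-+ (+ m)      (-[1+ n ]) = int-⊖ m (suc n)
  int-+ (-[1+ m ]) (+ n)      = trans (int-⊖ n (suc m)) (+-comm _ _)
  int-+ (-[1+ m ]) (-[1+ n ]) = begin
    - nat (suc (suc (m ℕ.+ n)))      ≈⟨ -‿cong (≡⇒≈ (≡.cong nat (≡.cong suc (≡.sym (ℕₚ.+-suc m n))))) ⟩
    - nat (suc m ℕ.+ suc n)          ≈⟨ -‿cong (nat-+ (suc m) (suc n)) ⟩
    - (nat (suc m) + nat (suc n))    ≈⟨ -‿+-comm _ _ ⟨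
    - nat (suc m) - nat (suc n)      ∎

  int-*⁺ : ∀ m j → int (+ m ℤ.* j) ≈ nat m * int j
  int-*⁺ m (+ n)      = trans (≡⇒≈ (≡.cong int (≡.sym (ℤₚ.pos-* m n)))) (nat-* m n)
  int-*⁺ m (-[1+ n ]) = begin
    int (+ m ℤ.* -[1+ n ])       ≈⟨ ≡⇒≈ (≡.cong int (≡.sym (ℤₚ.neg-distribʳ-* (+ m) (+ suc n)))) ⟩
    int (ℤ.- (+ m ℤ.* + suc n))  ≈⟨ int-neg (+ m ℤ.* + suc n) ⟩
    - int (+ m ℤ.* + suc n)      ≈⟨ -‿cong (int-*⁺ m (+ suc n)) ⟩
    - (nat m * nat (suc n))      ≈⟨ -‿distribʳ-* _ _ ⟩
    nat m * - nat (suc n)        ∎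

  int-* : ∀ i j → int (i ℤ.* j) ≈ int i * int j
  int-* (+ m)      j = int-*⁺ m j
  int-* (-[1+ m ]) j = begin
    int (-[1+ m ] ℤ.* j)         ≈⟨ ≡⇒≈ (≡.cong int (≡.sym (ℤₚ.neg-distribˡ-* (+ suc m) j))) ⟩
    int (ℤ.- (+ suc m ℤ.* j))    ≈⟨ int-neg (+ suc m ℤ.* j) ⟩
    - int (+ suc m ℤ.* j)        ≈⟨ -‿cong (int-*⁺ (suc m) j) ⟩
    - (nat (suc m) * int j)      ≈⟨ -‿distribˡ-* _ _ ⟩
    - nat (suc m) * int j        ∎

  -- The solver's constant 1 has to denote 1# itself, not 1# + 0#.
  coef⁺ : ℕ → Carrier
  coef⁺ 1 = 1#
  coef⁺ n = nat n

  coef : ℤ → Carrier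
  coef (+ n)      = coef⁺ n
  coef (-[1+ n ]) = - coef⁺ (suc n)

  private
    coef⁺≈nat : ∀ n → coef⁺ n ≈ nat n
    coef⁺≈nat 0             = refl
    coef⁺≈nat 1             = sym (+-identityʳ 1#)
    coef⁺≈nat (suc (suc n)) = refl

    coef≈int : ∀ i → coef i ≈ int i
    coef≈int (+ n)      = coef⁺≈nat n
    coef≈int (-[1+ n ]) = -‿cong (coef⁺≈nat (suc n))

    coef-morphism : ℤ.+-*-rawRing -Raw-AlmostCommutative⟶ fromCommutativeRing R
    coef-morphism = record
      { ⟦_⟧    = coef
      ; +-homo = λ i j → trans (coef≈int (i ℤ.+ j))
                           (trans (int-+ i j) (sym (+-cong (coef≈int i) (coef≈int j))))
      ; *-homo = λ i j → trans (coef≈int (i ℤ.* j))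
                           (trans (int-* i j) (sym (*-cong (coef≈int i) (coef≈int j))))
      ; -‿homo = λ i → trans (coef≈int (ℤ.- i)) (trans (int-neg i) (-‿cong (sym (coef≈int i))))
      ; 0-homo = refl
      ; 1-homo = refl
      }

    coef≟ : ∀ i j → Maybe (coef i ≈ coef j)
    coef≟ i j = Maybe.map (λ i≡j → ≡⇒≈ (≡.cong coef i≡j)) (dec⇒maybe (i ℤ.≟ j))

  open RingSolver ℤ.+-*-rawRing (fromCommutativeRing R) coef-morphism coef≟ public
    using (solve; _:=_; con; _:+_; _:*_; _:-_; :-_)

  pow-cong : ∀ n {a b} → a ≈ b → pow a n ≈ pow b n
  pow-cong zero    a≈b = refl
  pow-cong (suc n) a≈b = *-cong a≈b (pow-cong n a≈b)

  pow-+ : ∀ a m n → pow a (m ℕ.+ n) ≈ pow a m * pow a n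
  pow-+ a zero    n = sym (*-identityˡ _)
  pow-+ a (suc m) n = trans (*-congˡ (pow-+ a m n)) (sym (*-assoc _ _ _))

  pow-1 : ∀ n → pow 1# n ≈ 1#
  pow-1 zero    = refl
  pow-1 (suc n) = trans (*-identityˡ _) (pow-1 n)

  pow-* : ∀ a m n → pow a (m ℕ.* n) ≈ pow (pow a m) n
  pow-* a m zero    = ≡⇒≈ (≡.cong (pow a) (ℕₚ.*-zeroʳ m))
  pow-* a m (suc n) = begin
    pow a (m ℕ.* suc n)         ≈⟨ ≡⇒≈ (≡.cong (pow a) (ℕₚ.*-suc m n)) ⟩
    pow a (m ℕ.+ m ℕ.* n)       ≈⟨ pow-+ a m (m ℕ.* n) ⟩
    pow a m * pow a (m ℕ.* n)   ≈⟨ *-congˡ (pow-* a m n) ⟩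
    pow a m * pow (pow a m) n   ∎

  pow-distrib : ∀ a b n → pow (a * b) n ≈ pow a n * pow b n
  pow-distrib a b zero    = sym (*-identityˡ _)
  pow-distrib a b (suc n) = trans (*-congˡ (pow-distrib a b n))
    (solve 4 (λ a b u v → a :* b :* (u :* v) := a :* u :* (b :* v)) refl a b (pow a n) (pow b n))

  Σ-cong : ∀ n {f g} → (∀ i → i ℕ.< n → f i ≈ g i) → Σ< n f ≈ Σ< n g
  Σ-cong zero    f≈g = refl
  Σ-cong (suc n) f≈g = +-cong (f≈g 0 (s≤s z≤n)) (Σ-cong n (λ i i<n → f≈g (suc i) (s≤s i<n)))

  Σ-+ : ∀ n f g → Σ< n (λ i → f i + g i) ≈ Σ< n f + Σ< n g
  Σ-+ zero    f g = sym (+-identityˡ _)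
  Σ-+ (suc n) f g = trans (+-congˡ (Σ-+ n _ _))
    (solve 4 (λ a b u v → a :+ b :+ (u :+ v) := a :+ u :+ (b :+ v)) refl (f 0) (g 0) _ _)

  Σ-*ˡ : ∀ n a f → Σ< n (λ i → a * f i) ≈ a * Σ< n f
  Σ-*ˡ zero    a f = sym (zeroʳ a)
  Σ-*ˡ (suc n) a f = trans (+-congˡ (Σ-*ˡ n a _)) (sym (distribˡ _ _ _))

  Σ-last : ∀ n f → Σ< (suc n) f ≈ Σ< n f + f n
  Σ-last zero    f = +-comm _ _
  Σ-last (suc n) f = trans (+-congˡ (Σ-last n (λ i → f (suc i)))) (sym (+-assoc _ _ _))

  Σ-zero : ∀ n → Σ< n (λ _ → 0#) ≈ 0#
  Σ-zero zero    = refl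
  Σ-zero (suc n) = trans (+-identityˡ _) (Σ-zero n)

  Σ-swap : ∀ m n (f : ℕ → ℕ → Carrier) →
    Σ< m (λ i → Σ< n (f i)) ≈ Σ< n (λ j → Σ< m (λ i → f i j))
  Σ-swap zero    n f = sym (Σ-zero n)
  Σ-swap (suc m) n f = trans (+-congˡ (Σ-swap m n (λ i → f (suc i)))) (sym (Σ-+ n (f 0) _))

  Σ-++ : ∀ m n f → Σ< (m ℕ.+ n) f ≈ Σ< m f + Σ< n (λ i → f (m ℕ.+ i))
  Σ-++ zero    n f = sym (+-identityˡ _)
  Σ-++ (suc m) n f = trans (+-congˡ (Σ-++ m n _)) (sym (+-assoc _ _ _))

  Σ-blocks : ∀ m n f → Σ< (m ℕ.* n) f ≈ Σ< n (λ j → Σ< m (λ i → f (m ℕ.* j ℕ.+ i)))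
  Σ-blocks m zero    f = ≡⇒≈ (≡.cong (λ k → Σ< k f) (ℕₚ.*-zeroʳ m))
  Σ-blocks m (suc n) f = begin
    Σ< (m ℕ.* suc n) f           ≈⟨ ≡⇒≈ (≡.cong (λ k → Σ< k f) (≡.trans (ℕₚ.*-suc m n) (ℕₚ.+-comm m _))) ⟩
    Σ< (m ℕ.* n ℕ.+ m) f         ≈⟨ Σ-++ (m ℕ.* n) m f ⟩
    Σ< (m ℕ.* n) f + Σ< m (λ i → f (m ℕ.* n ℕ.+ i))  ≈⟨ +-congʳ (Σ-blocks m n f) ⟩
    Σ< n (λ j → Σ< m (λ i → f (m ℕ.* j ℕ.+ i))) + Σ< m (λ i → f (m ℕ.* n ℕ.+ i))
      ≈⟨ Σ-last n (λ j → Σ< m (λ i → f (m ℕ.* j ℕ.+ i))) ⟨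
    Σ< (suc n) (λ j → Σ< m (λ i → f (m ℕ.* j ℕ.+ i)))  ∎

  Σ-reverse : ∀ n f → Σ< n (λ i → f (n ∸ suc i)) ≈ Σ< n f
  Σ-reverse zero    f = refl
  Σ-reverse (suc n) f = trans (+-congˡ (Σ-reverse n f)) (trans (+-comm _ _) (sym (Σ-last n f)))

  Σ-const : ∀ n a → Σ< n (λ _ → a) ≈ nat n * a
  Σ-const zero    a = sym (zeroˡ a)
  Σ-const (suc n) a = trans (+-cong (sym (*-identityˡ a)) (Σ-const n a)) (sym (distribʳ _ _ _))

  geometric : ∀ z n → (z - 1#) * Σ< n (pow z) ≈ pow z n - 1#
  geometric z zero    = trans (zeroʳ _) (sym (-‿inverseʳ 1#))
  geometric z (suc n) = begin
    (z - 1#) * Σ< (suc n) (pow z)                   ≈⟨ *-congˡ (Σ-last n (pow z)) ⟩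
    (z - 1#) * (Σ< n (pow z) + pow z n)             ≈⟨ distribˡ _ _ _ ⟩
    (z - 1#) * Σ< n (pow z) + (z - 1#) * pow z n    ≈⟨ +-congʳ (geometric z n) ⟩
    pow z n - 1# + (z - 1#) * pow z n
      ≈⟨ solve 2 (λ z p → p :- con (+ 1) :+ (z :- con (+ 1)) :* p := z :* p :- con (+ 1)) refl z (pow z n) ⟩
    z * pow z n - 1#                                ∎

  Unit : Carrier → Set (c ⊔ ℓ)
  Unit u = ∃ λ v → u * v ≈ 1#

  unit-cancel : ∀ {u a b} → Unit u → u * a ≈ u * b → a ≈ b
  unit-cancel {u} {a} {b} (v , uv) e = begin
    a            ≈⟨ *-identityˡ a ⟨
    1# * a       ≈⟨ *-congʳ uv ⟨
    u * v * a    ≈⟨ solve 3 (λ u v a → u :* v :* a := v :* (u :* a)) refl u v a ⟩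
    v * (u * a)  ≈⟨ *-congˡ e ⟩
    v * (u * b)  ≈⟨ solve 3 (λ u v a → u :* v :* a := v :* (u :* a)) refl u v b ⟨
    u * v * b    ≈⟨ *-congʳ uv ⟩
    1# * b       ≈⟨ *-identityˡ b ⟩
    b            ∎

  unit-pow : ∀ {u} n → Unit u → Unit (pow u n)
  unit-pow {u} n (v , uv) = pow v n , trans (sym (pow-distrib u v n)) (trans (pow-cong n uv) (pow-1 n))

-- Gaussian binomials over a commutative ring

module GaussianBinomials {c ℓ} (R : CommutativeRing c ℓ) where

  open RingTheory R

  qbin-cong : ∀ {q q′} → q ≈ q′ → ∀ n k → qbin q n k ≈ qbin q′ n k
  qbin-cong q≈q′ n       zero    = refl
  qbin-cong q≈q′ zero    (suc k) = refl
  qbin-cong q≈q′ (suc n) (suc k) =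
    +-cong (qbin-cong q≈q′ n k) (*-cong (pow-cong (suc k) q≈q′) (qbin-cong q≈q′ n (suc k)))

  qbin-> : ∀ q {n k} → n ℕ.< k → qbin q n k ≈ 0#
  qbin-> q {zero}  {suc k} _ = refl
  qbin-> q {suc n} {suc k} (s≤s n<k) = begin
    qbin q n k + pow q (suc k) * qbin q n (suc k)
      ≈⟨ +-cong (qbin-> q n<k) (*-congˡ (qbin-> q (ℕₚ.m<n⇒m<1+n n<k))) ⟩
    0# + pow q (suc k) * 0#  ≈⟨ solve 1 (λ p → con (ℤ.+ 0) :+ p :* con (ℤ.+ 0) := con (ℤ.+ 0)) refl _ ⟩
    0#                       ∎

  qbin-diag : ∀ q n → qbin q n n ≈ 1#
  qbin-diag q zero    = refl
  qbin-diag q (suc n) = begin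
    qbin q n n + pow q (suc n) * qbin q n (suc n)
      ≈⟨ +-cong (qbin-diag q n) (*-congˡ (qbin-> q (ℕₚ.n<1+n n))) ⟩
    1# + pow q (suc n) * 0#  ≈⟨ +-congˡ (zeroʳ _) ⟩
    1# + 0#                  ≈⟨ +-identityʳ _ ⟩
    1#                       ∎

  -- Truncated subtraction does no harm here: if k exceeds n then so does j, and both sides vanish.
  pow-∸-qbin : ∀ q n k j → k ℕ.≤ j → pow q k * (pow q (n ∸ k) * qbin q n j) ≈ pow q n * qbin q n j
  pow-∸-qbin q n k j k≤j with k ℕ.≤? n
  ... | yes k≤n = begin
    pow q k * (pow q (n ∸ k) * qbin q n j)  ≈⟨ *-assoc _ _ _ ⟨
    pow q k * pow q (n ∸ k) * qbin q n j    ≈⟨ *-congʳ (pow-+ q k (n ∸ k)) ⟨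
    pow q (k ℕ.+ (n ∸ k)) * qbin q n j      ≈⟨ *-congʳ (≡⇒≈ (≡.cong (pow q) (ℕₚ.m+[n∸m]≡n k≤n))) ⟩
    pow q n * qbin q n j                    ∎
  ... | no k≰n = begin
    pow q k * (pow q (n ∸ k) * qbin q n j)  ≈⟨ *-congˡ (*-congˡ z) ⟩
    pow q k * (pow q (n ∸ k) * 0#)          ≈⟨ trans (*-congˡ (zeroʳ _)) (zeroʳ _) ⟩
    0#                                      ≈⟨ zeroʳ _ ⟨
    pow q n * 0#                            ≈⟨ *-congˡ z ⟨
    pow q n * qbin q n j                    ∎
    where z = qbin-> q (ℕₚ.<-≤-trans (ℕₚ.≰⇒> k≰n) k≤j)

  mutual
    -- The three identities are ratios of neighbouring q-binomials with denominators cleared, since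
    -- nothing may be divided by q^k - 1. They support one induction on n: by Pascal's rule the step
    -- in k at n gives absorption and the step in n there, and these two together give the step in k
    -- at n + 1.
    qbin-absorb : ∀ q n k →
      (pow q (suc k) - 1#) * qbin q (suc n) (suc k) ≈ (pow q (suc n) - 1#) * qbin q n k
    qbin-absorb q n k = begin
      (pow q (suc k) - 1#) * (c₀ + pow q (suc k) * c₁)
        ≈⟨ solve 3 (λ p a b → (p :- con (ℤ.+ 1)) :* (a :+ p :* b) := (p :- con (ℤ.+ 1)) :* a :+ p :* ((p :- con (ℤ.+ 1)) :* b)) refl (pow q (suc k)) c₀ c₁ ⟩
      (pow q (suc k) - 1#) * c₀ + pow q (suc k) * ((pow q (suc k) - 1#) * c₁)
        ≈⟨ +-congˡ (*-congˡ (qbin-stepʳ q n k)) ⟩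
      (q * pow q k - 1#) * c₀ + q * pow q k * ((pow q (n ∸ k) - 1#) * c₀)
        ≈⟨ solve 4 (λ q p r a → (q :* p :- con (ℤ.+ 1)) :* a :+ q :* p :* ((r :- con (ℤ.+ 1)) :* a)
                   := q :* (p :* (r :* a)) :- a) refl q (pow q k) (pow q (n ∸ k)) c₀ ⟩
      q * (pow q k * (pow q (n ∸ k) * c₀)) - c₀  ≈⟨ +-congʳ (*-congˡ (pow-∸-qbin q n k k ℕₚ.≤-refl)) ⟩
      q * (pow q n * c₀) - c₀
        ≈⟨ solve 3 (λ q p a → q :* (p :* a) :- a := (q :* p :- con (ℤ.+ 1)) :* a) refl q (pow q n) c₀ ⟩
      (q * pow q n - 1#) * c₀  ∎
      where

      c₀ = qbin q n k
      c₁ = qbin q n (suc k)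

    qbin-stepˡ : ∀ q n k →
      (pow q (suc n ∸ k) - 1#) * qbin q (suc n) k ≈ (pow q (suc n) - 1#) * qbin q n k
    qbin-stepˡ q n zero    = refl
    qbin-stepˡ q n (suc k) = begin
      (pow q (n ∸ k) - 1#) * (c₀ + q * pow q k * c₁)
        ≈⟨ solve 5 (λ q p r a b → (r :- con (ℤ.+ 1)) :* (a :+ q :* p :* b)
             := (r :- con (ℤ.+ 1)) :* a :+ q :* (p :* (r :* b)) :- q :* p :* b) refl q (pow q k) (pow q (n ∸ k)) c₀ c₁ ⟩
      (pow q (n ∸ k) - 1#) * c₀ + q * (pow q k * (pow q (n ∸ k) * c₁)) - q * pow q k * c₁
        ≈⟨ +-congʳ (+-cong (sym (qbin-stepʳ q n k)) (*-congˡ (pow-∸-qbin q n k (suc k) (ℕₚ.n≤1+n k)))) ⟩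
      (q * pow q k - 1#) * c₁ + q * (pow q n * c₁) - q * pow q k * c₁
        ≈⟨ solve 4 (λ q p n b → (q :* p :- con (ℤ.+ 1)) :* b :+ q :* (n :* b) :- q :* p :* b
             := (q :* n :- con (ℤ.+ 1)) :* b) refl q (pow q k) (pow q n) c₁ ⟩
      (q * pow q n - 1#) * c₁  ∎
      where

      c₀ = qbin q n k
      c₁ = qbin q n (suc k)

    qbin-stepʳ : ∀ q n k → (pow q (suc k) - 1#) * qbin q n (suc k) ≈ (pow q (n ∸ k) - 1#) * qbin q n k
    qbin-stepʳ q zero zero    = trans (zeroʳ _) (sym (trans (*-congʳ (-‿inverseʳ _)) (zeroˡ _)))
    qbin-stepʳ q zero (suc k) = trans (zeroʳ _) (sym (zeroʳ _))
    qbin-stepʳ q (suc n) k    = trans (qbin-absorb q n k) (sym (qbin-stepˡ q n k))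

  -- Phrased for any `i` with the defining property of the q-integer, so that it applies to the list
  -- `qint n`; `q * 1#` is `pow q 1` unfolded.
  q-integer-suc : ∀ q n {i} → i * (q * 1# - 1#) ≈ pow q n - 1# → (1# + q * i) * (q * 1# - 1#) ≈ pow q (suc n) - 1#
  q-integer-suc q n {i} e = begin
    (1# + q * i) * (q * 1# - 1#)
      ≈⟨ solve 2 (λ q i → (con (ℤ.+ 1) :+ q :* i) :* (q :* con (ℤ.+ 1) :- con (ℤ.+ 1))
           := q :- con (ℤ.+ 1) :+ q :* (i :* (q :* con (ℤ.+ 1) :- con (ℤ.+ 1)))) refl q i ⟩
    q - 1# + q * (i * (q * 1# - 1#))      ≈⟨ +-congˡ (*-congˡ e) ⟩
    q - 1# + q * (pow q n - 1#)           ≈⟨ solve 2 (λ q p → q :- con (ℤ.+ 1) :+ q :* (p :- con (ℤ.+ 1)) := q :* p :- con (ℤ.+ 1)) refl q (pow q n) ⟩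
    q * pow q n - 1#                      ∎

  -- Absorption for q-integers. Only cancellability of q - 1 is asked for: in the polynomial ring q
  -- - 1 is monic but not a unit.
  q-integer-absorb : ∀ q n k {i j} → (∀ {a b} → a * (q * 1# - 1#) ≈ b * (q * 1# - 1#) → a ≈ b) →
    i * (q * 1# - 1#) ≈ pow q (suc k) - 1# → j * (q * 1# - 1#) ≈ pow q (suc n) - 1# →
    i * qbin q (suc n) (suc k) ≈ j * qbin q n k
  q-integer-absorb q n k {i} {j} cancel ei ej = cancel (begin
    i * b * w                   ≈⟨ solve 3 (λ i b w → i :* b :* w := i :* w :* b) refl i b w ⟩
    i * w * b                   ≈⟨ *-congʳ ei ⟩
    (pow q (suc k) - 1#) * b    ≈⟨ qbin-absorb q n k ⟩
    (pow q (suc n) - 1#) * b′   ≈⟨ *-congʳ ej ⟨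
    j * w * b′                  ≈⟨ solve 3 (λ i b w → i :* b :* w := i :* w :* b) refl j b′ w ⟨
    j * b′ * w                  ∎)
    where
    b = qbin q (suc n) (suc k)
    b′ = qbin q n k
    w = q * 1# - 1#

  -- The inductive step of `qfact-qbin`: f, g, h are the q-factorials of n, k, n - k, and i, j the
  -- q-integers of k + 1, n + 1.
  factorial-suc : ∀ {f g h b b′ i j} → i * b′ ≈ j * b → f ≈ b * (g * h) → j * f ≈ b′ * (i * g * h)
  factorial-suc {f} {g} {h} {b} {b′} {i} {j} e e′ = begin
    j * f                ≈⟨ *-congˡ e′ ⟩
    j * (b * (g * h))    ≈⟨ *-assoc j b (g * h) ⟨
    j * b * (g * h)      ≈⟨ *-congʳ e ⟨
    i * b′ * (g * h)     ≈⟨ solve 4 (λ i b g h → i :* b :* (g :* h) := b :* (i :* g :* h)) refl i b′ g h ⟩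
    b′ * (i * g * h)     ∎

  qbin-pascalʳ : ∀ q n k → qbin q (suc n) (suc k) ≈ pow q (n ∸ k) * qbin q n k + qbin q n (suc k)
  qbin-pascalʳ q n k = begin
    c₀ + p * c₁                  ≈⟨ solve 3 (λ a p b → a :+ p :* b := a :+ (p :- con (ℤ.+ 1)) :* b :+ b) refl c₀ p c₁ ⟩
    c₀ + (p - 1#) * c₁ + c₁      ≈⟨ +-congʳ (+-congˡ (qbin-stepʳ q n k)) ⟩
    c₀ + (r - 1#) * c₀ + c₁      ≈⟨ solve 3 (λ a r b → a :+ (r :- con (ℤ.+ 1)) :* a :+ b := r :* a :+ b) refl c₀ r c₁ ⟩
    r * c₀ + c₁                  ∎
    where

    c₀ = qbin q n k
    c₁ = qbin q n (suc k)
    p = pow q (suc k)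
    r = pow q (n ∸ k)

  -- The factor q^k turns the truncated exponent `n ∸ k` into n, so that the identity can be used
  -- without comparing k and n.
  qbin-stepʳ′ : ∀ q n k → pow q k * ((pow q (suc k) - 1#) * qbin q n (suc k)) ≈ (pow q n - pow q k) * qbin q n k
  qbin-stepʳ′ q n k = begin
    pow q k * ((pow q (suc k) - 1#) * qbin q n (suc k))        ≈⟨ *-congˡ (qbin-stepʳ q n k) ⟩
    pow q k * ((pow q (n ∸ k) - 1#) * c₀)
      ≈⟨ solve 3 (λ p r a → p :* ((r :- con (ℤ.+ 1)) :* a) := p :* (r :* a) :- p :* a) refl (pow q k) (pow q (n ∸ k)) c₀ ⟩
    pow q k * (pow q (n ∸ k) * c₀) - pow q k * c₀               ≈⟨ +-congʳ (pow-∸-qbin q n k k ℕₚ.≤-refl) ⟩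
    pow q n * c₀ - pow q k * c₀
      ≈⟨ solve 3 (λ p r a → p :* a :- r :* a := (p :- r) :* a) refl (pow q n) (pow q k) c₀ ⟩
    (pow q n - pow q k) * c₀                                   ∎
    where

    c₀ = qbin q n k

  qbin-stepˡ′ : ∀ q n k → (pow q (suc n) - pow q k) * qbin q (suc n) k ≈ pow q k * ((pow q (suc n) - 1#) * qbin q n k)
  qbin-stepˡ′ q n k = begin
    (pow q (suc n) - pow q k) * c₀
      ≈⟨ solve 3 (λ p r a → p :* a :- r :* a := (p :- r) :* a) refl (pow q (suc n)) (pow q k) c₀ ⟨
    pow q (suc n) * c₀ - pow q k * c₀                                  ≈⟨ +-congʳ (pow-∸-qbin q (suc n) k k ℕₚ.≤-refl) ⟨
    pow q k * (pow q (suc n ∸ k) * c₀) - pow q k * c₀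
      ≈⟨ solve 3 (λ p r a → p :* ((r :- con (ℤ.+ 1)) :* a) := p :* (r :* a) :- p :* a) refl (pow q k) (pow q (suc n ∸ k)) c₀ ⟨
    pow q k * ((pow q (suc n ∸ k) - 1#) * c₀)                          ≈⟨ *-congˡ (qbin-stepˡ q n k) ⟩
    pow q k * ((pow q (suc n) - 1#) * qbin q n k)                      ∎
    where

    c₀ = qbin q (suc n) k

  -- The summand i takes N - i elements from the N and j + i from the M. With the lower index
  -- written as j + N neither the indices nor the exponent contain a subtraction. In the induction
  -- on N, Pascal's rule splits the left side into the cases j and j + 1, and `qbin-pascalʳ` merges
  -- the two sums after a shift of i by one.
  qbin-vandermonde : ∀ q M N j →
    qbin q (M ℕ.+ N) (j ℕ.+ N) ≈ Σ< (suc N) (λ i → qbin q N i * (qbin q M (j ℕ.+ i) * pow q ((j ℕ.+ i) ℕ.* i)))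
  qbin-vandermonde q M zero j = begin
    qbin q (M ℕ.+ 0) (j ℕ.+ 0)                                ≈⟨ ≡⇒≈ (≡.cong (λ n → qbin q n (j ℕ.+ 0)) (ℕₚ.+-identityʳ M)) ⟩
    c₀                                                        ≈⟨ solve 1 (λ a → con (ℤ.+ 1) :* (a :* con (ℤ.+ 1)) :+ con (ℤ.+ 0) := a) refl c₀ ⟨
    1# * (c₀ * 1#) + 0#                                       ≈⟨ +-congʳ (*-congˡ (*-congˡ (≡⇒≈ (≡.cong (pow q) (≡.sym (ℕₚ.*-zeroʳ (j ℕ.+ 0))))))) ⟩
    1# * (c₀ * pow q ((j ℕ.+ 0) ℕ.* 0)) + 0#                  ∎
    where

    c₀ = qbin q M (j ℕ.+ 0)
  qbin-vandermonde q M (suc N) j = begin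
    qbin q (M ℕ.+ suc N) (j ℕ.+ suc N)  ≈⟨ ≡⇒≈ (≡.cong₂ (qbin q) (ℕₚ.+-suc M N) (ℕₚ.+-suc j N)) ⟩
    qbin q (M ℕ.+ N) (j ℕ.+ N) + pow q (suc (j ℕ.+ N)) * qbin q (M ℕ.+ N) (suc j ℕ.+ N)
      ≈⟨ +-cong (qbin-vandermonde q M N j) (*-congˡ (qbin-vandermonde q M N (suc j))) ⟩
    Σ< (suc N) (λ i → qbin q N i * g i) + Q * Σ< (suc N) (λ i → qbin q N i * g′ i)
      -- The first sum is extended by its vanishing summand i = N + 1; once its summand i = 0 is
      -- split off, it has as many summands as the second.
      ≈⟨ +-cong (sym (trans (Σ-last (suc N) (λ i → qbin q N i * g i))
                  (trans (+-congˡ (trans (*-congʳ (qbin-> q (ℕₚ.n<1+n N))) (zeroˡ _))) (+-identityʳ _))))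
                (sym (Σ-*ˡ (suc N) Q (λ i → qbin q N i * g′ i))) ⟩
    Σ< (suc (suc N)) (λ i → qbin q N i * g i) + Σ< (suc N) (λ i → Q * (qbin q N i * g′ i))
      ≈⟨ solve 3 (λ a b d → a :+ b :+ d := a :+ (d :+ b)) refl (qbin q N 0 * g 0) _ _ ⟩
    1# * g 0 + (Σ< (suc N) (λ i → Q * (qbin q N i * g′ i)) + Σ< (suc N) (λ i → qbin q N (suc i) * g (suc i)))
      ≈⟨ +-congˡ (Σ-+ (suc N) (λ i → Q * (qbin q N i * g′ i)) (λ i → qbin q N (suc i) * g (suc i))) ⟨
    1# * g 0 + Σ< (suc N) (λ i → Q * (qbin q N i * g′ i) + qbin q N (suc i) * g (suc i))
      ≈⟨ +-congˡ (Σ-cong (suc N) (λ i _ → combine i)) ⟩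
    1# * g 0 + Σ< (suc N) (λ i → qbin q (suc N) (suc i) * g (suc i))  ∎
    where

    exponents : ∀ i j d → suc (j ℕ.+ (d ℕ.+ i)) ℕ.+ (suc j ℕ.+ i) ℕ.* i ≡ d ℕ.+ (j ℕ.+ suc i) ℕ.* suc i
    exponents = solve-∀
    g g′ : ℕ → Carrier
    g i = qbin q M (j ℕ.+ i) * pow q ((j ℕ.+ i) ℕ.* i)
    g′ i = qbin q M (suc j ℕ.+ i) * pow q ((suc j ℕ.+ i) ℕ.* i)
    Q = pow q (suc (j ℕ.+ N))
    exponent : ∀ i → i ℕ.≤ N → suc (j ℕ.+ N) ℕ.+ (suc j ℕ.+ i) ℕ.* i ≡ (N ∸ i) ℕ.+ (j ℕ.+ suc i) ℕ.* suc i
    exponent i i≤N = ≡.trans (≡.cong (λ n → suc (j ℕ.+ n) ℕ.+ (suc j ℕ.+ i) ℕ.* i) (≡.sym (ℕₚ.m∸n+n≡m i≤N)))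
      (exponents i j (N ∸ i))
    shift : ∀ i → Q * (qbin q N i * g′ i) ≈ pow q (N ∸ i) * qbin q N i * g (suc i)
    shift i with i ℕ.≤? N
    ... | yes i≤N = begin
      Q * (qbin q N i * (qbin q M (suc j ℕ.+ i) * pow q ((suc j ℕ.+ i) ℕ.* i)))
        ≈⟨ solve 4 (λ Q a b p → Q :* (a :* (b :* p)) := a :* (b :* (Q :* p))) refl Q (qbin q N i) _ _ ⟩
      qbin q N i * (qbin q M (suc j ℕ.+ i) * (Q * pow q ((suc j ℕ.+ i) ℕ.* i)))
        ≈⟨ *-congˡ (*-cong (≡⇒≈ (≡.cong (qbin q M) (≡.sym (ℕₚ.+-suc j i)))) (sym (pow-+ q (suc (j ℕ.+ N)) _))) ⟩
      qbin q N i * (qbin q M (j ℕ.+ suc i) * pow q (suc (j ℕ.+ N) ℕ.+ (suc j ℕ.+ i) ℕ.* i))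
        ≈⟨ *-congˡ (*-congˡ (trans (≡⇒≈ (≡.cong (pow q) (exponent i i≤N))) (pow-+ q (N ∸ i) _))) ⟩
      qbin q N i * (qbin q M (j ℕ.+ suc i) * (pow q (N ∸ i) * pow q ((j ℕ.+ suc i) ℕ.* suc i)))
        ≈⟨ solve 4 (λ a b r p → a :* (b :* (r :* p)) := r :* a :* (b :* p)) refl (qbin q N i) _ _ _ ⟩
      pow q (N ∸ i) * qbin q N i * g (suc i)  ∎
    ... | no i≰N = begin
      Q * (qbin q N i * g′ i)                 ≈⟨ *-congˡ (*-congʳ z) ⟩
      Q * (0# * g′ i)                         ≈⟨ solve 4 (λ Q a r b → Q :* (con (ℤ.+ 0) :* a) := r :* con (ℤ.+ 0) :* b) refl Q (g′ i) (pow q (N ∸ i)) (g (suc i)) ⟩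
      pow q (N ∸ i) * 0# * g (suc i)          ≈⟨ *-congʳ (*-congˡ z) ⟨
      pow q (N ∸ i) * qbin q N i * g (suc i)  ∎
      where z = qbin-> q (ℕₚ.≰⇒> i≰N)
    combine : ∀ i → Q * (qbin q N i * g′ i) + qbin q N (suc i) * g (suc i) ≈ qbin q (suc N) (suc i) * g (suc i)
    combine i = begin
      Q * (qbin q N i * g′ i) + qbin q N (suc i) * g (suc i)                        ≈⟨ +-congʳ (shift i) ⟩
      pow q (N ∸ i) * qbin q N i * g (suc i) + qbin q N (suc i) * g (suc i)         ≈⟨ distribʳ _ _ _ ⟨
      (pow q (N ∸ i) * qbin q N i + qbin q N (suc i)) * g (suc i)                   ≈⟨ *-congʳ (qbin-pascalʳ q N i) ⟨
      qbin q (suc N) (suc i) * g (suc i)                                            ∎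

  -- The first and the last summand of the Vandermonde sum are the two terms of the Pascal
  -- recursion at the base q^(m²), for M = m a, j = m b and m = suc p.
  qbin-vandermonde-ends : ∀ q M p j →
    qbin q (M ℕ.+ suc p) (j ℕ.+ suc p) ≈
      qbin q M j
      + Σ< p (λ i → qbin q (suc p) (suc i) * (qbin q M (j ℕ.+ suc i) * pow q ((j ℕ.+ suc i) ℕ.* suc i)))
      + pow q ((j ℕ.+ suc p) ℕ.* suc p) * qbin q M (j ℕ.+ suc p)
  qbin-vandermonde-ends q M p j = begin
    qbin q (M ℕ.+ suc p) (j ℕ.+ suc p)       ≈⟨ qbin-vandermonde q M (suc p) j ⟩
    F 0 + Σ< (suc p) (λ i → F (suc i))       ≈⟨ +-cong first (Σ-last p (λ i → F (suc i))) ⟩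
    qbin q M j + (Σ< p (λ i → F (suc i)) + F (suc p))  ≈⟨ +-assoc _ _ _ ⟨
    qbin q M j + Σ< p (λ i → F (suc i)) + F (suc p)    ≈⟨ +-congˡ (trans (*-congʳ (qbin-diag q (suc p))) (trans (*-identityˡ _) (*-comm _ _))) ⟩
    qbin q M j + Σ< p (λ i → F (suc i)) + pow q ((j ℕ.+ suc p) ℕ.* suc p) * qbin q M (j ℕ.+ suc p)  ∎
    where
    F : ℕ → Carrier
    F i = qbin q (suc p) i * (qbin q M (j ℕ.+ i) * pow q ((j ℕ.+ i) ℕ.* i))
    first : F 0 ≈ qbin q M j
    first = begin
      1# * (qbin q M (j ℕ.+ 0) * pow q ((j ℕ.+ 0) ℕ.* 0))  ≈⟨ *-identityˡ _ ⟩
      qbin q M (j ℕ.+ 0) * pow q ((j ℕ.+ 0) ℕ.* 0)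
        ≈⟨ *-cong (≡⇒≈ (≡.cong (qbin q M) (ℕₚ.+-identityʳ j))) (≡⇒≈ (≡.cong (pow q) (ℕₚ.*-zeroʳ (j ℕ.+ 0)))) ⟩
      qbin q M j * 1#                                      ≈⟨ *-identityʳ _ ⟩
      qbin q M j                                           ∎

m*[1+n]≡m*n+m : ∀ m n → m ℕ.* suc n ≡ m ℕ.* n ℕ.+ m
m*[1+n]≡m*n+m m n = ≡.trans (ℕₚ.*-suc m n) (ℕₚ.+-comm m _)

complement : ∀ {p i} → i ℕ.< p → suc i ℕ.+ suc (p ∸ suc i) ≡ suc p
complement {p} {i} i<p = ≡.trans (ℕₚ.+-suc (suc i) (p ∸ suc i)) (≡.cong suc (ℕₚ.m+[n∸m]≡n i<p))

complement< : ∀ {p i} → i ℕ.< p → p ∸ suc i ℕ.< p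
complement< {p} {i} i<p = ℕₚ.≤-trans (ℕₚ.+-monoˡ-≤ (p ∸ suc i) (s≤s (z≤n {i}))) (ℕₚ.≤-reflexive (ℕₚ.m+[n∸m]≡n i<p))

-- Ordinary binomials as ring elements

module OrdinaryBinomials {c ℓ} (R : CommutativeRing c ℓ) where

  open RingTheory R

  binom : ℕ → ℕ → Carrier
  binom n k = nat (n C k)

  binom-0 : ∀ n → binom n 0 ≈ 1#
  binom-0 n = trans (≡⇒≈ (≡.cong nat (≡.trans (nCk≡nC[n∸k] {0} {n} z≤n) (nCn≡1 n)))) (+-identityʳ 1#)

  binom-> : ∀ {n k} → n ℕ.< k → binom n k ≈ 0#
  binom-> n<k = ≡⇒≈ (≡.cong nat (k>n⇒nCk≡0 n<k))

  binom-pascal : ∀ n k → binom (suc n) (suc k) ≈ binom n k + binom n (suc k)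
  binom-pascal n k = trans (≡⇒≈ (≡.cong nat (≡.sym (nCk+nC[k+1]≡[n+1]C[k+1] n k)))) (nat-+ (n C k) (n C suc k))

  -- Subtraction takes place in the ring, so all n and k are covered. This relation closes the
  -- recursion for the correction term in `qbin-ljunggren`.
  binom-stepʳ : ∀ n k → nat (suc k) * binom n (suc k) ≈ (nat n - nat k) * binom n k
  binom-stepʳ zero zero    = trans (zeroʳ _) (sym (trans (*-congʳ (-‿inverseʳ _)) (zeroˡ _)))
  binom-stepʳ zero (suc k) = trans (trans (*-congˡ (binom-> {0} {suc (suc k)} (s≤s z≤n))) (zeroʳ _))
                               (sym (trans (*-congˡ (binom-> {0} {suc k} (s≤s z≤n))) (zeroʳ _)))
  binom-stepʳ (suc n) zero = begin
    nat 1 * binom (suc n) 1             ≈⟨ *-congˡ (trans (binom-pascal n 0) (+-congʳ (binom-0 n))) ⟩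
    nat 1 * (1# + binom n 1)            ≈⟨ solve 1 (λ b → (con (ℤ.+ 1) :+ con (ℤ.+ 0)) :* (con (ℤ.+ 1) :+ b) := con (ℤ.+ 1) :+ (con (ℤ.+ 1) :+ con (ℤ.+ 0)) :* b) refl (binom n 1) ⟩
    1# + nat 1 * binom n 1              ≈⟨ +-congˡ (trans (binom-stepʳ n 0) (*-congˡ (binom-0 n))) ⟩
    1# + (nat n - nat 0) * 1#           ≈⟨ solve 1 (λ n → con (ℤ.+ 1) :+ (n :- con (ℤ.+ 0)) :* con (ℤ.+ 1) := (con (ℤ.+ 1) :+ n :- con (ℤ.+ 0)) :* con (ℤ.+ 1)) refl (nat n) ⟩
    (nat (suc n) - nat 0) * 1#          ≈⟨ *-congˡ (binom-0 (suc n)) ⟨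
    (nat (suc n) - nat 0) * binom (suc n) 0  ∎
  binom-stepʳ (suc n) (suc k) = begin
    nat (suc (suc k)) * binom (suc n) (suc (suc k))   ≈⟨ *-congˡ (binom-pascal n (suc k)) ⟩
    (1# + nat (suc k)) * (c₁ + binom n (suc (suc k))) ≈⟨ distribˡ _ _ _ ⟩
    (1# + nat (suc k)) * c₁ + nat (suc (suc k)) * binom n (suc (suc k))
      ≈⟨ +-congˡ (binom-stepʳ n (suc k)) ⟩
    (1# + nat (suc k)) * c₁ + (nat n - nat (suc k)) * c₁
      ≈⟨ solve 3 (λ n k a → (con (ℤ.+ 1) :+ (con (ℤ.+ 1) :+ k)) :* a :+ (n :- (con (ℤ.+ 1) :+ k)) :* a
           := (con (ℤ.+ 1) :+ k) :* a :+ (n :- k) :* a) refl (nat n) (nat k) c₁ ⟩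
    nat (suc k) * c₁ + (nat n - nat k) * c₁           ≈⟨ +-congʳ (binom-stepʳ n k) ⟩
    (nat n - nat k) * binom n k + (nat n - nat k) * c₁
      ≈⟨ solve 4 (λ n k a b → (n :- k) :* a :+ (n :- k) :* b := ((con (ℤ.+ 1) :+ n) :- (con (ℤ.+ 1) :+ k)) :* (a :+ b)) refl (nat n) (nat k) _ _ ⟩
    (nat (suc n) - nat (suc k)) * (binom n k + c₁)    ≈⟨ *-congˡ (binom-pascal n k) ⟨
    (nat (suc n) - nat (suc k)) * binom (suc n) (suc k)  ∎
    where c₁ = binom n (suc k)

-- Modulo x: Gaussian binomials and sums at a primitive m-th root of unity

module RootOfUnity {c ℓ} (S : CommutativeRing c ℓ) (q : CommutativeRing.Carrier S) (p : ℕ)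
  (q^m≈1 : CommutativeRing._≈_ S (RingTheory.pow S q (suc p)) (CommutativeRing.1# S))
  (y : ℕ → CommutativeRing.Carrier S)
  (y-inverse : ∀ r → r ℕ.< p → CommutativeRing._≈_ S
    (CommutativeRing._*_ S (CommutativeRing._-_ S (RingTheory.pow S q (suc r)) (CommutativeRing.1# S)) (y r))
    (CommutativeRing.1# S))
  where

  open RingTheory S
  open GaussianBinomials S
  open OrdinaryBinomials S

  private
    m = suc p

    q^r-1-unit : ∀ r → r ℕ.< p → Unit (pow q (suc r) - 1#)
    q^r-1-unit r r<p = y r , y-inverse r r<p

  pow-multiple : ∀ a → pow q (m ℕ.* a) ≈ 1#
  pow-multiple a = trans (pow-* q m a) (trans (pow-cong a q^m≈1) (pow-1 a))

  pow-mod : ∀ a r → pow q (m ℕ.* a ℕ.+ r) ≈ pow q r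
  pow-mod a r = trans (pow-+ q (m ℕ.* a) r) (trans (*-congʳ (pow-multiple a)) (*-identityˡ _))

  qbin-m-middle : ∀ i → i ℕ.< p → qbin q m (suc i) ≈ 0#
  qbin-m-middle i i<p = unit-cancel (q^r-1-unit i i<p) (begin
    (pow q (suc i) - 1#) * qbin q m (suc i)  ≈⟨ qbin-absorb q p i ⟩
    (pow q m - 1#) * qbin q p i              ≈⟨ *-congʳ (trans (+-congʳ q^m≈1) (-‿inverseʳ _)) ⟩
    0# * qbin q p i                          ≈⟨ trans (zeroˡ _) (sym (zeroʳ _)) ⟩
    (pow q (suc i) - 1#) * 0#                ∎)

  -- Vandermonde with m further elements: the interior summands contain binom(m, i)_q = 0, and the
  -- two outer ones are Pascal's rule for `binom`.
  qbin-multiples : ∀ a b → qbin q (m ℕ.* a) (m ℕ.* b) ≈ binom a b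
  qbin-multiples a zero = begin
    qbin q (m ℕ.* a) (m ℕ.* 0)   ≈⟨ ≡⇒≈ (≡.cong (qbin q (m ℕ.* a)) (ℕₚ.*-zeroʳ m)) ⟩
    1#                           ≈⟨ binom-0 a ⟨
    binom a 0                    ∎
  qbin-multiples zero (suc b) = begin
    qbin q (m ℕ.* 0) (m ℕ.* suc b)  ≈⟨ ≡⇒≈ (≡.cong (λ n → qbin q n (m ℕ.* suc b)) (ℕₚ.*-zeroʳ m)) ⟩
    0#                              ≈⟨ binom-> {0} {suc b} (s≤s z≤n) ⟨
    binom 0 (suc b)                 ∎
  qbin-multiples (suc a) (suc b) = begin
    qbin q (m ℕ.* suc a) (m ℕ.* suc b)
      ≈⟨ ≡⇒≈ (≡.cong₂ (qbin q) (m*[1+n]≡m*n+m m a) (m*[1+n]≡m*n+m m b)) ⟩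
    qbin q (m ℕ.* a ℕ.+ m) (m ℕ.* b ℕ.+ m)   ≈⟨ qbin-vandermonde-ends q (m ℕ.* a) p (m ℕ.* b) ⟩
    qbin q (m ℕ.* a) (m ℕ.* b) + Σ< p F + pow q ((m ℕ.* b ℕ.+ m) ℕ.* m) * qbin q (m ℕ.* a) (m ℕ.* b ℕ.+ m)
      ≈⟨ +-cong (+-cong (qbin-multiples a b) (trans (Σ-cong p middle) (Σ-zero p))) (*-cong last-power last-qbin) ⟩
    binom a b + 0# + 1# * binom a (suc b)
      ≈⟨ solve 2 (λ x y → x :+ con (ℤ.+ 0) :+ con (ℤ.+ 1) :* y := x :+ y) refl _ _ ⟩
    binom a b + binom a (suc b)              ≈⟨ binom-pascal a b ⟨
    binom (suc a) (suc b)                    ∎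
    where
    F : ℕ → Carrier
    F i = qbin q m (suc i) * (qbin q (m ℕ.* a) (m ℕ.* b ℕ.+ suc i) * pow q ((m ℕ.* b ℕ.+ suc i) ℕ.* suc i))
    middle : ∀ i → i ℕ.< p → F i ≈ 0#
    middle i i<p = trans (*-congʳ (qbin-m-middle i i<p)) (zeroˡ _)
    last-power : pow q ((m ℕ.* b ℕ.+ m) ℕ.* m) ≈ 1#
    last-power = trans (≡⇒≈ (≡.cong (pow q) (ℕₚ.*-comm (m ℕ.* b ℕ.+ m) m))) (pow-multiple (m ℕ.* b ℕ.+ m))
    last-qbin : qbin q (m ℕ.* a) (m ℕ.* b ℕ.+ m) ≈ binom a (suc b)
    last-qbin = trans (≡⇒≈ (≡.cong (qbin q (m ℕ.* a)) (≡.sym (m*[1+n]≡m*n+m m b)))) (qbin-multiples a (suc b))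

  -- Raising the upper index from mM + r to mM + r + 1 multiplies both sides of `qbin-stepˡ′` by the
  -- same unit q^(r+1) - 1, as long as r + 1 < m.
  qbin-lucas : ∀ M n r → r ℕ.≤ p → qbin q (m ℕ.* M ℕ.+ r) (m ℕ.* n) ≈ binom M n
  qbin-lucas M n zero _ =
    trans (≡⇒≈ (≡.cong (λ k → qbin q k (m ℕ.* n)) (ℕₚ.+-identityʳ (m ℕ.* M)))) (qbin-multiples M n)
  qbin-lucas M n (suc r) r<p = unit-cancel (q^r-1-unit r r<p) (begin
    (pow q (suc r) - 1#) * qbin q (m ℕ.* M ℕ.+ suc r) (m ℕ.* n)
      ≈⟨ *-cong (+-cong (trans (sym (pow-mod M (suc r))) (≡⇒≈ (≡.cong (pow q) e))) (-‿cong (sym (pow-multiple n))))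
                (≡⇒≈ (≡.cong (λ k → qbin q k (m ℕ.* n)) e)) ⟩
    (pow q (suc N) - pow q (m ℕ.* n)) * qbin q (suc N) (m ℕ.* n)   ≈⟨ qbin-stepˡ′ q N (m ℕ.* n) ⟩
    pow q (m ℕ.* n) * ((pow q (suc N) - 1#) * qbin q N (m ℕ.* n))
      ≈⟨ *-cong (pow-multiple n) (*-cong (+-congʳ (trans (≡⇒≈ (≡.cong (pow q) (≡.sym e))) (pow-mod M (suc r))))
                                         (qbin-lucas M n r (ℕₚ.<⇒≤ r<p))) ⟩
    1# * ((pow q (suc r) - 1#) * binom M n)                         ≈⟨ *-identityˡ _ ⟩
    (pow q (suc r) - 1#) * binom M n                                ∎)
    where
    N = m ℕ.* M ℕ.+ r
    e : m ℕ.* M ℕ.+ suc r ≡ suc N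
    e = ℕₚ.+-suc (m ℕ.* M) r

  summation-by-parts : ∀ z (w : ℕ → Carrier) n →
    (z - 1#) * Σ< n (λ i → w i * pow z i) ≈
      w n * pow z n - w 0 - z * Σ< n (λ i → (w (suc i) - w i) * pow z i)
  summation-by-parts z w zero = solve 2 (λ z a → (z :- con (ℤ.+ 1)) :* con (ℤ.+ 0)
      := a :* con (ℤ.+ 1) :- a :- z :* con (ℤ.+ 0)) refl z (w 0)
  summation-by-parts z w (suc n) = begin
    (z - 1#) * Σ< (suc n) (λ i → w i * pow z i)                     ≈⟨ *-congˡ (Σ-last n (λ i → w i * pow z i)) ⟩
    (z - 1#) * (Σ< n (λ i → w i * pow z i) + w n * pow z n)         ≈⟨ distribˡ _ _ _ ⟩
    (z - 1#) * Σ< n (λ i → w i * pow z i) + (z - 1#) * (w n * pow z n)  ≈⟨ +-congʳ (summation-by-parts z w n) ⟩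
    w n * pow z n - w 0 - z * D + (z - 1#) * (w n * pow z n)
      ≈⟨ solve 6 (λ z a b d p e → a :* p :- b :- z :* d :+ (z :- con (ℤ.+ 1)) :* (a :* p)
           := e :* (z :* p) :- b :- z :* (d :+ (e :- a) :* p)) refl z (w n) (w 0) D (pow z n) (w (suc n)) ⟩
    w (suc n) * pow z (suc n) - w 0 - z * (D + (w (suc n) - w n) * pow z n)
      ≈⟨ +-congˡ (-‿cong (*-congˡ (Σ-last n (λ i → (w (suc i) - w i) * pow z i)))) ⟨
    w (suc n) * pow z (suc n) - w 0 - z * Σ< (suc n) (λ i → (w (suc i) - w i) * pow z i)  ∎
    where D = Σ< n (λ i → (w (suc i) - w i) * pow z i)

  private
    weight : ℕ → Carrier
    weight i = nat i * (nat m - nat i)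

  -- At n = m the right side is m (m² - 1): the origin of the factor m² - 1.
  6Σweight : ∀ n → nat 6 * Σ< n weight ≈ nat n * (nat n - 1#) * (nat 3 * nat m - (nat 2 * nat n - 1#))
  6Σweight zero    = solve 1 (λ a → con (ℤ.+ 6) :* con (ℤ.+ 0) := con (ℤ.+ 0) :* (con (ℤ.+ 0) :- con (ℤ.+ 1)) :* a) refl _
  6Σweight (suc n) = begin
    nat 6 * Σ< (suc n) weight             ≈⟨ trans (*-congˡ (Σ-last n weight)) (distribˡ _ _ _) ⟩
    nat 6 * Σ< n weight + nat 6 * weight n  ≈⟨ +-congʳ (6Σweight n) ⟩
    nat n * (nat n - 1#) * (nat 3 * nat m - (nat 2 * nat n - 1#)) + nat 6 * (nat n * (nat m - nat n))
      ≈⟨ solve 2 (λ n m → n :* (n :- con (ℤ.+ 1)) :* (con (ℤ.+ 3) :* m :- (con (ℤ.+ 2) :* n :- con (ℤ.+ 1)))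
                            :+ con (ℤ.+ 6) :* (n :* (m :- n))
           := (con (ℤ.+ 1) :+ n) :* (con (ℤ.+ 1) :+ n :- con (ℤ.+ 1))
              :* (con (ℤ.+ 3) :* m :- (con (ℤ.+ 2) :* (con (ℤ.+ 1) :+ n) :- con (ℤ.+ 1)))) refl (nat n) (nat m) ⟩
    nat (suc n) * (nat (suc n) - 1#) * (nat 3 * nat m - (nat 2 * nat (suc n) - 1#))  ∎

  Σpow-root : ∀ r → r ℕ.< p → Σ< m (pow (pow q (suc r))) ≈ 0#
  Σpow-root r r<p = unit-cancel (q^r-1-unit r r<p) (begin
    (pow q (suc r) - 1#) * Σ< m (pow (pow q (suc r)))  ≈⟨ geometric (pow q (suc r)) m ⟩
    pow (pow q (suc r)) m - 1#                         ≈⟨ +-congʳ (root^m≈1 r) ⟩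
    1# - 1#                                            ≈⟨ trans (-‿inverseʳ _) (sym (zeroʳ _)) ⟩
    (pow q (suc r) - 1#) * 0#                          ∎)
    where
    root^m≈1 : ∀ r → pow (pow q (suc r)) m ≈ 1#
    root^m≈1 r = trans (sym (pow-* q (suc r) m))
      (trans (≡⇒≈ (≡.cong (pow q) (ℕₚ.*-comm (suc r) m))) (pow-multiple (suc r)))

  -- The second difference of the periodic function i ↦ i (m - i) is -2 off 0, so its
  -- discrete Fourier transform is 2 m z / (z - 1)².
  Σweight-root : ∀ r → r ℕ.< p →
    Σ< m (λ i → weight i * pow (pow q (suc r)) i) ≈ nat 2 * nat m * (pow q (suc r) * (y r * y r))
  Σweight-root r r<p = begin
    A                        ≈⟨ *-identityˡ A ⟨
    1# * A                   ≈⟨ *-congʳ (trans (*-cong uv uv) (*-identityˡ 1#)) ⟨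
    u * v * (u * v) * A      ≈⟨ solve 3 (λ u v a → u :* v :* (u :* v) :* a := u :* (u :* a) :* (v :* v)) refl u v A ⟩
    u * (u * A) * (v * v)    ≈⟨ *-congʳ (*-congˡ uA) ⟩
    u * - (z * B) * (v * v)  ≈⟨ solve 4 (λ u z b v → u :* :- (z :* b) :* (v :* v) := :- (z :* (u :* b)) :* (v :* v)) refl u z B v ⟩
    - (z * (u * B)) * (v * v)  ≈⟨ *-congʳ (-‿cong (*-congˡ uB)) ⟩
    - (z * - (nat 2 * nat m)) * (v * v)
      ≈⟨ solve 3 (λ z m v → :- (z :* :- (con (ℤ.+ 2) :* m)) :* (v :* v) := con (ℤ.+ 2) :* m :* (z :* (v :* v))) refl z (nat m) v ⟩
    nat 2 * nat m * (z * (v * v))  ∎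
    where
    z = pow q (suc r)
    u = z - 1#
    v = y r
    uv = y-inverse r r<p
    d : ℕ → Carrier
    d i = weight (suc i) - weight i
    A = Σ< m (λ i → weight i * pow z i)
    B = Σ< m (λ i → d i * pow z i)
    z^m≈1 : pow z m ≈ 1#
    z^m≈1 = trans (sym (pow-* q (suc r) m))
      (trans (≡⇒≈ (≡.cong (pow q) (ℕₚ.*-comm (suc r) m))) (pow-multiple (suc r)))
    uA : u * A ≈ - (z * B)
    -- No boundary term survives, because the weight vanishes at 0 and at m.
    uA = trans (summation-by-parts z weight m)
      (solve 4 (λ m p z b → m :* (m :- m) :* p :- con (ℤ.+ 0) :* (m :- con (ℤ.+ 0)) :- z :* b := :- (z :* b)) refl (nat m) (pow z m) z B)
    dd : Σ< m (λ i → (d (suc i) - d i) * pow z i) ≈ 0#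
    dd = begin
      Σ< m (λ i → (d (suc i) - d i) * pow z i)
        ≈⟨ Σ-cong m (λ i _ → *-congʳ {pow z i} (solve 2 (λ i m →
             let w = λ j → j :* (m :- j) ; i₁ = con (ℤ.+ 1) :+ i ; i₂ = con (ℤ.+ 1) :+ i₁ in
             w i₂ :- w i₁ :- (w i₁ :- w i) := :- con (ℤ.+ 2)) refl (nat i) (nat m))) ⟩
      Σ< m (λ i → - nat 2 * pow z i)       ≈⟨ Σ-*ˡ m (- nat 2) (pow z) ⟩
      - nat 2 * Σ< m (pow z)               ≈⟨ *-congˡ (Σpow-root r r<p) ⟩
      - nat 2 * 0#                         ≈⟨ zeroʳ _ ⟩
      0#                                   ∎
    uB : u * B ≈ - (nat 2 * nat m)
    uB = begin
      u * B                                            ≈⟨ summation-by-parts z d m ⟩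
      d m * pow z m - d 0 - z * Σ< m (λ i → (d (suc i) - d i) * pow z i)
        ≈⟨ +-cong (+-congʳ (*-congˡ z^m≈1)) (-‿cong (*-congˡ dd)) ⟩
      -- The first differences do not match at the two ends: d m is -(m + 1) and d 0 is m - 1, which
      -- leaves -2m.
      d m * 1# - d 0 - z * 0#
        ≈⟨ solve 2 (λ m z →
             let w = λ j → j :* (m :- j) ; m₁ = con (ℤ.+ 1) :+ m ; e₁ = con (ℤ.+ 1) :+ con (ℤ.+ 0) in
             (w m₁ :- w m) :* con (ℤ.+ 1) :- (w e₁ :- w (con (ℤ.+ 0))) :- z :* con (ℤ.+ 0) := :- (con (ℤ.+ 2) :* m)) refl (nat m) z ⟩
      - (nat 2 * nat m)                                ∎

  -- Sum `Σweight-root` over r and exchange the sums. For 0 < i < m the powers (q^r)^i with 0 < r <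
  -- m add up to -1, since all m of them add up to 0; what remains is minus the total weight. The
  -- factor m common to both sides is then cancelled.
  Σ-inverse-squares : Unit (nat m) →
    nat 12 * Σ< p (λ r → pow q (suc r) * (y r * y r)) ≈ - (nat m * nat m - 1#)
  Σ-inverse-squares m-unit = unit-cancel m-unit (begin
    nat m * (nat 12 * T)          ≈⟨ solve 2 (λ m t → m :* (con (ℤ.+ 12) :* t) := con (ℤ.+ 6) :* (con (ℤ.+ 2) :* m :* t)) refl (nat m) T ⟩
    nat 6 * (nat 2 * nat m * T)   ≈⟨ *-congˡ (Σ-*ˡ p _ _) ⟨
    nat 6 * Σ< p (λ r → nat 2 * nat m * (pow q (suc r) * (y r * y r)))
      ≈⟨ *-congˡ (Σ-cong p (λ r r<p → Σweight-root r r<p)) ⟨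
    nat 6 * Σ< p (λ r → Σ< m (λ i → weight i * pow (pow q (suc r)) i))
      ≈⟨ *-congˡ (Σ-swap p m (λ r i → weight i * pow (pow q (suc r)) i)) ⟩
    nat 6 * Σ< m (λ i → Σ< p (λ r → weight i * pow (pow q (suc r)) i))
      ≈⟨ *-congˡ (Σ-cong m (λ i i<m → trans (Σ-*ˡ p (weight i) _) (column i i<m))) ⟩
    nat 6 * Σ< m (λ i → - 1# * weight i)   ≈⟨ *-congˡ (Σ-*ˡ m (- 1#) weight) ⟩
    nat 6 * (- 1# * Σ< m weight)
      ≈⟨ solve 1 (λ s → con (ℤ.+ 6) :* (:- con (ℤ.+ 1) :* s) := :- (con (ℤ.+ 6) :* s)) refl _ ⟩
    - (nat 6 * Σ< m weight)                ≈⟨ -‿cong (6Σweight m) ⟩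
    - (nat m * (nat m - 1#) * (nat 3 * nat m - (nat 2 * nat m - 1#)))
      ≈⟨ solve 1 (λ m → :- (m :* (m :- con (ℤ.+ 1)) :* (con (ℤ.+ 3) :* m :- (con (ℤ.+ 2) :* m :- con (ℤ.+ 1))))
            := m :* :- (m :* m :- con (ℤ.+ 1))) refl (nat m) ⟩
    nat m * - (nat m * nat m - 1#)         ∎)
    where
    T = Σ< p (λ r → pow q (suc r) * (y r * y r))
    exchange : ∀ r i → pow (pow q (suc r)) (suc i) ≈ pow (pow q (suc i)) (suc r)
    exchange r i = trans (sym (pow-* q (suc r) (suc i)))
      (trans (≡⇒≈ (≡.cong (pow q) (ℕₚ.*-comm (suc r) (suc i)))) (pow-* q (suc i) (suc r)))
    column : ∀ i → i ℕ.< m → weight i * Σ< p (λ r → pow (pow q (suc r)) i) ≈ - 1# * weight i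
    -- At i = 0 the inner sum is m - 1 and not -1, but there the weight is 0.
    column zero _ = solve 2 (λ m s → con (ℤ.+ 0) :* (m :- con (ℤ.+ 0)) :* s := :- con (ℤ.+ 1) :* (con (ℤ.+ 0) :* (m :- con (ℤ.+ 0)))) refl (nat m) _
    column (suc i) (s≤s i<p) = begin
      w * Σ< p (λ r → pow (pow q (suc r)) (suc i))          ≈⟨ *-congˡ (Σ-cong p (λ r _ → exchange r i)) ⟩
      w * σ                                                 ≈⟨ solve 2 (λ w s → w :* s := w :* (con (ℤ.+ 1) :+ s) :+ :- con (ℤ.+ 1) :* w) refl w σ ⟩
      w * Σ< m (pow (pow q (suc i))) + - 1# * w             ≈⟨ +-congʳ (*-congˡ (Σpow-root i i<p)) ⟩
      w * 0# + - 1# * w                                     ≈⟨ trans (+-congʳ (zeroʳ w)) (+-identityˡ _) ⟩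
      - 1# * w                                              ∎
      where
      w = weight (suc i)
      σ = Σ< p (λ r → pow (pow q (suc i)) (suc r))

  -- i² and (m - i)² agree modulo m. The common factor q^(r i) makes both exponents multiples of m
  -- and avoids any subtraction.
  pow-square-complement : ∀ i r → i ℕ.+ r ≡ m → pow q (i ℕ.* i) ≈ pow q (r ℕ.* r)
  pow-square-complement i r i+r≡m = unit-cancel (unit-pow (r ℕ.* i) q-unit) (begin
    pow q (r ℕ.* i) * pow q (i ℕ.* i)   ≈⟨ pow-+ q (r ℕ.* i) (i ℕ.* i) ⟨
    pow q (r ℕ.* i ℕ.+ i ℕ.* i)         ≈⟨ ≡⇒≈ (≡.cong (pow q) (≡.trans (≡.sym (ℕₚ.*-distribʳ-+ i r i))
                                             (≡.cong (ℕ._* i) (≡.trans (ℕₚ.+-comm r i) i+r≡m)))) ⟩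
    pow q (m ℕ.* i)                     ≈⟨ trans (pow-multiple i) (sym (pow-multiple r)) ⟩
    pow q (m ℕ.* r)                     ≈⟨ ≡⇒≈ (≡.cong (pow q) (≡.trans (≡.cong (ℕ._* r) (≡.sym i+r≡m))
                                             (≡.trans (ℕₚ.*-distribʳ-+ r i r) (≡.cong (ℕ._+ r ℕ.* r) (ℕₚ.*-comm i r))))) ⟩
    pow q (r ℕ.* i ℕ.+ r ℕ.* r)         ≈⟨ pow-+ q (r ℕ.* i) (r ℕ.* r) ⟩
    pow q (r ℕ.* i) * pow q (r ℕ.* r)   ∎)
    where
    q-unit : Unit q
    q-unit = pow q p , q^m≈1

  -- Here signs and triangular powers disappear: two q-binomials bring `sgn` squared into the
  -- denominator, and the power q^(r²) in front of them cancels it up to q^r.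
  sgn-square : ∀ r → sgn q r * sgn q r * pow q r ≈ pow q (r ℕ.* r)
  sgn-square zero    = solve 0 (:- con (ℤ.+ 1) :* :- con (ℤ.+ 1) :* con (ℤ.+ 1) := con (ℤ.+ 1)) refl
  sgn-square (suc r) = begin
    - (P * s) * - (P * s) * (q * P)  ≈⟨ solve 3 (λ q P s → :- (P :* s) :* :- (P :* s) :* (q :* P) := s :* s :* P :* (q :* P :* P)) refl q P s ⟩
    s * s * P * (q * P * P)          ≈⟨ *-cong (sgn-square r) (sym (pow-+ q (suc r) r)) ⟩
    pow q (r ℕ.* r) * pow q (suc r ℕ.+ r)  ≈⟨ pow-+ q (r ℕ.* r) (suc r ℕ.+ r) ⟨
    pow q (r ℕ.* r ℕ.+ (suc r ℕ.+ r))      ≈⟨ ≡⇒≈ (≡.cong (pow q) (square-suc r)) ⟩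
    pow q (suc r ℕ.* suc r)                ∎
    where
    P = pow q r
    s = sgn q r
    square-suc : ∀ r → r ℕ.* r ℕ.+ (suc r ℕ.+ r) ≡ suc r ℕ.* suc r
    square-suc = solve-∀

  -- Start of the descent from mb. β is the cofactor of x in binom(ma, mb - 1)_q, and the hypothesis
  -- is the recurrence with x taken out: the geometric sum is (q^(mb) - 1)/(q^m - 1), which becomes
  -- b.
  sgn-first : ∀ a b {β b₀} → b₀ ≈ binom a b →
    (pow q (m ℕ.* a) * pow q 1 - pow q (m ℕ.* b)) * β ≈ pow q (m ℕ.* b) * (Σ< b (pow (pow q m)) * b₀) →
    sgn q 1 * (pow q 1 - 1#) * β ≈ nat b * binom a b
  sgn-first a b {β} {b₀} b₀≈ e = begin
    - (1# * - 1#) * (pow q 1 - 1#) * β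
      ≈⟨ solve 2 (λ z β → :- (con (ℤ.+ 1) :* :- con (ℤ.+ 1)) :* (z :- con (ℤ.+ 1)) :* β
           := (con (ℤ.+ 1) :* z :- con (ℤ.+ 1)) :* β) refl (pow q 1) β ⟩
    (1# * pow q 1 - 1#) * β
      ≈⟨ *-congʳ (+-cong (*-congʳ (pow-multiple a)) (-‿cong (pow-multiple b))) ⟨
    (pow q (m ℕ.* a) * pow q 1 - pow q (m ℕ.* b)) * β         ≈⟨ e ⟩
    pow q (m ℕ.* b) * (Σ< b (pow (pow q m)) * b₀)             ≈⟨ *-cong (pow-multiple b) (*-cong count b₀≈) ⟩
    1# * (nat b * binom a b)                                  ≈⟨ *-identityˡ _ ⟩
    nat b * binom a b                                         ∎
    where
    count : Σ< b (pow (pow q m)) ≈ nat b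
    count = trans (Σ-cong b (λ i _ → trans (pow-cong i q^m≈1) (pow-1 i))) (trans (Σ-const b 1#) (*-identityʳ _))

  -- One step of the descent. As q^(k+1) and q^r are inverse to each other, q^r (q^(k+1) - 1) is
  -- -(q^r - 1); this yields the factor -q^r in the recursion of `sgn`.
  sgn-next : ∀ a b k r {β β′} → suc k ℕ.+ r ≡ m ℕ.* b →
    (pow q (m ℕ.* a) * pow q (suc r) - pow q (m ℕ.* b)) * β′ ≈ pow q (m ℕ.* b) * ((pow q (suc k) - 1#) * β) →
    sgn q (suc r) * (pow q (suc r) - 1#) * β′ ≈ sgn q r * (pow q r - 1#) * β
  sgn-next a b k r {β} {β′} k+r e = begin
    - (P * s) * (P⁺ - 1#) * β′
      ≈⟨ solve 4 (λ P s P⁺ β → :- (P :* s) :* (P⁺ :- con (ℤ.+ 1)) :* β := :- s :* (P :* ((con (ℤ.+ 1) :* P⁺ :- con (ℤ.+ 1)) :* β))) refl P s P⁺ β′ ⟩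
    - s * (P * ((1# * P⁺ - 1#) * β′))
      ≈⟨ *-congˡ (*-congˡ (*-congʳ (+-cong (*-congʳ (pow-multiple a)) (-‿cong (pow-multiple b))))) ⟨
    - s * (P * ((pow q (m ℕ.* a) * P⁺ - pow q (m ℕ.* b)) * β′))   ≈⟨ *-congˡ (*-congˡ e) ⟩
    - s * (P * (pow q (m ℕ.* b) * ((pow q (suc k) - 1#) * β)))    ≈⟨ *-congˡ (*-congˡ (*-congʳ (pow-multiple b))) ⟩
    - s * (P * (1# * ((pow q (suc k) - 1#) * β)))
      ≈⟨ solve 4 (λ P s K β → :- s :* (P :* (con (ℤ.+ 1) :* ((K :- con (ℤ.+ 1)) :* β))) := s :* (P :- K :* P) :* β) refl P s (pow q (suc k)) β ⟩
    s * (P - pow q (suc k) * P) * β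
      ≈⟨ *-congʳ (*-congˡ (+-congˡ (-‿cong (trans (sym (pow-+ q (suc k) r))
            (trans (≡⇒≈ (≡.cong (pow q) k+r)) (pow-multiple b)))))) ⟩
    s * (P - 1#) * β                                              ∎
    where
    P = pow q r
    P⁺ = pow q (suc r)
    s = sgn q r

  -- Solving both residue equations for the cofactors puts (`sgn` times (q^r - 1))² into the
  -- denominator; `sgn-square` removes its first half and leaves q^r / (q^r - 1)², the summand of
  -- `Σ-inverse-squares`.
  sgn-pair : ∀ r {β β′ c c′ ρ ρ′ e} → r ℕ.< p →
    sgn q (suc r) * (pow q (suc r) - 1#) * β ≈ c →
    sgn q (suc r) * (pow q (suc r) - 1#) * β′ ≈ c′ →
    e ≈ pow q (suc r ℕ.* suc r) → ρ ≈ ρ′ →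
    e * (β * β′ * ρ) ≈ pow q (suc r) * (y r * y r) * (c * c′ * ρ′)
  sgn-pair r {β} {β′} {c} {c′} {ρ} {ρ′} {e} r<p β≈ β′≈ e≈ ρ≈ = begin
    e * (β * β′ * ρ)                          ≈⟨ trans (*-congʳ (trans e≈ (sym (sgn-square (suc r))))) (sym (*-identityˡ _)) ⟩
    1# * (s * s * z * (β * β′ * ρ))           ≈⟨ *-congʳ (trans (*-cong uv uv) (*-identityˡ 1#)) ⟨
    u * v * (u * v) * (s * s * z * (β * β′ * ρ))
      ≈⟨ solve 7 (λ s z β β′ ρ u v → u :* v :* (u :* v) :* (s :* s :* z :* (β :* β′ :* ρ))
           := z :* (v :* v) :* (s :* u :* β :* (s :* u :* β′) :* ρ)) refl s z β β′ ρ u v ⟩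
    z * (v * v) * (s * u * β * (s * u * β′) * ρ)  ≈⟨ *-congˡ (*-cong (*-cong β≈ β′≈) ρ≈) ⟩
    z * (v * v) * (c * c′ * ρ′)               ∎
    where
    s = sgn q (suc r)
    z = pow q (suc r)
    u = z - 1#
    v = y r
    uv = y-inverse r r<p

  qbin-1 : ∀ n k → qbin 1# n k ≈ binom n k
  qbin-1 n       zero    = sym (binom-0 n)
  qbin-1 zero    (suc k) = sym (binom-> {0} {suc k} (s≤s z≤n))
  qbin-1 (suc n) (suc k) = trans (+-cong (qbin-1 n k)
      (trans (*-cong (pow-1 (suc k)) (qbin-1 n (suc k))) (*-identityˡ _)))
    (sym (binom-pascal n k))

  qbin-q^m² : ∀ n k → qbin (pow q (m ℕ.* m)) n k ≈ binom n k
  qbin-q^m² n k = trans (qbin-cong (pow-multiple m) n k) (qbin-1 n k)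

-- Quotient by a principal ideal, and nilpotent generators

module Quotient {c ℓ} (R : CommutativeRing c ℓ) (x : CommutativeRing.Carrier R) where

  open RingTheory R

  infix 4 _∼_
  record _∼_ (a b : Carrier) : Set (c ⊔ ℓ) where
    constructor by
    field
      factor   : Carrier
      equation : a ≈ b + x * factor

  ≈⇒∼ : ∀ {a b} → a ≈ b → a ∼ b
  ≈⇒∼ {a} {b} a≈b = by 0# (trans a≈b (solve 2 (λ x b → b := b :+ x :* con (ℤ.+ 0)) refl x b))

  -- The operations are those of R, so that pow, nat, Σ<, qbin and sgn are
  -- definitionally the same in R and in the quotient.
  quotient : CommutativeRing c (c ⊔ ℓ)
  quotient = record
    { Carrier = Carrier
    ; _≈_ = _∼_
    ; _+_ = _+_
    ; _*_ = _*_
    ; -_ = -_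
    ; 0# = 0#
    ; 1# = 1#
    ; isCommutativeRing = record
      { isRing = record
        { +-isAbelianGroup = record
          { isGroup = record
            { isMonoid = record
              { isSemigroup = record
                { isMagma = record
                  { isEquivalence = record
                    { refl = ≈⇒∼ refl
                    ; sym = λ { {a} {b} (by h e) → by (- h) (trans
                        (solve 3 (λ x b h → b := b :+ x :* h :+ x :* :- h) refl x b h) (+-congʳ (sym e))) }
                    ; trans = λ { {a} {b} {d} (by h e) (by k f) → by (h + k) (trans (trans e (+-congʳ f))
                        (solve 4 (λ x d h k → d :+ x :* k :+ x :* h := d :+ x :* (h :+ k)) refl x d h k)) }
                    }
                  ; ∙-cong = λ { {a} {b} {d} {f} (by h e) (by k g) → by (h + k) (trans (+-cong e g)
                      (solve 5 (λ x b f h k → b :+ x :* h :+ (f :+ x :* k) := b :+ f :+ x :* (h :+ k)) refl x b f h k)) }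
                  }
                ; assoc = λ a b d → ≈⇒∼ (+-assoc a b d)
                }
              ; identity = (λ a → ≈⇒∼ (+-identityˡ a)) , (λ a → ≈⇒∼ (+-identityʳ a))
              }
            ; inverse = (λ a → ≈⇒∼ (-‿inverseˡ a)) , (λ a → ≈⇒∼ (-‿inverseʳ a))
            ; ⁻¹-cong = λ { {a} {b} (by h e) → by (- h) (trans (-‿cong e)
                (solve 3 (λ x b h → :- (b :+ x :* h) := :- b :+ x :* :- h) refl x b h)) }
            }
          ; comm = λ a b → ≈⇒∼ (+-comm a b)
          }
        ; *-cong = λ { {a} {b} {d} {f} (by h e) (by k g) → by (b * k + h * f + x * (h * k)) (trans (*-cong e g)
            (solve 5 (λ x b f h k → (b :+ x :* h) :* (f :+ x :* k) := b :* f :+ x :* (b :* k :+ h :* f :+ x :* (h :* k))) refl x b f h k)) }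
        ; *-assoc = λ a b d → ≈⇒∼ (*-assoc a b d)
        ; *-identity = (λ a → ≈⇒∼ (*-identityˡ a)) , (λ a → ≈⇒∼ (*-identityʳ a))
        ; distrib = (λ a b d → ≈⇒∼ (distribˡ a b d)) , (λ a b d → ≈⇒∼ (distribʳ a b d))
        }
      ; *-comm = λ a b → ≈⇒∼ (*-comm a b)
      }
    }

  module Nilpotent (x³≈0 : x * (x * x) ≈ 0#) where

    -- A truncated geometric series: as x³ = 0, the inverse of 1 + x h is 1 - x h + (x h)².
    unit-lift : ∀ {u} v → u * v ∼ 1# → Unit u
    unit-lift {u} v (by h uv) = v * (1# - x * h + x * h * (x * h)) , (begin
      u * (v * (1# - x * h + x * h * (x * h)))          ≈⟨ *-assoc _ _ _ ⟨
      u * v * (1# - x * h + x * h * (x * h))            ≈⟨ *-congʳ uv ⟩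
      (1# + x * h) * (1# - x * h + x * h * (x * h))
        ≈⟨ solve 2 (λ x h → (con (ℤ.+ 1) :+ x :* h) :* (con (ℤ.+ 1) :- x :* h :+ x :* h :* (x :* h))
             := con (ℤ.+ 1) :+ x :* (x :* x) :* (h :* (h :* h))) refl x h ⟩
      1# + x * (x * x) * (h * (h * h))                  ≈⟨ +-congˡ (trans (*-congʳ x³≈0) (zeroˡ _)) ⟩
      1# + 0#                                           ≈⟨ +-identityʳ _ ⟩
      1#                                                ∎)

    -- The bridge from the quotient back to R: next to x² only residues modulo x are visible.
    x²-cong : ∀ {a b} → a ∼ b → x * x * a ≈ x * x * b
    x²-cong {a} {b} (by h e) = begin
      x * x * a                        ≈⟨ *-congˡ e ⟩
      x * x * (b + x * h)              ≈⟨ solve 3 (λ x b h → x :* x :* (b :+ x :* h) := x :* x :* b :+ x :* (x :* x) :* h) refl x b h ⟩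
      x * x * b + x * (x * x) * h      ≈⟨ +-congˡ (trans (*-congʳ x³≈0) (zeroˡ h)) ⟩
      x * x * b + 0#                   ≈⟨ +-identityʳ _ ⟩
      x * x * b                        ∎

-- Modulo x³: Straub's congruence and the sum over k

module Supercongruence {c ℓ} (R : CommutativeRing c ℓ) (q : CommutativeRing.Carrier R) (p : ℕ)
  (x : CommutativeRing.Carrier R)
  (q^m≈1+x : CommutativeRing._≈_ R (RingTheory.pow R q (suc p)) (CommutativeRing._+_ R (CommutativeRing.1# R) x))
  (x³≈0 : CommutativeRing._≈_ R (CommutativeRing._*_ R x (CommutativeRing._*_ R x x)) (CommutativeRing.0# R))
  (y : ℕ → CommutativeRing.Carrier R)
  (y-inverse : ∀ r → r ℕ.< p → CommutativeRing._≈_ R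
    (CommutativeRing._*_ R (CommutativeRing._-_ R (RingTheory.pow R q (suc r)) (CommutativeRing.1# R)) (y r))
    (CommutativeRing.1# R))
  (nat-unit : ∀ n → RingTheory.Unit R (RingTheory.nat R (suc n)))
  where

  open RingTheory R
  open GaussianBinomials R
  open OrdinaryBinomials R
  open Quotient R x
  open Nilpotent x³≈0

  private
    m = suc p

    q^m∼1 : pow q m ∼ 1#
    q^m∼1 = by 1# (trans q^m≈1+x (+-congˡ (sym (*-identityʳ x))))

    module S = RingTheory quotient
    open RootOfUnity quotient q p q^m∼1 y (λ r r<p → ≈⇒∼ (y-inverse r r<p))

  μ : Carrier
  μ = nat m * nat m - 1#

  x² : Carrier
  x² = x * x

  -- Replaces a statement modulo x² about binom(ma, k)_q for k = mb - r. The cofactor is kept as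
  -- data, because x cannot be cancelled in R.
  record SignedMultiple (a b k r : ℕ) : Set (c ⊔ ℓ) where
    field
      cofactor : Carrier
      multiple : qbin q (m ℕ.* a) k ≈ x * cofactor
      residue  : sgn q r * (pow q r - 1#) * cofactor ∼ nat b * binom a b

  -- Descent from the lower index mb, one unit at a time. The recurrence divides by `w r`, a unit
  -- because it reduces to q^(r+1) - 1 modulo x; the first step brings in the factor x and the later
  -- ones preserve it.
  qbin-nonmultiple : ∀ a b r k → r ℕ.< p → k ℕ.+ suc r ≡ m ℕ.* b → SignedMultiple a b k (suc r)
  qbin-nonmultiple a b r k r<p k+r≡mb = go r k r<p k+r≡mb
    where
    w : ℕ → Carrier
    w r = pow q (m ℕ.* a) * pow q (suc r) - pow q (m ℕ.* b)

    w-unit : ∀ r → r ℕ.< p → Unit (w r)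
    w-unit r r<p = unit-lift (y r) (S.trans
      (S.*-congʳ (S.+-cong (S.trans (S.*-congʳ (pow-multiple a)) (S.*-identityˡ _)) (S.-‿cong (pow-multiple b))))
      (≈⇒∼ (y-inverse r r<p)))

    recurrence : ∀ r k → k ℕ.+ suc r ≡ m ℕ.* b →
      w r * qbin q (m ℕ.* a) k ≈ pow q (m ℕ.* b) * ((pow q (suc k) - 1#) * qbin q (m ℕ.* a) (suc k))
    recurrence r k k+r = begin
      (A * Q - pow q (m ℕ.* b)) * b₁    ≈⟨ *-congʳ (+-congˡ (-‿cong mb)) ⟩
      (A * Q - K * Q) * b₁              ≈⟨ solve 4 (λ A K Q b → (A :* Q :- K :* Q) :* b := Q :* ((A :- K) :* b)) refl A K Q b₁ ⟩
      Q * ((A - K) * b₁)                ≈⟨ *-congˡ (qbin-stepʳ′ q (m ℕ.* a) k) ⟨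
      Q * (K * d)                       ≈⟨ solve 3 (λ K Q d → Q :* (K :* d) := K :* Q :* d) refl K Q d ⟩
      K * Q * d                         ≈⟨ *-congʳ mb ⟨
      pow q (m ℕ.* b) * d               ∎
      where
      A = pow q (m ℕ.* a)
      Q = pow q (suc r)
      K = pow q k
      b₁ = qbin q (m ℕ.* a) k
      d = (pow q (suc k) - 1#) * qbin q (m ℕ.* a) (suc k)
      mb : pow q (m ℕ.* b) ≈ K * Q
      mb = trans (≡⇒≈ (≡.cong (pow q) (≡.sym k+r))) (pow-+ q k (suc r))

    divide : ∀ {w v} t e → w * v ≈ 1# → w * t ≈ x * e → t ≈ x * (v * e)
    divide {w} {v} t e wv wt = unit-cancel (v , wv) (begin
      w * t              ≈⟨ wt ⟩
      x * e              ≈⟨ *-identityˡ _ ⟨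
      1# * (x * e)       ≈⟨ *-congʳ wv ⟨
      w * v * (x * e)    ≈⟨ solve 4 (λ w v x e → w :* v :* (x :* e) := w :* (x :* (v :* e))) refl w v x e ⟩
      w * (x * (v * e))  ∎)

    restore : ∀ {w v} e → w * v ≈ 1# → w * (v * e) ∼ e
    restore e wv = ≈⇒∼ (trans (sym (*-assoc _ _ _)) (trans (*-congʳ wv) (*-identityˡ e)))

    go : ∀ r k → r ℕ.< p → k ℕ.+ suc r ≡ m ℕ.* b → SignedMultiple a b k (suc r)
    go zero k r<p k+1 = record
      { cofactor = v * e
      ; multiple = divide (qbin q (m ℕ.* a) k) e wv w*b₁
      ; residue  = sgn-first a b {β = v * e} {b₀ = b₀} b₀∼ (restore e wv)
      }
      where
      v = proj₁ (w-unit 0 r<p)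
      wv : w 0 * v ≈ 1#
      wv = proj₂ (w-unit 0 r<p)
      g b₀ e : Carrier
      g = Σ< b (pow (pow q m))
      b₀ = qbin q (m ℕ.* a) (suc k)
      e = pow q (m ℕ.* b) * (g * b₀)
      k+1′ : suc k ≡ m ℕ.* b
      k+1′ = ≡.trans (ℕₚ.+-comm 1 k) k+1
      b₀∼ : b₀ ∼ binom a b
      b₀∼ = S.trans (≈⇒∼ (≡⇒≈ (≡.cong (qbin q (m ℕ.* a)) k+1′))) (qbin-multiples a b)
      -- The source of the factor x in the whole descent: q^(mb) - 1 is a multiple of q^m - 1.
      xg : pow q (suc k) - 1# ≈ x * g
      xg = begin
        pow q (suc k) - 1#       ≈⟨ +-congʳ (trans (≡⇒≈ (≡.cong (pow q) k+1′)) (pow-* q m b)) ⟩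
        pow (pow q m) b - 1#     ≈⟨ geometric (pow q m) b ⟨
        (pow q m - 1#) * g       ≈⟨ *-congʳ (trans (+-congʳ q^m≈1+x) (solve 1 (λ x → con (ℤ.+ 1) :+ x :- con (ℤ.+ 1) := x) refl x)) ⟩
        x * g                    ∎
      w*b₁ : w 0 * qbin q (m ℕ.* a) k ≈ x * e
      w*b₁ = begin
        w 0 * qbin q (m ℕ.* a) k                        ≈⟨ recurrence 0 k k+1 ⟩
        pow q (m ℕ.* b) * ((pow q (suc k) - 1#) * b₀)   ≈⟨ *-congˡ (*-congʳ xg) ⟩
        pow q (m ℕ.* b) * (x * g * b₀)                  ≈⟨ solve 4 (λ Q x g b → Q :* (x :* g :* b) := x :* (Q :* (g :* b))) refl _ x g b₀ ⟩
        x * e                                           ∎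
    go (suc r) k r<p k+r = record
      { cofactor = v * e
      ; multiple = divide (qbin q (m ℕ.* a) k) e wv w*b₁
      ; residue  = S.trans (sgn-next a b k (suc r) {β = β} {β′ = v * e} k+r′ (restore e wv)) (SignedMultiple.residue rec)
      }
      where
      k+r′ : suc k ℕ.+ suc r ≡ m ℕ.* b
      k+r′ = ≡.trans (≡.sym (ℕₚ.+-suc k (suc r))) k+r
      rec = go r (suc k) (ℕₚ.<⇒≤ r<p) k+r′
      v = proj₁ (w-unit (suc r) r<p)
      wv : w (suc r) * v ≈ 1#
      wv = proj₂ (w-unit (suc r) r<p)
      β e : Carrier
      β = SignedMultiple.cofactor rec
      e = pow q (m ℕ.* b) * ((pow q (suc k) - 1#) * β)
      w*b₁ : w (suc r) * qbin q (m ℕ.* a) k ≈ x * e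
      w*b₁ = begin
        w (suc r) * qbin q (m ℕ.* a) k                                             ≈⟨ recurrence (suc r) k k+r ⟩
        pow q (m ℕ.* b) * ((pow q (suc k) - 1#) * qbin q (m ℕ.* a) (suc k))        ≈⟨ *-congˡ (*-congˡ (SignedMultiple.multiple rec)) ⟩
        pow q (m ℕ.* b) * ((pow q (suc k) - 1#) * (x * β))
          ≈⟨ solve 4 (λ Q K x β → Q :* (K :* (x :* β)) := x :* (Q :* (K :* β))) refl _ (pow q (suc k) - 1#) x β ⟩
        x * e                                                                      ∎

  -- Each of the two q-binomials supplies one x, so everything else matters modulo x only and
  -- `sgn-pair` applies. It serves the interior terms of the Vandermonde sum as well as the terms of
  -- A_q(mn) with m not dividing k.
  nonmultiple-pair : ∀ a b a′ b′ r k k′ {e ρ ρ′} → r ℕ.< p →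
    k ℕ.+ suc r ≡ m ℕ.* b → k′ ℕ.+ suc r ≡ m ℕ.* b′ →
    e ∼ pow q (suc r ℕ.* suc r) → ρ ∼ ρ′ →
    e * (qbin q (m ℕ.* a) k * qbin q (m ℕ.* a′) k′ * ρ) ≈
      x² * (pow q (suc r) * (y r * y r) * (nat b * binom a b * (nat b′ * binom a′ b′) * ρ′))
  nonmultiple-pair a b a′ b′ r k k′ {e} {ρ} {ρ′} r<p k+r k′+r e∼ ρ∼ = begin
    e * (qbin q (m ℕ.* a) k * qbin q (m ℕ.* a′) k′ * ρ)
      ≈⟨ *-congˡ (*-congʳ (*-cong P.multiple P′.multiple)) ⟩
    e * (x * P.cofactor * (x * P′.cofactor) * ρ)
      ≈⟨ solve 5 (λ e x β β′ ρ → e :* (x :* β :* (x :* β′) :* ρ) := x :* x :* (e :* (β :* β′ :* ρ))) refl e x P.cofactor P′.cofactor ρ ⟩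
    x² * (e * (P.cofactor * P′.cofactor * ρ))   ≈⟨ x²-cong (sgn-pair r r<p P.residue P′.residue e∼ ρ∼) ⟩
    x² * (pow q (suc r) * (y r * y r) * (nat b * binom a b * (nat b′ * binom a′ b′) * ρ′))  ∎
    where
    module P = SignedMultiple (qbin-nonmultiple a b r k r<p k+r)
    module P′ = SignedMultiple (qbin-nonmultiple a′ b′ r k′ r<p k′+r)

  -- The zero-based i stands for i + 1, and `p ∸ suc i` likewise for the complement m - (i + 1).
  -- Reversing the order of summation turns complements into indices, after which
  -- `Σ-inverse-squares` evaluates the sum.
  Σ-middle : ∀ G K → (∀ i → i ℕ.< p → G i ≈ x² * (pow q (suc (p ∸ suc i)) * (y (p ∸ suc i) * y (p ∸ suc i)) * K)) →
    nat 12 * Σ< p G ≈ - (μ * (x² * K))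
  Σ-middle G K G≈ = begin
    nat 12 * Σ< p G                                   ≈⟨ *-congˡ (Σ-cong p (λ i i<p → trans (G≈ i i<p) (reorder _))) ⟩
    nat 12 * Σ< p (λ i → x² * K * T (p ∸ suc i))      ≈⟨ *-congˡ (trans (Σ-*ˡ p (x² * K) (λ i → T (p ∸ suc i))) (*-congˡ (Σ-reverse p T))) ⟩
    nat 12 * (x² * K * Σ< p T)
      ≈⟨ solve 3 (λ x² K t → con (ℤ.+ 12) :* (x² :* K :* t) := x² :* (con (ℤ.+ 12) :* t) :* K) refl x² K _ ⟩
    x² * (nat 12 * Σ< p T) * K                        ≈⟨ *-congʳ (x²-cong (Σ-inverse-squares (S-unit (nat-unit p)))) ⟩
    x² * - μ * K                                      ≈⟨ solve 3 (λ x² K μ → x² :* :- μ :* K := :- (μ :* (x² :* K))) refl x² K μ ⟩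
    - (μ * (x² * K))                                  ∎
    where
    T : ℕ → Carrier
    T r = pow q (suc r) * (y r * y r)
    reorder : ∀ t → x² * (t * K) ≈ x² * K * t
    reorder t = solve 3 (λ x² K t → x² :* (t :* K) := x² :* K :* t) refl x² K t
    S-unit : ∀ {u} → Unit u → S.Unit u
    S-unit (v , uv) = v , ≈⇒∼ uv

  -- The outer Vandermonde terms reproduce Pascal's rule at the base q^(m²). The interior ones
  -- contribute -2 μ x² (b + 1) binom(a, b + 1), exactly the defect by which b (a - b) binom(a, b)
  -- fails Pascal's rule; `weights` is this identity.
  qbin-ljunggren : ∀ a b → nat 24 * qbin q (m ℕ.* a) (m ℕ.* b) ≈
    nat 24 * qbin (pow q (m ℕ.* m)) a b - μ * (x² * (nat b * (nat a - nat b) * binom a b))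
  qbin-ljunggren a zero = begin
    nat 24 * qbin q (m ℕ.* a) (m ℕ.* 0)   ≈⟨ *-congˡ (≡⇒≈ (≡.cong (qbin q (m ℕ.* a)) (ℕₚ.*-zeroʳ m))) ⟩
    nat 24 * 1#
      ≈⟨ solve 4 (λ μ x a b → con (ℤ.+ 24) :* con (ℤ.+ 1) := con (ℤ.+ 24) :* con (ℤ.+ 1) :- μ :* (x :* (con (ℤ.+ 0) :* (a :- con (ℤ.+ 0)) :* b))) refl μ x² (nat a) (binom a 0) ⟩
    nat 24 * 1# - μ * (x² * (nat 0 * (nat a - nat 0) * binom a 0))  ∎
  qbin-ljunggren zero (suc b) = begin
    nat 24 * qbin q (m ℕ.* 0) (m ℕ.* suc b)  ≈⟨ *-congˡ (≡⇒≈ (≡.cong (λ n → qbin q n (m ℕ.* suc b)) (ℕₚ.*-zeroʳ m))) ⟩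
    nat 24 * 0#
      ≈⟨ solve 3 (λ μ x b → con (ℤ.+ 24) :* con (ℤ.+ 0) := con (ℤ.+ 24) :* con (ℤ.+ 0) :- μ :* (x :* (b :* con (ℤ.+ 0)))) refl μ x² (nat (suc b) * (nat 0 - nat (suc b))) ⟩
    nat 24 * 0# - μ * (x² * (nat (suc b) * (nat 0 - nat (suc b)) * 0#))
      ≈⟨ +-congˡ (-‿cong (*-congˡ (*-congˡ (*-congˡ (binom-> {0} {suc b} (s≤s z≤n)))))) ⟨
    nat 24 * 0# - μ * (x² * (nat (suc b) * (nat 0 - nat (suc b)) * binom 0 (suc b)))  ∎
  qbin-ljunggren (suc a) (suc b) = begin
    nat 24 * qbin q (m ℕ.* suc a) (m ℕ.* suc b)
      ≈⟨ *-congˡ (trans (≡⇒≈ (≡.cong₂ (qbin q) (m*[1+n]≡m*n+m m a) (m*[1+n]≡m*n+m m b)))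
                        (qbin-vandermonde-ends q (m ℕ.* a) p (m ℕ.* b))) ⟩
    nat 24 * (qbin q (m ℕ.* a) (m ℕ.* b) + Σ< p F + pow q ((m ℕ.* b ℕ.+ m) ℕ.* m) * qbin q (m ℕ.* a) (m ℕ.* b ℕ.+ m))
      ≈⟨ *-congˡ (+-congˡ (*-cong last-power (≡⇒≈ (≡.cong (qbin q (m ℕ.* a)) (≡.sym (m*[1+n]≡m*n+m m b)))))) ⟩
    nat 24 * (qbin q (m ℕ.* a) (m ℕ.* b) + Σ< p F + Q^ * qbin q (m ℕ.* a) (m ℕ.* suc b))
      ≈⟨ solve 4 (λ u s P v → con (ℤ.+ 24) :* (u :+ s :+ P :* v)
           := con (ℤ.+ 24) :* u :+ con (ℤ.+ 2) :* (con (ℤ.+ 12) :* s) :+ P :* (con (ℤ.+ 24) :* v)) refl _ _ _ _ ⟩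
    nat 24 * qbin q (m ℕ.* a) (m ℕ.* b) + nat 2 * (nat 12 * Σ< p F) + Q^ * (nat 24 * qbin q (m ℕ.* a) (m ℕ.* suc b))
      ≈⟨ +-cong (+-cong (qbin-ljunggren a b) (*-congˡ (Σ-middle F K middle))) (*-congˡ (qbin-ljunggren a (suc b))) ⟩
    (nat 24 * u - μ * (x² * E)) + nat 2 * - (μ * (x² * K)) + Q^ * (nat 24 * v - μ * (x² * E′))
      ≈⟨ solve 8 (λ u μ x² E K P v E′ →
           (con (ℤ.+ 24) :* u :- μ :* (x² :* E)) :+ con (ℤ.+ 2) :* :- (μ :* (x² :* K)) :+ P :* (con (ℤ.+ 24) :* v :- μ :* (x² :* E′))
           := con (ℤ.+ 24) :* (u :+ P :* v) :- μ :* (x² :* E :+ con (ℤ.+ 2) :* (x² :* K) :+ x² :* P :* E′)) refl u μ x² E K Q^ v E′ ⟩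
    nat 24 * (u + Q^ * v) - μ * (x² * E + nat 2 * (x² * K) + x² * Q^ * E′)
      ≈⟨ +-congˡ (-‿cong (*-congˡ (+-congˡ (*-congʳ (trans (x²-cong Q^∼1) (*-identityʳ x²)))))) ⟩
    nat 24 * (u + Q^ * v) - μ * (x² * E + nat 2 * (x² * K) + x² * E′)
      ≈⟨ +-congˡ (-‿cong (*-congˡ (trans (solve 4 (λ x² E K E′ → x² :* E :+ con (ℤ.+ 2) :* (x² :* K) :+ x² :* E′
                                            := x² :* (E :+ con (ℤ.+ 2) :* K :+ E′)) refl x² E K E′) (*-congˡ weights)))) ⟩
    nat 24 * (u + Q^ * v) - μ * (x² * (nat (suc b) * (nat (suc a) - nat (suc b)) * binom (suc a) (suc b)))  ∎
    where
    F : ℕ → Carrier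
    F i = qbin q m (suc i) * (qbin q (m ℕ.* a) (m ℕ.* b ℕ.+ suc i) * pow q ((m ℕ.* b ℕ.+ suc i) ℕ.* suc i))
    Q = pow q (m ℕ.* m)
    Q^ = pow Q (suc b)
    u = qbin Q a b
    v = qbin Q a (suc b)
    c₀ = binom a b
    c₁ = binom a (suc b)
    E = nat b * (nat a - nat b) * c₀
    E′ = nat (suc b) * (nat a - nat (suc b)) * c₁
    -- Left unsimplified: this is the shape that `nonmultiple-pair` returns for the index pairs (1,
    -- 1) and (a, b + 1) with third factor 1.
    K = nat 1 * binom 1 1 * (nat (suc b) * c₁) * 1#

    last-power : pow q ((m ℕ.* b ℕ.+ m) ℕ.* m) ≈ Q^
    last-power = trans (≡⇒≈ (≡.cong (pow q) (≡.trans (≡.cong (ℕ._* m) (≡.sym (m*[1+n]≡m*n+m m b)))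
      (≡.trans (ℕₚ.*-comm (m ℕ.* suc b) m) (≡.sym (ℕₚ.*-assoc m m (suc b))))))) (pow-* q (m ℕ.* m) (suc b))

    Q^∼1 : Q^ ∼ 1#
    Q^∼1 = S.trans (S.pow-cong (suc b) (pow-multiple m)) (S.pow-1 (suc b))

    middle : ∀ i → i ℕ.< p → F i ≈ x² * (pow q (suc (p ∸ suc i)) * (y (p ∸ suc i) * y (p ∸ suc i)) * K)
    middle i i<p = begin
      qbin q m (suc i) * (qbin q (m ℕ.* a) (m ℕ.* b ℕ.+ suc i) * e)
        -- Written with upper index m * 1, binom(m, i)_q is itself a non-multiple q-binomial, with a
        -- = b = 1.
        ≈⟨ *-congʳ (≡⇒≈ (≡.cong (λ n → qbin q n (suc i)) (≡.sym (ℕₚ.*-identityʳ m)))) ⟩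
      qbin q (m ℕ.* 1) (suc i) * (qbin q (m ℕ.* a) (m ℕ.* b ℕ.+ suc i) * e)
        ≈⟨ solve 3 (λ u v e → u :* (v :* e) := e :* (u :* v :* con (ℤ.+ 1))) refl _ _ e ⟩
      e * (qbin q (m ℕ.* 1) (suc i) * qbin q (m ℕ.* a) (m ℕ.* b ℕ.+ suc i) * 1#)
        ≈⟨ nonmultiple-pair 1 1 a (suc b) r (suc i) (m ℕ.* b ℕ.+ suc i) {ρ = 1#} r<p
             (≡.trans i+r≡m (≡.sym (ℕₚ.*-identityʳ m)))
             (≡.trans (ℕₚ.+-assoc (m ℕ.* b) (suc i) (suc r)) (≡.trans (≡.cong (m ℕ.* b ℕ.+_) i+r≡m) (≡.sym (m*[1+n]≡m*n+m m b))))
             (S.trans e∼ (pow-square-complement (suc i) (suc r) i+r≡m)) S.refl ⟩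
      x² * (pow q (suc r) * (y r * y r) * K)  ∎
      where
      r = p ∸ suc i
      e = pow q ((m ℕ.* b ℕ.+ suc i) ℕ.* suc i)
      i+r≡m : suc i ℕ.+ suc r ≡ m
      i+r≡m = complement i<p
      r<p : r ℕ.< p
      r<p = complement< i<p
      e∼ : e ∼ pow q (suc i ℕ.* suc i)
      e∼ = S.trans (≈⇒∼ (pow-* q (m ℕ.* b ℕ.+ suc i) (suc i)))
             (S.trans (S.pow-cong (suc i) (pow-mod b (suc i))) (≈⇒∼ (sym (pow-* q (suc i) (suc i)))))

    weights : E + nat 2 * K + E′ ≈ nat (suc b) * (nat (suc a) - nat (suc b)) * binom (suc a) (suc b)
    weights = begin
      E + nat 2 * K + E′
        ≈⟨ +-congʳ (+-congˡ (*-congˡ (*-congʳ (*-congʳ (*-congˡ (trans (≡⇒≈ (≡.cong nat (nCn≡1 1))) (+-identityʳ 1#))))))) ⟩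
      E + nat 2 * (nat 1 * 1# * (nat (suc b) * c₁) * 1#) + E′
        ≈⟨ solve 4 (λ a b c₀ c₁ → let 1+b = con (ℤ.+ 1) :+ b ; 1′ = con (ℤ.+ 1) in
             b :* (a :- b) :* c₀ :+ con (ℤ.+ 2) :* ((1′ :+ con (ℤ.+ 0)) :* 1′ :* (1+b :* c₁) :* 1′) :+ 1+b :* (a :- 1+b) :* c₁
             := 1+b :* ((1′ :+ a) :- 1+b) :* (c₀ :+ c₁) :+ (1+b :* c₁ :- (a :- b) :* c₀)) refl (nat a) (nat b) c₀ c₁ ⟩
      nat (suc b) * (nat (suc a) - nat (suc b)) * (c₀ + c₁) + (nat (suc b) * c₁ - (nat a - nat b) * c₀)
        ≈⟨ +-cong (*-congˡ (sym (binom-pascal a b))) (trans (+-congʳ (binom-stepʳ a b)) (-‿inverseʳ _)) ⟩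
      nat (suc b) * (nat (suc a) - nat (suc b)) * binom (suc a) (suc b) + 0#  ≈⟨ +-identityʳ _ ⟩
      nat (suc b) * (nat (suc a) - nat (suc b)) * binom (suc a) (suc b)  ∎

  -- To first order u/v is 1 - (μ/24) x² w, so w behaves like a logarithmic derivative: under
  -- products it adds, while the common residue d multiplies.
  record Approx (u v w d : Carrier) : Set (c ⊔ ℓ) where
    field
      expansion : nat 24 * u ≈ nat 24 * v - μ * (x² * (w * d))
      u∼d       : u ∼ d
      v∼d       : v ∼ d

  approx-* : ∀ {u v w d u′ v′ w′ d′} → Approx u v w d → Approx u′ v′ w′ d′ →
    Approx (u * u′) (v * v′) (w + w′) (d * d′)
  approx-* {u} {v} {w} {d} {u′} {v′} {w′} {d′} A A′ = record
    { expansion = begin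
        nat 24 * (u * u′)      ≈⟨ *-assoc _ _ _ ⟨
        nat 24 * u * u′        ≈⟨ *-congʳ A.expansion ⟩
        (nat 24 * v - μ * (x² * (w * d))) * u′
          ≈⟨ solve 6 (λ v μ x² w d u′ → (con (ℤ.+ 24) :* v :- μ :* (x² :* (w :* d))) :* u′
               := v :* (con (ℤ.+ 24) :* u′) :- μ :* (x² :* (w :* d :* u′))) refl v μ x² w d u′ ⟩
        v * (nat 24 * u′) - μ * (x² * (w * d * u′))
          ≈⟨ +-cong (*-congˡ A′.expansion) (-‿cong (*-congˡ (x²-cong (S.*-congˡ A′.u∼d)))) ⟩
        v * (nat 24 * v′ - μ * (x² * (w′ * d′))) - μ * (x² * (w * d * d′))
          ≈⟨ solve 8 (λ v μ x² w d v′ w′ d′ →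
               v :* (con (ℤ.+ 24) :* v′ :- μ :* (x² :* (w′ :* d′))) :- μ :* (x² :* (w :* d :* d′))
               := con (ℤ.+ 24) :* (v :* v′) :- μ :* (x² :* (v :* (w′ :* d′))) :- μ :* (x² :* (w :* d :* d′))) refl v μ x² w d v′ w′ d′ ⟩
        nat 24 * (v * v′) - μ * (x² * (v * (w′ * d′))) - μ * (x² * (w * d * d′))
          ≈⟨ +-congʳ (+-congˡ (-‿cong (*-congˡ (x²-cong (S.*-congʳ A.v∼d))))) ⟩
        nat 24 * (v * v′) - μ * (x² * (d * (w′ * d′))) - μ * (x² * (w * d * d′))
          ≈⟨ solve 7 (λ vv′ μ x² w d w′ d′ →
               con (ℤ.+ 24) :* vv′ :- μ :* (x² :* (d :* (w′ :* d′))) :- μ :* (x² :* (w :* d :* d′))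
               := con (ℤ.+ 24) :* vv′ :- μ :* (x² :* ((w :+ w′) :* (d :* d′)))) refl (v * v′) μ x² w d w′ d′ ⟩
        nat 24 * (v * v′) - μ * (x² * ((w + w′) * (d * d′)))  ∎
    ; u∼d = S.*-cong A.u∼d A′.u∼d
    ; v∼d = S.*-cong A.v∼d A′.v∼d
    }
    where
    module A = Approx A
    module A′ = Approx A′

  approx-qbin : ∀ a b → Approx (qbin q (m ℕ.* a) (m ℕ.* b)) (qbin (pow q (m ℕ.* m)) a b)
    (nat b * (nat a - nat b)) (binom a b)
  approx-qbin a b = record { expansion = qbin-ljunggren a b ; u∼d = qbin-multiples a b ; v∼d = qbin-q^m² a b }

  -- `e k` stands for q^α(mn, k) and `e′ k` for q^(m² α(n, k)). The three properties come from
  -- homogeneity, from q^m being 1 modulo x, and from α(0, k) = k² respectively.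
  module Sum (n₁ n₂ n₃ n₄ : ℕ) (e e′ : ℕ → Carrier)
    (e-multiple : ∀ k → e (m ℕ.* k) ≈ e′ k)
    (e′∼1 : ∀ k → e′ k ∼ 1#)
    (e-square : ∀ j i → e (m ℕ.* j ℕ.+ i) ∼ pow q (i ℕ.* i))
    where

    product : Carrier → (N₁ N₂ N₃ N₄ k : ℕ) → Carrier
    product z N₁ N₂ N₃ N₄ k =
      qbin z N₁ k * qbin z N₃ k * qbin z (N₁ ℕ.+ N₂ ∸ k) N₁ * qbin z (N₃ ℕ.+ N₄ ∸ k) N₃

    coefficient : ℕ → Carrier
    coefficient k = binom n₁ k * binom n₃ k * binom (n₁ ℕ.+ n₂ ∸ k) n₁ * binom (n₃ ℕ.+ n₄ ∸ k) n₃

    total : Carrier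
    total = nat n₁ * nat n₂ + nat n₃ * nat n₄

    term term′ : ℕ → Carrier
    term  k = e k * product q (m ℕ.* n₁) (m ℕ.* n₂) (m ℕ.* n₃) (m ℕ.* n₄) k
    term′ k = e′ k * product (pow q (m ℕ.* m)) n₁ n₂ n₃ n₄ k

    -- The corrections b (a - b) of the four q-binomials of a term, added up according to `Approx`.
    weight : ℕ → Carrier
    weight k = nat k * (nat n₁ - nat k) + nat k * (nat n₃ - nat k)
      + nat n₁ * (nat (n₁ ℕ.+ n₂ ∸ k) - nat n₁) + nat n₃ * (nat (n₃ ℕ.+ n₄ ∸ k) - nat n₃)

    nat-+-∸ : ∀ a b k → k ℕ.≤ a → nat (a ℕ.+ b ∸ k) ≈ nat a + nat b - nat k
    nat-+-∸ a b k k≤a = begin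
      nat (a ℕ.+ b ∸ k)                       ≈⟨ solve 2 (λ d k → d := d :+ k :- k) refl _ (nat k) ⟩
      nat (a ℕ.+ b ∸ k) + nat k - nat k       ≈⟨ +-congʳ (nat-+ (a ℕ.+ b ∸ k) k) ⟨
      nat (a ℕ.+ b ∸ k ℕ.+ k) - nat k         ≈⟨ +-congʳ (≡⇒≈ (≡.cong nat (ℕₚ.m∸n+n≡m (ℕₚ.≤-trans k≤a (ℕₚ.m≤m+n a b))))) ⟩
      nat (a ℕ.+ b) - nat k                   ≈⟨ +-congʳ (nat-+ a b) ⟩
      nat a + nat b - nat k                   ∎

    coefficient-> : ∀ {k} → n₃ ℕ.< k → coefficient k ≈ 0#
    coefficient-> n₃<k = trans (*-congʳ (*-congʳ (*-congˡ (binom-> n₃<k))))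
      (solve 3 (λ a b d → a :* con (ℤ.+ 0) :* b :* d := con (ℤ.+ 0)) refl _ _ _)

    -- Here the two kinds of terms meet: 2 k² is what the non-multiples of m attached to k
    -- contribute, and it cancels all dependence of the weight on k.
    weight-total : ∀ k → k ℕ.≤ n₁ → (weight k + nat 2 * (nat k * nat k)) * coefficient k ≈ total * coefficient k
    weight-total k k≤n₁ with k ℕ.≤? n₃
    ... | yes k≤n₃ = *-congʳ (begin
      weight k + nat 2 * (nat k * nat k)
        ≈⟨ +-congʳ (+-cong (+-congˡ (*-congˡ (+-congʳ (nat-+-∸ n₁ n₂ k k≤n₁)))) (*-congˡ (+-congʳ (nat-+-∸ n₃ n₄ k k≤n₃)))) ⟩
      nat k * (nat n₁ - nat k) + nat k * (nat n₃ - nat k) + nat n₁ * (nat n₁ + nat n₂ - nat k - nat n₁)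
        + nat n₃ * (nat n₃ + nat n₄ - nat k - nat n₃) + nat 2 * (nat k * nat k)
        ≈⟨ solve 5 (λ a b d f k → k :* (a :- k) :+ k :* (d :- k) :+ a :* (a :+ b :- k :- a) :+ d :* (d :+ f :- k :- d)
             :+ con (ℤ.+ 2) :* (k :* k) := a :* b :+ d :* f) refl (nat n₁) (nat n₂) (nat n₃) (nat n₄) (nat k) ⟩
      total  ∎)
    -- Above n₃ the truncated subtraction in the weight cannot be trusted, but there binom(n₃, k)
    -- kills the coefficient.
    ... | no k≰n₃ = trans (*-congˡ z) (trans (zeroʳ _) (sym (trans (*-congˡ z) (zeroʳ _))))
      where z = coefficient-> (ℕₚ.≰⇒> k≰n₃)

    m-+-∸ : ∀ a b k → m ℕ.* a ℕ.+ m ℕ.* b ∸ m ℕ.* k ≡ m ℕ.* (a ℕ.+ b ∸ k)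
    m-+-∸ a b k = ≡.trans (≡.cong (_∸ m ℕ.* k) (≡.sym (ℕₚ.*-distribˡ-+ m a b))) (≡.sym (ℕₚ.*-distribˡ-∸ m (a ℕ.+ b) k))

    term-multiple : ∀ k → nat 24 * term (m ℕ.* k) ≈ nat 24 * term′ k - μ * (x² * (weight k * coefficient k))
    term-multiple k = begin
      nat 24 * term (m ℕ.* k)
        ≈⟨ *-congˡ (*-cong (e-multiple k) (*-cong (*-congˡ (≡⇒≈ (≡.cong (λ n → qbin q n (m ℕ.* n₁)) (m-+-∸ n₁ n₂ k))))
                                                  (≡⇒≈ (≡.cong (λ n → qbin q n (m ℕ.* n₃)) (m-+-∸ n₃ n₄ k))))) ⟩
      nat 24 * (e′ k * (qbin q (m ℕ.* n₁) (m ℕ.* k) * qbin q (m ℕ.* n₃) (m ℕ.* k)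
        * qbin q (m ℕ.* (n₁ ℕ.+ n₂ ∸ k)) (m ℕ.* n₁) * qbin q (m ℕ.* (n₃ ℕ.+ n₄ ∸ k)) (m ℕ.* n₃)))
        ≈⟨ Approx.expansion approximation ⟩
      nat 24 * term′ k - μ * (x² * ((0# + weight k) * (1# * coefficient k)))
        ≈⟨ +-congˡ (-‿cong (*-congˡ (*-congˡ (*-cong (+-identityˡ _) (*-identityˡ _))))) ⟩
      nat 24 * term′ k - μ * (x² * (weight k * coefficient k))  ∎
      where
      trivial : Approx (e′ k) (e′ k) 0# 1#
      trivial = record
        { expansion = solve 3 (λ e μ x² → con (ℤ.+ 24) :* e := con (ℤ.+ 24) :* e :- μ :* (x² :* (con (ℤ.+ 0) :* con (ℤ.+ 1)))) refl (e′ k) μ x²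
        ; u∼d = e′∼1 k
        ; v∼d = e′∼1 k
        }
      approximation = approx-* trivial (approx-* (approx-* (approx-* (approx-qbin n₁ k) (approx-qbin n₃ k))
        (approx-qbin (n₁ ℕ.+ n₂ ∸ k) n₁)) (approx-qbin (n₃ ℕ.+ n₄ ∸ k) n₃))

    -- With k = m (j + 1) - r the two q-binomials having k as lower index supply x². The other two
    -- have an upper index of the form m s + r with r < m, so modulo x they reduce by `qbin-lucas`.
    term-nonmultiple : ∀ j i → j ℕ.< n₁ → i ℕ.< p → term (m ℕ.* j ℕ.+ suc i) ≈
      x² * (pow q (suc (p ∸ suc i)) * (y (p ∸ suc i) * y (p ∸ suc i)) * (nat (suc j) * nat (suc j) * coefficient (suc j)))
    term-nonmultiple j i j<n₁ i<p with suc j ℕ.≤? n₃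
    ... | yes j<n₃ = begin
      e k * (b₁ * b₃ * b₂ * b₄)     ≈⟨ *-congˡ (*-assoc (b₁ * b₃) b₂ b₄) ⟩
      e k * (b₁ * b₃ * (b₂ * b₄))
        ≈⟨ nonmultiple-pair n₁ (suc j) n₃ (suc j) r k k r<p k+r k+r
             (S.trans (e-square j (suc i)) (pow-square-complement (suc i) (suc r) i+r≡m))
             (S.*-cong (lucas n₁ n₂ j<n₁) (lucas n₃ n₄ j<n₃)) ⟩
      x² * (pow q (suc r) * (y r * y r) * (nat (suc j) * c₁ * (nat (suc j) * c₃) * (c₂ * c₄)))
        ≈⟨ *-congˡ (*-congˡ (solve 5 (λ j c₁ c₃ c₂ c₄ → j :* c₁ :* (j :* c₃) :* (c₂ :* c₄) := j :* j :* (c₁ :* c₃ :* c₂ :* c₄)) refl (nat (suc j)) c₁ c₃ c₂ c₄)) ⟩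
      x² * (pow q (suc r) * (y r * y r) * (nat (suc j) * nat (suc j) * coefficient (suc j)))  ∎
      where
      r = p ∸ suc i
      k = m ℕ.* j ℕ.+ suc i
      b₁ = qbin q (m ℕ.* n₁) k
      b₃ = qbin q (m ℕ.* n₃) k
      b₂ = qbin q (m ℕ.* n₁ ℕ.+ m ℕ.* n₂ ∸ k) (m ℕ.* n₁)
      b₄ = qbin q (m ℕ.* n₃ ℕ.+ m ℕ.* n₄ ∸ k) (m ℕ.* n₃)
      c₁ = binom n₁ (suc j)
      c₃ = binom n₃ (suc j)
      c₂ = binom (n₁ ℕ.+ n₂ ∸ suc j) n₁
      c₄ = binom (n₃ ℕ.+ n₄ ∸ suc j) n₃
      i+r≡m : suc i ℕ.+ suc r ≡ m
      i+r≡m = complement i<p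
      r<p : r ℕ.< p
      r<p = complement< i<p
      k+r : k ℕ.+ suc r ≡ m ℕ.* suc j
      k+r = ≡.trans (ℕₚ.+-assoc (m ℕ.* j) (suc i) (suc r)) (≡.trans (≡.cong (m ℕ.* j ℕ.+_) i+r≡m) (≡.sym (m*[1+n]≡m*n+m m j)))
      remainder : ∀ a b → suc j ℕ.≤ a → m ℕ.* a ℕ.+ m ℕ.* b ∸ k ≡ m ℕ.* (a ℕ.+ b ∸ suc j) ℕ.+ suc r
      remainder a b j<a = ≡.trans (≡.cong (_∸ k) (≡.trans (≡.sym (ℕₚ.*-distribˡ-+ m a b)) split)) (ℕₚ.m+n∸n≡m _ k)
        where
        s = a ℕ.+ b ∸ suc j
        split : m ℕ.* (a ℕ.+ b) ≡ m ℕ.* s ℕ.+ suc r ℕ.+ k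
        split = ≡.trans (≡.cong (m ℕ.*_) (≡.sym (ℕₚ.m∸n+n≡m (ℕₚ.≤-trans j<a (ℕₚ.m≤m+n a b)))))
          (≡.trans (ℕₚ.*-distribˡ-+ m s (suc j)) (≡.trans (≡.cong (m ℕ.* s ℕ.+_) (≡.trans (≡.sym k+r) (ℕₚ.+-comm k (suc r))))
            (≡.sym (ℕₚ.+-assoc (m ℕ.* s) (suc r) k))))
      lucas : ∀ a b → suc j ℕ.≤ a → qbin q (m ℕ.* a ℕ.+ m ℕ.* b ∸ k) (m ℕ.* a) ∼ binom (a ℕ.+ b ∸ suc j) a
      lucas a b j<a = S.trans (≈⇒∼ (≡⇒≈ (≡.cong (λ n → qbin q n (m ℕ.* a)) (remainder a b j<a))))
        (qbin-lucas (a ℕ.+ b ∸ suc j) a (suc r) r<p)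
    ... | no j≮n₃ = begin
      e k * (b₁ * b₃ * b₂ * b₄)     ≈⟨ *-congˡ (*-congʳ (*-congʳ (*-congˡ (qbin-> q m*n₃<k)))) ⟩
      e k * (b₁ * 0# * b₂ * b₄)
        ≈⟨ solve 7 (λ e b₁ b₂ b₄ x² z J → e :* (b₁ :* con (ℤ.+ 0) :* b₂ :* b₄) := x² :* (z :* (J :* con (ℤ.+ 0)))) refl (e k) b₁ b₂ b₄ x² z (nat (suc j) * nat (suc j)) ⟩
      x² * (z * (nat (suc j) * nat (suc j) * 0#))
        ≈⟨ *-congˡ (*-congˡ (*-congˡ (coefficient-> (ℕₚ.≰⇒> j≮n₃)))) ⟨
      x² * (z * (nat (suc j) * nat (suc j) * coefficient (suc j)))  ∎
      where
      k = m ℕ.* j ℕ.+ suc i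
      b₁ = qbin q (m ℕ.* n₁) k
      b₃ = qbin q (m ℕ.* n₃) k
      b₂ = qbin q (m ℕ.* n₁ ℕ.+ m ℕ.* n₂ ∸ k) (m ℕ.* n₁)
      b₄ = qbin q (m ℕ.* n₃ ℕ.+ m ℕ.* n₄ ∸ k) (m ℕ.* n₃)
      z = pow q (suc (p ∸ suc i)) * (y (p ∸ suc i) * y (p ∸ suc i))
      m*n₃<k : m ℕ.* n₃ ℕ.< k
      m*n₃<k = ℕₚ.≤-<-trans (ℕₚ.*-monoʳ-≤ m (ℕₚ.≤-pred (ℕₚ.≰⇒> j≮n₃))) (ℕₚ.m<m+n (m ℕ.* j) (s≤s z≤n))

    block-sum : ∀ j → j ℕ.< n₁ → nat 24 * Σ< m (λ i → term (m ℕ.* j ℕ.+ suc i)) ≈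
      nat 24 * term′ (suc j) - μ * (x² * (total * coefficient (suc j)))
    block-sum j j<n₁ = begin
      nat 24 * Σ< m G                  ≈⟨ *-congˡ (Σ-last p G) ⟩
      nat 24 * (Σ< p G + G p)          ≈⟨ solve 2 (λ s t → con (ℤ.+ 24) :* (s :+ t) := con (ℤ.+ 2) :* (con (ℤ.+ 12) :* s) :+ con (ℤ.+ 24) :* t) refl _ _ ⟩
      nat 2 * (nat 12 * Σ< p G) + nat 24 * G p
        ≈⟨ +-cong (*-congˡ (Σ-middle G _ (λ i i<p → term-nonmultiple j i j<n₁ i<p)))
                  (trans (*-congˡ (≡⇒≈ (≡.cong term (≡.sym (m*[1+n]≡m*n+m m j))))) (term-multiple (suc j))) ⟩
      nat 2 * - (μ * (x² * (J * J * T))) + (nat 24 * term′ (suc j) - μ * (x² * (weight (suc j) * T)))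
        ≈⟨ solve 6 (λ μ x² J T t w → con (ℤ.+ 2) :* :- (μ :* (x² :* (J :* J :* T))) :+ (con (ℤ.+ 24) :* t :- μ :* (x² :* (w :* T)))
             := con (ℤ.+ 24) :* t :- μ :* (x² :* ((w :+ con (ℤ.+ 2) :* (J :* J)) :* T))) refl μ x² J T _ _ ⟩
      nat 24 * term′ (suc j) - μ * (x² * ((weight (suc j) + nat 2 * (J * J)) * T))
        ≈⟨ +-congˡ (-‿cong (*-congˡ (*-congˡ (weight-total (suc j) j<n₁)))) ⟩
      nat 24 * term′ (suc j) - μ * (x² * (total * T))  ∎
      where
      G : ℕ → Carrier
      G i = term (m ℕ.* j ℕ.+ suc i)
      J = nat (suc j)
      T = coefficient (suc j)

    Σ-expansion : ∀ n (f g h : ℕ → Carrier) →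
      (∀ i → i ℕ.< n → nat 24 * f i ≈ nat 24 * g i - μ * (x² * (total * h i))) →
      nat 24 * Σ< n f ≈ nat 24 * Σ< n g - μ * (x² * (total * Σ< n h))
    Σ-expansion zero f g h _ = solve 3 (λ μ x² t → con (ℤ.+ 24) :* con (ℤ.+ 0)
      := con (ℤ.+ 24) :* con (ℤ.+ 0) :- μ :* (x² :* (t :* con (ℤ.+ 0)))) refl μ x² total
    Σ-expansion (suc n) f g h f≈ = begin
      nat 24 * (f 0 + Σ< n (λ i → f (suc i)))   ≈⟨ distribˡ _ _ _ ⟩
      nat 24 * f 0 + nat 24 * Σ< n (λ i → f (suc i))
        ≈⟨ +-cong (f≈ 0 (s≤s z≤n)) (Σ-expansion n _ _ _ (λ i i<n → f≈ (suc i) (s≤s i<n))) ⟩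
      (nat 24 * g 0 - μ * (x² * (total * h 0))) + (nat 24 * Σ< n (λ i → g (suc i)) - μ * (x² * (total * Σ< n (λ i → h (suc i)))))
        ≈⟨ solve 7 (λ μ x² t g s h u → (con (ℤ.+ 24) :* g :- μ :* (x² :* (t :* h))) :+ (con (ℤ.+ 24) :* s :- μ :* (x² :* (t :* u)))
             := con (ℤ.+ 24) :* (g :+ s) :- μ :* (x² :* (t :* (h :+ u)))) refl μ x² total (g 0) _ (h 0) _ ⟩
      nat 24 * Σ< (suc n) g - μ * (x² * (total * Σ< (suc n) h))  ∎

    supercongruence : nat 24 * Σ< (suc (m ℕ.* n₁)) term ≈
      nat 24 * Σ< (suc n₁) term′ - μ * (x² * (total * Σ< (suc n₁) coefficient))
    supercongruence = trans (*-congˡ (+-cong (≡⇒≈ (≡.cong term (≡.sym (ℕₚ.*-zeroʳ m)))) blocks))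
      (Σ-expansion (suc n₁) block term′ coefficient expansions)
      where
      -- Block K collects k = mK - r for 0 ≤ r < m, so the non-multiples are grouped with the
      -- multiple above them; block 0 is the single term k = 0.
      block : ℕ → Carrier
      block zero    = term (m ℕ.* 0)
      block (suc j) = Σ< m (λ i → term (m ℕ.* j ℕ.+ suc i))

      blocks : Σ< (m ℕ.* n₁) (λ k → term (suc k)) ≈ Σ< n₁ (λ j → block (suc j))
      blocks = trans (Σ-blocks m n₁ (λ k → term (suc k)))
        (Σ-cong n₁ (λ j _ → Σ-cong m (λ i _ → ≡⇒≈ (≡.cong term (≡.sym (ℕₚ.+-suc (m ℕ.* j) i))))))

      expansions : ∀ k → k ℕ.< suc n₁ → nat 24 * block k ≈ nat 24 * term′ k - μ * (x² * (total * coefficient k))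
      -- Block 0 has no non-multiples; the vanishing 2 times 0² is inserted to make `weight-total`
      -- applicable.
      expansions zero    _          = trans (term-multiple 0) (+-congˡ (-‿cong (*-congˡ (*-congˡ
        (trans (*-congʳ (trans (sym (+-identityʳ _)) (+-congˡ (sym (trans (*-congˡ (zeroˡ _)) (zeroʳ _))))))
               (weight-total 0 z≤n))))))
      expansions (suc j) (s≤s j<n₁) = block-sum j j<n₁

-- Coefficient lists as a commutative ring

at : Poly → ℕ → ℚ
at []      _       = 0ℚ
at (a ∷ f) zero    = a
at (a ∷ f) (suc n) = at f n

infix 4 _≋_
-- Lists that differ by trailing zeros are the same polynomial. Being a record, the relation keeps f
-- and g recoverable from the type, which a bare family of equations would not.
record _≋_ (f g : Poly) : Set where
  constructor coefficientwise
  field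
    coefficients : ∀ n → at f n ≡ at g n
open _≋_ public

at-+ : ∀ f g n → at (f +ₚ g) n ≡ at f n ℚ.+ at g n
at-+ []      g       n       = ≡.sym (ℚₚ.+-identityˡ _)
at-+ (a ∷ f) []      zero    = ≡.sym (ℚₚ.+-identityʳ a)
at-+ (a ∷ f) []      (suc n) = ≡.sym (ℚₚ.+-identityʳ _)
at-+ (a ∷ f) (b ∷ g) zero    = ≡.refl
at-+ (a ∷ f) (b ∷ g) (suc n) = at-+ f g n

at-scale : ∀ c f n → at (scaleₚ c f) n ≡ c ℚ.* at f n
at-scale c []      n       = ≡.sym (ℚₚ.*-zeroʳ c)
at-scale c (a ∷ f) zero    = ≡.refl
at-scale c (a ∷ f) (suc n) = at-scale c f n

module PolynomialArithmetic where

  ≋-isEquivalence : IsEquivalence _≋_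
  ≋-isEquivalence = record
    { refl  = coefficientwise λ _ → ≡.refl
    ; sym   = λ e → coefficientwise λ n → ≡.sym (coefficients e n)
    ; trans = λ e e′ → coefficientwise λ n → ≡.trans (coefficients e n) (coefficients e′ n)
    }

  module ≋ = IsEquivalence ≋-isEquivalence

  ≋-setoid : Setoid _ _
  ≋-setoid = record { isEquivalence = ≋-isEquivalence }

  open import Relation.Binary.Reasoning.Setoid ≋-setoid

  ≡⇒≋ : ∀ {f g} → f ≡ g → f ≋ g
  ≡⇒≋ ≡.refl = ≋.refl

  +ₚ-cong : ∀ {f f′ g g′} → f ≋ f′ → g ≋ g′ → f +ₚ g ≋ f′ +ₚ g′
  +ₚ-cong {f} {f′} {g} {g′} e e′ = coefficientwise λ n →
    ≡.trans (at-+ f g n) (≡.trans (≡.cong₂ ℚ._+_ (coefficients e n) (coefficients e′ n)) (≡.sym (at-+ f′ g′ n)))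

  scale-cong : ∀ c {f g} → f ≋ g → scaleₚ c f ≋ scaleₚ c g
  scale-cong c {f} {g} e = coefficientwise λ n →
    ≡.trans (at-scale c f n) (≡.trans (≡.cong (c ℚ.*_) (coefficients e n)) (≡.sym (at-scale c g n)))

  ∷-cong : ∀ {a b f g} → a ≡ b → f ≋ g → a ∷ f ≋ b ∷ g
  ∷-cong a≡b e = coefficientwise λ { zero → a≡b ; (suc n) → coefficients e n }

  0∷[] : 0ℚ ∷ [] ≋ []
  0∷[] = coefficientwise λ { zero → ≡.refl ; (suc n) → ≡.refl }

  +ₚ-assoc : ∀ f g h → (f +ₚ g) +ₚ h ≋ f +ₚ (g +ₚ h)
  +ₚ-assoc f g h = coefficientwise λ n → ≡.trans (at-+ (f +ₚ g) h n) (≡.trans (≡.cong (ℚ._+ at h n) (at-+ f g n))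
    (≡.trans (ℚₚ.+-assoc (at f n) (at g n) (at h n))
      (≡.sym (≡.trans (at-+ f (g +ₚ h) n) (≡.cong (at f n ℚ.+_) (at-+ g h n))))))

  +ₚ-comm : ∀ f g → f +ₚ g ≋ g +ₚ f
  +ₚ-comm f g = coefficientwise λ n → ≡.trans (at-+ f g n) (≡.trans (ℚₚ.+-comm (at f n) (at g n)) (≡.sym (at-+ g f n)))

  +ₚ-identityʳ : ∀ f → f +ₚ [] ≋ f
  +ₚ-identityʳ f = +ₚ-comm f []

  negate : Poly → Poly
  negate = scaleₚ (ℚ.- 1ℚ)

  at-negate : ∀ f n → at (negate f) n ≡ ℚ.- at f n
  at-negate f n = ≡.trans (at-scale (ℚ.- 1ℚ) f n)
    (≡.trans (≡.sym (ℚₚ.neg-distribˡ-* 1ℚ (at f n))) (≡.cong ℚ.-_ (ℚₚ.*-identityˡ (at f n))))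

  +ₚ-inverseʳ : ∀ f → f +ₚ negate f ≋ []
  +ₚ-inverseʳ f = coefficientwise λ n → ≡.trans (at-+ f (negate f) n)
    (≡.trans (≡.cong (at f n ℚ.+_) (at-negate f n)) (ℚₚ.+-inverseʳ (at f n)))

  +ₚ-interchange : ∀ f g h k → (f +ₚ g) +ₚ (h +ₚ k) ≋ (f +ₚ h) +ₚ (g +ₚ k)
  +ₚ-interchange f g h k = begin
    (f +ₚ g) +ₚ (h +ₚ k)   ≈⟨ +ₚ-assoc f g (h +ₚ k) ⟩
    f +ₚ (g +ₚ (h +ₚ k))   ≈⟨ +ₚ-cong (≋.refl {f}) (≋.trans (≋.sym (+ₚ-assoc g h k)) (≋.trans (+ₚ-cong (+ₚ-comm g h) (≋.refl {k})) (+ₚ-assoc h g k))) ⟩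
    f +ₚ (h +ₚ (g +ₚ k))   ≈⟨ +ₚ-assoc f h (g +ₚ k) ⟨
    (f +ₚ h) +ₚ (g +ₚ k)   ∎

  scale-+ : ∀ c f g → scaleₚ c (f +ₚ g) ≋ scaleₚ c f +ₚ scaleₚ c g
  scale-+ c f g = coefficientwise λ n → ≡.trans (at-scale c (f +ₚ g) n) (≡.trans (≡.cong (c ℚ.*_) (at-+ f g n))
    (≡.trans (ℚₚ.*-distribˡ-+ c (at f n) (at g n))
      (≡.sym (≡.trans (at-+ (scaleₚ c f) (scaleₚ c g) n) (≡.cong₂ ℚ._+_ (at-scale c f n) (at-scale c g n))))))

  scale-scale : ∀ c d f → scaleₚ (c ℚ.* d) f ≋ scaleₚ c (scaleₚ d f)
  scale-scale c d f = coefficientwise λ n → ≡.trans (at-scale (c ℚ.* d) f n)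
    (≡.trans (ℚₚ.*-assoc c d (at f n))
      (≡.sym (≡.trans (at-scale c (scaleₚ d f) n) (≡.cong (c ℚ.*_) (at-scale d f n)))))

  0-scale : ∀ f → scaleₚ 0ℚ f ≋ []
  0-scale f = coefficientwise λ n → ≡.trans (at-scale 0ℚ f n) (ℚₚ.*-zeroˡ (at f n))

  1-scale : ∀ f → scaleₚ 1ℚ f ≋ f
  1-scale f = coefficientwise λ n → ≡.trans (at-scale 1ℚ f n) (ℚₚ.*-identityˡ (at f n))

  *ₚ-congˡ : ∀ f {g h} → g ≋ h → f *ₚ g ≋ f *ₚ h
  *ₚ-congˡ []      e = ≋.refl
  *ₚ-congˡ (a ∷ f) e = +ₚ-cong (scale-cong a e) (∷-cong ≡.refl (*ₚ-congˡ f e))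

  *ₚ-zeroʳ : ∀ f → f *ₚ [] ≋ []
  *ₚ-zeroʳ []      = ≋.refl
  *ₚ-zeroʳ (a ∷ f) = ≋.trans (∷-cong ≡.refl (*ₚ-zeroʳ f)) 0∷[]

  -- The mirror image of the defining clause of `*ₚ`; commutativity follows from the two by
  -- induction.
  *ₚ-∷ : ∀ f b g → f *ₚ (b ∷ g) ≋ scaleₚ b f +ₚ (0ℚ ∷ (f *ₚ g))
  *ₚ-∷ []      b g = ≋.sym 0∷[]
  *ₚ-∷ (a ∷ f) b g = ∷-cong (≡.cong (ℚ._+ 0ℚ) (ℚₚ.*-comm a b)) (begin
    scaleₚ a g +ₚ (f *ₚ (b ∷ g))                        ≈⟨ +ₚ-cong (≋.refl {scaleₚ a g}) (*ₚ-∷ f b g) ⟩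
    scaleₚ a g +ₚ (scaleₚ b f +ₚ (0ℚ ∷ (f *ₚ g)))       ≈⟨ +ₚ-assoc (scaleₚ a g) (scaleₚ b f) _ ⟨
    (scaleₚ a g +ₚ scaleₚ b f) +ₚ (0ℚ ∷ (f *ₚ g))       ≈⟨ +ₚ-cong (+ₚ-comm (scaleₚ a g) (scaleₚ b f)) (≋.refl {0ℚ ∷ (f *ₚ g)}) ⟩
    (scaleₚ b f +ₚ scaleₚ a g) +ₚ (0ℚ ∷ (f *ₚ g))       ≈⟨ +ₚ-assoc (scaleₚ b f) (scaleₚ a g) _ ⟩
    scaleₚ b f +ₚ (scaleₚ a g +ₚ (0ℚ ∷ (f *ₚ g)))       ∎)

  *ₚ-comm : ∀ f g → f *ₚ g ≋ g *ₚ f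
  *ₚ-comm []      g = ≋.sym (*ₚ-zeroʳ g)
  *ₚ-comm (a ∷ f) g = ≋.trans (+ₚ-cong (≋.refl {scaleₚ a g}) (∷-cong ≡.refl (*ₚ-comm f g))) (≋.sym (*ₚ-∷ g a f))

  *ₚ-cong : ∀ {f f′ g g′} → f ≋ f′ → g ≋ g′ → f *ₚ g ≋ f′ *ₚ g′
  *ₚ-cong {f} {f′} {g} {g′} e e′ = begin
    f *ₚ g    ≈⟨ *ₚ-congˡ f e′ ⟩
    f *ₚ g′   ≈⟨ *ₚ-comm f g′ ⟩
    g′ *ₚ f   ≈⟨ *ₚ-congˡ g′ e ⟩
    g′ *ₚ f′  ≈⟨ *ₚ-comm g′ f′ ⟩
    f′ *ₚ g′  ∎

  *ₚ-distribˡ : ∀ f g h → f *ₚ (g +ₚ h) ≋ (f *ₚ g) +ₚ (f *ₚ h)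
  *ₚ-distribˡ []      g h = ≋.refl
  *ₚ-distribˡ (a ∷ f) g h = begin
    scaleₚ a (g +ₚ h) +ₚ (0ℚ ∷ (f *ₚ (g +ₚ h)))
      ≈⟨ +ₚ-cong (scale-+ a g h) (∷-cong (≡.sym (ℚₚ.+-identityˡ 0ℚ)) (*ₚ-distribˡ f g h)) ⟩
    (scaleₚ a g +ₚ scaleₚ a h) +ₚ ((0ℚ ∷ (f *ₚ g)) +ₚ (0ℚ ∷ (f *ₚ h)))
      ≈⟨ +ₚ-interchange (scaleₚ a g) (scaleₚ a h) _ _ ⟩
    ((a ∷ f) *ₚ g) +ₚ ((a ∷ f) *ₚ h)  ∎

  *ₚ-distribʳ : ∀ h f g → (f +ₚ g) *ₚ h ≋ (f *ₚ h) +ₚ (g *ₚ h)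
  *ₚ-distribʳ h f g = ≋.trans (*ₚ-comm (f +ₚ g) h) (≋.trans (*ₚ-distribˡ h f g) (+ₚ-cong (*ₚ-comm h f) (*ₚ-comm h g)))

  scale-* : ∀ c f g → scaleₚ c f *ₚ g ≋ scaleₚ c (f *ₚ g)
  scale-* c []      g = ≋.refl
  scale-* c (a ∷ f) g = begin
    scaleₚ (c ℚ.* a) g +ₚ (0ℚ ∷ (scaleₚ c f *ₚ g))
      ≈⟨ +ₚ-cong (scale-scale c a g) (∷-cong (≡.sym (ℚₚ.*-zeroʳ c)) (scale-* c f g)) ⟩
    scaleₚ c (scaleₚ a g) +ₚ scaleₚ c (0ℚ ∷ (f *ₚ g))  ≈⟨ scale-+ c (scaleₚ a g) _ ⟨
    scaleₚ c ((a ∷ f) *ₚ g)                            ∎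

  *ₚ-assoc : ∀ f g h → (f *ₚ g) *ₚ h ≋ f *ₚ (g *ₚ h)
  *ₚ-assoc []      g h = ≋.refl
  *ₚ-assoc (a ∷ f) g h = begin
    (scaleₚ a g +ₚ (0ℚ ∷ (f *ₚ g))) *ₚ h                    ≈⟨ *ₚ-distribʳ h (scaleₚ a g) _ ⟩
    (scaleₚ a g *ₚ h) +ₚ (scaleₚ 0ℚ h +ₚ (0ℚ ∷ ((f *ₚ g) *ₚ h)))
      ≈⟨ +ₚ-cong (scale-* a g h) (+ₚ-cong (0-scale h) (∷-cong ≡.refl (*ₚ-assoc f g h))) ⟩
    scaleₚ a (g *ₚ h) +ₚ (0ℚ ∷ (f *ₚ (g *ₚ h)))             ∎

  const-* : ∀ a f → (a ∷ []) *ₚ f ≋ scaleₚ a f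
  const-* a f = ≋.trans (+ₚ-cong (≋.refl {scaleₚ a f}) 0∷[]) (+ₚ-identityʳ _)

  *ₚ-identityˡ : ∀ f → oneₚ *ₚ f ≋ f
  *ₚ-identityˡ f = ≋.trans (const-* 1ℚ f) (1-scale f)

  polynomialRing : CommutativeRing _ _
  polynomialRing = record
    { Carrier = Poly
    ; _≈_ = _≋_
    ; _+_ = _+ₚ_
    ; _*_ = _*ₚ_
    ; -_ = negate
    ; 0# = []
    ; 1# = oneₚ
    ; isCommutativeRing = record
      { isRing = record
        { +-isAbelianGroup = record
          { isGroup = record
            { isMonoid = record
              { isSemigroup = record
                { isMagma = record { isEquivalence = ≋-isEquivalence ; ∙-cong = +ₚ-cong }
                ; assoc = +ₚ-assoc
                }
              ; identity = (λ f → ≋.refl) , +ₚ-identityʳ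
              }
            ; inverse = (λ f → ≋.trans (+ₚ-comm (negate f) f) (+ₚ-inverseʳ f)) , +ₚ-inverseʳ
            ; ⁻¹-cong = scale-cong (ℚ.- 1ℚ)
            }
          ; comm = +ₚ-comm
          }
        ; *-cong = *ₚ-cong
        ; *-assoc = *ₚ-assoc
        ; *-identity = *ₚ-identityˡ , (λ f → ≋.trans (*ₚ-comm f oneₚ) (*ₚ-identityˡ f))
        ; distrib = *ₚ-distribˡ , *ₚ-distribʳ
        }
      ; *-comm = *ₚ-comm
      }
    }

open PolynomialArithmetic

constant : ℚ → Poly
constant a = a ∷ []

X : Poly
X = 0ℚ ∷ 1ℚ ∷ []

X-* : ∀ f → X *ₚ f ≋ 0ℚ ∷ f
X-* f = ≋.trans (+ₚ-cong (0-scale f) (∷-cong (≡.refl {x = 0ℚ}) (*ₚ-identityˡ f))) ≋.refl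

∷-split : ∀ a f → a ∷ f ≋ constant a +ₚ X *ₚ f
∷-split a f = ≋.trans (∷-cong (≡.sym (ℚₚ.+-identityʳ a)) (≋.refl {f})) (+ₚ-cong (≋.refl {constant a}) (≋.sym (X-* f)))

-- Evaluation of polynomials in a ring that receives ℚ

module Evaluation {c ℓ} (R : CommutativeRing c ℓ) (ι : ℚ → CommutativeRing.Carrier R)
  (ι-+ : ∀ a b → CommutativeRing._≈_ R (ι (a ℚ.+ b)) (CommutativeRing._+_ R (ι a) (ι b)))
  (ι-* : ∀ a b → CommutativeRing._≈_ R (ι (a ℚ.* b)) (CommutativeRing._*_ R (ι a) (ι b)))
  (ι-0 : CommutativeRing._≈_ R (ι 0ℚ) (CommutativeRing.0# R))
  (ι-1 : CommutativeRing._≈_ R (ι 1ℚ) (CommutativeRing.1# R))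
  where

  open RingTheory R

  eval : Carrier → Poly → Carrier
  eval z []      = 0#
  eval z (a ∷ f) = ι a + z * eval z f

  eval-[] : ∀ z {f} → f ≋ [] → eval z f ≈ 0#
  eval-[] z {[]}    e = refl
  eval-[] z {a ∷ f} e = trans (+-cong (trans (≡⇒≈ (≡.cong ι (coefficients e 0))) ι-0)
      (*-congˡ (eval-[] z {f} (coefficientwise λ n → coefficients e (suc n)))))
    (trans (+-identityˡ _) (zeroʳ z))

  eval-cong : ∀ z {f g} → f ≋ g → eval z f ≈ eval z g
  eval-cong z {[]}    {g}     e = sym (eval-[] z (≋.sym e))
  eval-cong z {a ∷ f} {[]}    e = eval-[] z e
  eval-cong z {a ∷ f} {b ∷ g} e = +-cong (≡⇒≈ (≡.cong ι (coefficients e 0)))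
    (*-congˡ (eval-cong z {f} {g} (coefficientwise λ n → coefficients e (suc n))))

  eval-+ : ∀ z f g → eval z (f +ₚ g) ≈ eval z f + eval z g
  eval-+ z []      g       = sym (+-identityˡ _)
  eval-+ z (a ∷ f) []      = sym (+-identityʳ _)
  eval-+ z (a ∷ f) (b ∷ g) = trans (+-cong (ι-+ a b) (*-congˡ (eval-+ z f g)))
    (solve 5 (λ a b z f g → a :+ b :+ z :* (f :+ g) := a :+ z :* f :+ (b :+ z :* g)) refl (ι a) (ι b) z _ _)

  eval-scale : ∀ z c f → eval z (scaleₚ c f) ≈ ι c * eval z f
  eval-scale z c []      = sym (zeroʳ _)
  eval-scale z c (a ∷ f) = trans (+-cong (ι-* c a) (*-congˡ (eval-scale z c f)))
    (solve 4 (λ c a z f → c :* a :+ z :* (c :* f) := c :* (a :+ z :* f)) refl (ι c) (ι a) z _)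

  eval-* : ∀ z f g → eval z (f *ₚ g) ≈ eval z f * eval z g
  eval-* z []      g = sym (zeroˡ _)
  eval-* z (a ∷ f) g = trans (eval-+ z (scaleₚ a g) (0ℚ ∷ (f *ₚ g)))
    (trans (+-cong (eval-scale z a g) (+-cong ι-0 (*-congˡ (eval-* z f g))))
      (solve 4 (λ a g z f → a :* g :+ (con (ℤ.+ 0) :+ z :* (f :* g)) := (a :+ z :* f) :* g) refl (ι a) _ z _))

  eval-constant : ∀ z a → eval z (constant a) ≈ ι a
  eval-constant z a = trans (+-congˡ (zeroʳ z)) (+-identityʳ _)

  eval-X : ∀ z → eval z X ≈ z
  eval-X z = trans (+-cong ι-0 (*-congˡ (trans (eval-constant z 1ℚ) ι-1))) (trans (+-identityˡ _) (*-identityʳ z))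

  eval-replicate : ∀ z n f → eval z (replicate n 0ℚ ++ f) ≈ pow z n * eval z f
  eval-replicate z zero    f = sym (*-identityˡ _)
  eval-replicate z (suc n) f = trans (+-cong ι-0 (*-congˡ (eval-replicate z n f)))
    (trans (+-identityˡ _) (sym (*-assoc _ _ _)))

  eval-spread : ∀ z M f → eval z (spread (suc M) f) ≈ eval (pow z (suc M)) f
  eval-spread z M []      = refl
  eval-spread z M (a ∷ f) = +-congˡ (trans (*-congˡ (trans (eval-replicate z M (spread (suc M) f)) (*-congˡ (eval-spread z M f))))
    (sym (*-assoc _ _ _)))

  private module P = RingTheory polynomialRing

  eval-pow : ∀ z f n → eval z (P.pow f n) ≈ pow (eval z f) n
  eval-pow z f zero    = trans (eval-constant z 1ℚ) ι-1
  eval-pow z f (suc n) = trans (eval-* z f (P.pow f n)) (*-congˡ (eval-pow z f n))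

  eval-qbin : ∀ z n k → eval z (P.qbin X n k) ≈ qbin z n k
  eval-qbin z n       zero    = trans (eval-constant z 1ℚ) ι-1
  eval-qbin z zero    (suc k) = refl
  eval-qbin z (suc n) (suc k) = trans (eval-+ z (P.qbin X n k) _)
    (+-cong (eval-qbin z n k) (trans (eval-* z (P.pow X (suc k)) _)
      (*-cong (trans (eval-pow z X (suc k)) (pow-cong (suc k) (eval-X z))) (eval-qbin z n (suc k)))))

-- Degrees, and correctness of long division by monic polynomials

module PolynomialDivision where

  open RingTheory polynomialRing hiding (trans; refl; sym; Carrier)

  Below : Poly → ℕ → Set
  Below f d = ∀ n → d ℕ.≤ n → at f n ≡ 0ℚ

  -- The coefficient `a` is allowed to vanish, so d is only a bound for the degree unless `a` is
  -- known to be nonzero.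
  record Lead (f : Poly) (d : ℕ) (a : ℚ) : Set where
    constructor lead
    field
      leading : at f d ≡ a
      below   : Below f (suc d)

  Monic : Poly → ℕ → Set
  Monic f d = Lead f d 1ℚ

  below-cong : ∀ {f g d} → f ≋ g → Below f d → Below g d
  below-cong e b n d≤n = ≡.trans (≡.sym (coefficients e n)) (b n d≤n)

  lead-cong : ∀ {f g d a} → f ≋ g → Lead f d a → Lead g d a
  lead-cong {f} {g} {d} e (lead l b) = lead (≡.trans (≡.sym (coefficients e d)) l) (below-cong {f} {g} {suc d} e b)

  lead-unique : ∀ {f d e a b} → ¬ a ≡ 0ℚ → ¬ b ≡ 0ℚ → Lead f d a → Lead f e b → d ≡ e × a ≡ b
  lead-unique {f} {d} {e} a≢0 b≢0 (lead l u) (lead l′ u′) with ℕₚ.<-cmp d e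
  ... | tri< d<e _ _ = contradiction (≡.trans (≡.sym l′) (u e d<e)) b≢0
  ... | tri≈ _ ≡.refl _ = ≡.refl , ≡.trans (≡.sym l) l′
  ... | tri> _ _ e<d = contradiction (≡.trans (≡.sym l) (u′ d e<d)) a≢0

  lead-exists : ∀ f → f ≋ [] ⊎ ∃ λ d → ∃ λ a → (¬ a ≡ 0ℚ) × Lead f d a
  lead-exists []      = inj₁ ≋.refl
  lead-exists (a ∷ f) with lead-exists f | a ℚ.≟ 0ℚ
  ... | inj₂ (d , b , b≢0 , lead l u) | _ = inj₂ (suc d , b , b≢0 , lead l λ { (suc n) (s≤s d<n) → u n d<n })
  ... | inj₁ f≋0 | yes a≡0 = inj₁ (coefficientwise λ { zero → a≡0 ; (suc n) → coefficients f≋0 n })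
  ... | inj₁ f≋0 | no a≢0  = inj₂ (0 , a , a≢0 , lead ≡.refl λ { (suc n) _ → coefficients f≋0 n })

  at-∷-*-suc : ∀ a f g n → at ((a ∷ f) *ₚ g) (suc n) ≡ a ℚ.* at g (suc n) ℚ.+ at (f *ₚ g) n
  at-∷-*-suc a f g n = ≡.trans (at-+ (scaleₚ a g) (0ℚ ∷ (f *ₚ g)) (suc n)) (≡.cong (ℚ._+ at (f *ₚ g) n) (at-scale a g (suc n)))

  at-∷-*-zero : ∀ a f g → at ((a ∷ f) *ₚ g) 0 ≡ a ℚ.* at g 0
  at-∷-*-zero a f g = ≡.trans (at-+ (scaleₚ a g) (0ℚ ∷ (f *ₚ g)) 0)
    (≡.trans (ℚₚ.+-identityʳ _) (at-scale a g 0))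

  private
    x*0+0≡0 : ∀ {x y z} → y ≡ 0ℚ → z ≡ 0ℚ → x ℚ.* y ℚ.+ z ≡ 0ℚ
    x*0+0≡0 {x} ≡.refl ≡.refl = ≡.trans (ℚₚ.+-identityʳ _) (ℚₚ.*-zeroʳ x)

    []-* : ∀ {f} g → f ≋ [] → f *ₚ g ≋ []
    []-* g e = *ₚ-cong e (≋.refl {g})

  lead-* : ∀ {f g d e a b} → Lead f d a → Lead g e b → Lead (f *ₚ g) (d ℕ.+ e) (a ℚ.* b)
  lead-* {[]} {g} {d} {e} {a} {b} (lead l _) _ =
    lead (≡.sym (≡.trans (≡.cong (ℚ._* b) (≡.sym l)) (ℚₚ.*-zeroˡ b))) (λ _ _ → ≡.refl)
  lead-* {c ∷ f} {g} {zero} {e} {a} {b} (lead l u) (lead l′ u′) = lead top rest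
    where
    f≋0 : f ≋ []
    f≋0 = coefficientwise λ n → u (suc n) (s≤s z≤n)
    top : at ((c ∷ f) *ₚ g) e ≡ a ℚ.* b
    top = ≡.trans (at-e e) (≡.cong₂ ℚ._*_ l l′)
      where
      at-e : ∀ e → at ((c ∷ f) *ₚ g) e ≡ c ℚ.* at g e
      at-e zero    = at-∷-*-zero c f g
      at-e (suc e) = ≡.trans (at-∷-*-suc c f g e)
        (≡.trans (≡.cong (c ℚ.* at g (suc e) ℚ.+_) (coefficients ([]-* {f} g f≋0) e)) (ℚₚ.+-identityʳ _))
    rest : Below ((c ∷ f) *ₚ g) (suc e)
    rest (suc n) e<n = ≡.trans (at-∷-*-suc c f g n) (x*0+0≡0 {c} (u′ (suc n) e<n) (coefficients ([]-* {f} g f≋0) n))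
  lead-* {c ∷ f} {g} {suc d} {e} {a} {b} (lead l u) (lead l′ u′) = lead top rest
    where
    tail-lead : Lead (f *ₚ g) (d ℕ.+ e) (a ℚ.* b)
    tail-lead = lead-* {f} {g} (lead l λ n d<n → u (suc n) (s≤s d<n)) (lead l′ u′)
    top : at ((c ∷ f) *ₚ g) (suc (d ℕ.+ e)) ≡ a ℚ.* b
    top = ≡.trans (at-∷-*-suc c f g (d ℕ.+ e))
      (≡.trans (≡.cong (ℚ._+ at (f *ₚ g) (d ℕ.+ e)) (≡.trans (≡.cong (c ℚ.*_) (u′ (suc (d ℕ.+ e)) (s≤s (ℕₚ.m≤n+m e d)))) (ℚₚ.*-zeroʳ c)))
        (≡.trans (ℚₚ.+-identityˡ _) (Lead.leading tail-lead)))
    rest : Below ((c ∷ f) *ₚ g) (suc (suc d ℕ.+ e))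
    rest (suc n) (s≤s d+e<n) = ≡.trans (at-∷-*-suc c f g n)
      (x*0+0≡0 {c} (u′ (suc n) (s≤s (ℕₚ.≤-trans (ℕₚ.m≤n+m e d) (ℕₚ.<⇒≤ d+e<n)))) (Lead.below tail-lead n d+e<n))

  monic-* : ∀ {f g d e} → Monic f d → Monic g e → Monic (f *ₚ g) (d ℕ.+ e)
  monic-* {f} {g} = lead-* {f} {g}

  1≢0 : ¬ 1ℚ ≡ 0ℚ
  1≢0 ()

  monic-factor : ∀ {f g h d e} → h ≋ f *ₚ g → Monic h d → Monic g e → ∃ λ k → Monic f k
  monic-factor {f} {g} {h} {d} {e} h≋fg mh mg with lead-exists f
  ... | inj₁ f≋0 = contradiction (≡.trans (≡.sym (Lead.leading mh)) (coefficients (≋.trans h≋fg ([]-* {f} g f≋0)) d)) 1≢0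
  ... | inj₂ (k , a , a≢0 , lf) = k , ≡.subst (Lead f k) (≡.trans (≡.sym (ℚₚ.*-identityʳ a)) a*1≡1) lf
    where
    a*1≡1 : a ℚ.* 1ℚ ≡ 1ℚ
    a*1≡1 = ≡.sym (proj₂ (lead-unique {h} 1≢0 (λ a*1≡0 → a≢0 (≡.trans (≡.sym (ℚₚ.*-identityʳ a)) a*1≡0)) mh
      (lead-cong (≋.sym h≋fg) (lead-* {f} {g} lf mg))))

  -- The head of f cannot reach beyond degree d in the product, so the tail times g is already below
  -- d and the tail vanishes by induction; the coefficient at d is then the head itself.
  below-*-monic : ∀ f {g d} → Monic g d → Below (f *ₚ g) d → f ≋ []
  below-*-monic []      mg b = ≋.refl
  below-*-monic (a ∷ f) {g} {d} mg@(lead l u) b = coefficientwise λ { zero → a≡0 d l b ; (suc n) → coefficients f≋0 n }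
    where
    f≋0 : f ≋ []
    f≋0 = below-*-monic f mg λ n d≤n → ≡.trans
      (≡.sym (≡.trans (≡.cong (ℚ._+ at (f *ₚ g) n) (≡.trans (≡.cong (a ℚ.*_) (u (suc n) (s≤s d≤n))) (ℚₚ.*-zeroʳ a))) (ℚₚ.+-identityˡ _)))
      (≡.trans (≡.sym (at-∷-*-suc a f g n)) (b (suc n) (ℕₚ.m≤n⇒m≤1+n d≤n)))
    a≡0 : ∀ d → at g d ≡ 1ℚ → Below ((a ∷ f) *ₚ g) d → a ≡ 0ℚ
    a≡0 zero    l b = ≡.trans (≡.sym (≡.trans (at-∷-*-zero a f g) (≡.trans (≡.cong (a ℚ.*_) l) (ℚₚ.*-identityʳ a)))) (b 0 z≤n)
    a≡0 (suc d) l b = ≡.trans (≡.sym (≡.trans (at-∷-*-suc a f g d) (≡.trans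
        (≡.cong₂ ℚ._+_ (≡.trans (≡.cong (a ℚ.*_) l) (ℚₚ.*-identityʳ a)) (coefficients ([]-* {f} g f≋0) d)) (ℚₚ.+-identityʳ a))))
      (b (suc d) ℕₚ.≤-refl)

  monic-quotient-unique : ∀ f f′ {g d r} → Monic g d → Below r d → f *ₚ g ≋ f′ *ₚ g + r → f ≋ f′
  monic-quotient-unique f f′ {g} {d} {r} mg br e = begin
    f                  ≈⟨ solve 2 (λ f f′ → f := (f :- f′) :+ f′) ≋.refl f f′ ⟩
    (f - f′) + f′      ≈⟨ +ₚ-cong (below-*-monic (f - f′) mg (below-cong {r} {(f - f′) *ₚ g} {d} (≋.sym difference) br)) (≋.refl {f′}) ⟩
    f′                 ∎
    where
    difference : (f - f′) *ₚ g ≋ r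
    difference = begin
      (f - f′) *ₚ g              ≈⟨ solve 3 (λ f f′ g → (f :- f′) :* g := f :* g :- f′ :* g) ≋.refl f f′ g ⟩
      f *ₚ g - f′ *ₚ g           ≈⟨ +ₚ-cong e (≋.refl {negate (f′ *ₚ g)}) ⟩
      f′ *ₚ g + r - f′ *ₚ g      ≈⟨ solve 2 (λ a r → a :+ r :- a := r) ≋.refl (f′ *ₚ g) r ⟩
      r                          ∎

  monic-cancelʳ : ∀ f f′ {g d} → Monic g d → f *ₚ g ≋ f′ *ₚ g → f ≋ f′
  monic-cancelʳ f f′ mg e = monic-quotient-unique f f′ {r = []} mg (λ _ _ → ≡.refl) (≋.trans e (≋.sym (+ₚ-identityʳ _)))

  ∷ʳ-split : ∀ f a → f ++ a ∷ [] ≋ f + pow X (length f) *ₚ constant a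
  ∷ʳ-split []      a = ≋.sym (*ₚ-identityˡ (constant a))
  ∷ʳ-split (b ∷ f) a = begin
    b ∷ (f ++ a ∷ [])                              ≈⟨ ∷-cong ≡.refl (∷ʳ-split f a) ⟩
    b ∷ (f + P *ₚ constant a)                      ≈⟨ ∷-split b _ ⟩
    constant b + X *ₚ (f + P *ₚ constant a)        ≈⟨ solve 5 (λ b X f P a → b :+ X :* (f :+ P :* a) := b :+ X :* f :+ X :* P :* a) ≋.refl (constant b) X f P (constant a) ⟩
    (constant b + X *ₚ f) + X *ₚ P *ₚ constant a   ≈⟨ +ₚ-cong (≋.sym (∷-split b f)) (≋.refl {X *ₚ P *ₚ constant a}) ⟩
    (b ∷ f) + X *ₚ P *ₚ constant a                 ∎
    where P = pow X (length f)

  reverse-∷ : ∀ a f → reverse (a ∷ f) ≋ reverse f + pow X (length f) *ₚ constant a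
  reverse-∷ a f = begin
    reverse (a ∷ f)                                          ≈⟨ ≡⇒≋ (Listₚ.unfold-reverse a f) ⟩
    reverse f ++ a ∷ []                                      ≈⟨ ∷ʳ-split (reverse f) a ⟩
    reverse f + pow X (length (reverse f)) *ₚ constant a
      ≈⟨ +ₚ-cong (≋.refl {reverse f}) (≡⇒≋ (≡.cong (λ n → pow X n *ₚ constant a) (Listₚ.length-reverse f))) ⟩
    reverse f + pow X (length f) *ₚ constant a               ∎

  length-+ₚ : ∀ f g → length g ℕ.≤ length f → length (f +ₚ g) ≡ length f
  length-+ₚ []      []      _ = ≡.refl
  length-+ₚ (a ∷ f) []      _ = ≡.refl
  length-+ₚ (a ∷ f) (b ∷ g) (s≤s l) = ≡.cong suc (length-+ₚ f g l)

  -- Adding lists that start with the leading coefficient aligns their tops; read from the bottom,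
  -- the shorter one is shifted up by the difference of lengths.
  reverse-+ₚ : ∀ f g j → length f ≡ j ℕ.+ length g → reverse (f +ₚ g) ≋ reverse f + pow X j *ₚ reverse g
  reverse-+ₚ []      []      j e = ≋.sym (*ₚ-zeroʳ (pow X j))
  reverse-+ₚ []      (b ∷ g) j e = ⊥-elim (ℕₚ.0≢1+n (≡.trans e (ℕₚ.+-suc j (length g))))
  reverse-+ₚ (a ∷ f) []      j e = ≋.sym (≋.trans (+ₚ-cong (≋.refl {reverse (a ∷ f)}) (*ₚ-zeroʳ (pow X j))) (+ₚ-identityʳ _))
  reverse-+ₚ (a ∷ f) (b ∷ g) j e = begin
    reverse ((a ℚ.+ b) ∷ (f +ₚ g))                                         ≈⟨ reverse-∷ (a ℚ.+ b) (f +ₚ g) ⟩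
    reverse (f +ₚ g) + pow X (length (f +ₚ g)) *ₚ constant (a ℚ.+ b)
      ≈⟨ +ₚ-cong (reverse-+ₚ f g j e′) (≡⇒≋ (≡.cong (λ n → pow X n *ₚ constant (a ℚ.+ b)) (length-+ₚ f g g≤f))) ⟩
    (rf + Xʲ *ₚ rg) + Xᶠ *ₚ (constant a + constant b)
      ≈⟨ solve 6 (λ rf Xʲ rg Xᶠ a b → rf :+ Xʲ :* rg :+ Xᶠ :* (a :+ b) := rf :+ Xᶠ :* a :+ (Xʲ :* rg :+ Xᶠ :* b)) ≋.refl rf Xʲ rg Xᶠ (constant a) (constant b) ⟩
    (rf + Xᶠ *ₚ constant a) + (Xʲ *ₚ rg + Xᶠ *ₚ constant b)
      ≈⟨ +ₚ-cong (≋.sym (reverse-∷ a f)) (+ₚ-cong (≋.refl {Xʲ *ₚ rg}) (*ₚ-cong Xᶠ-split (≋.refl {constant b}))) ⟩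
    reverse (a ∷ f) + (Xʲ *ₚ rg + Xʲ *ₚ Xᵍ *ₚ constant b)
      ≈⟨ +ₚ-cong (≋.refl {reverse (a ∷ f)}) (solve 4 (λ Xʲ rg Xᵍ b → Xʲ :* rg :+ Xʲ :* Xᵍ :* b := Xʲ :* (rg :+ Xᵍ :* b)) ≋.refl Xʲ rg Xᵍ (constant b)) ⟩
    reverse (a ∷ f) + Xʲ *ₚ (rg + Xᵍ *ₚ constant b)
      ≈⟨ +ₚ-cong (≋.refl {reverse (a ∷ f)}) (*ₚ-congˡ Xʲ (≋.sym (reverse-∷ b g))) ⟩
    reverse (a ∷ f) + Xʲ *ₚ reverse (b ∷ g)                                ∎
    where
    rf = reverse f
    rg = reverse g
    Xʲ = pow X j
    Xᶠ = pow X (length f)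
    Xᵍ = pow X (length g)
    e′ : length f ≡ j ℕ.+ length g
    e′ = ℕₚ.suc-injective (≡.trans e (ℕₚ.+-suc j (length g)))
    g≤f : length g ℕ.≤ length f
    g≤f = ℕₚ.≤-trans (ℕₚ.m≤n+m (length g) j) (ℕₚ.≤-reflexive (≡.sym e′))
    Xᶠ-split : Xᶠ ≋ Xʲ *ₚ Xᵍ
    Xᶠ-split = ≋.trans (≡⇒≋ (≡.cong (pow X) e′)) (pow-+ X j (length g))

  reverse-scale : ∀ c f → reverse (scaleₚ c f) ≋ constant c *ₚ reverse f
  reverse-scale c f = ≋.trans (≡⇒≋ (≡.sym (Listₚ.reverse-map (c ℚ.*_) f))) (≋.sym (const-* c (reverse f)))

  length-divRev : ∀ k F gt → length F ≡ k ℕ.+ length gt → length (divRev k F gt) ≡ k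
  length-divRev zero    F       gt e = ≡.refl
  length-divRev (suc k) (c ∷ F) gt e = ≡.cong suc (length-divRev k _ gt
    (≡.trans (length-+ₚ F (scaleₚ (ℚ.- c) gt) (ℕₚ.≤-trans (ℕₚ.≤-reflexive (Listₚ.length-map _ gt))
       (ℕₚ.≤-trans (ℕₚ.m≤n+m (length gt) k) (ℕₚ.≤-reflexive (≡.sym (ℕₚ.suc-injective e)))))) (ℕₚ.suc-injective e)))

  length-below : ∀ f → Below f (length f)
  length-below []      n _ = ≡.refl
  length-below (a ∷ f) (suc n) (s≤s l) = length-below f n l

  reverse-below : ∀ f → Below (reverse f) (length f)
  reverse-below f = ≡.subst (Below (reverse f)) (Listₚ.length-reverse f) (length-below (reverse f))

  -- The count k is the number of quotient digits still due: F is longer than the tail of the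
  -- divisor by exactly k. A digit c in front subtracts c X^k times the divisor, where k is already
  -- the decreased count.
  divRev-division : ∀ k F gt → length F ≡ k ℕ.+ length gt →
    ∃ λ r → Below r (length gt) × reverse F ≋ reverse (divRev k F gt) *ₚ reverse (1ℚ ∷ gt) + r
  divRev-division zero    F       gt e = reverse F , ≡.subst (Below (reverse F)) e (reverse-below F) , ≋.refl
  divRev-division (suc k) (c ∷ F) gt e = r , r-below , (begin
    reverse (c ∷ F)                          ≈⟨ reverse-∷ c F ⟩
    rF + pow X (length F) *ₚ A               ≈⟨ +ₚ-cong (≋.refl {rF}) (*ₚ-cong (≋.trans (≡⇒≋ (≡.cong (pow X) e′)) (pow-+ X k t)) (≋.refl {A})) ⟩
    rF + Xᵏ *ₚ Xᵗ *ₚ A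
      ≈⟨ solve 5 (λ rF Xᵏ Xᵗ A rg → rF :+ Xᵏ :* Xᵗ :* A := (rF :+ Xᵏ :* (:- A :* rg)) :+ Xᵏ :* A :* (rg :+ Xᵗ)) ≋.refl rF Xᵏ Xᵗ A rg ⟩
    (rF + Xᵏ *ₚ (- A *ₚ rg)) + Xᵏ *ₚ A *ₚ (rg + Xᵗ)   ≈⟨ +ₚ-cong (≋.sym rF′) (≋.refl {Xᵏ *ₚ A *ₚ (rg + Xᵗ)}) ⟩
    reverse F′ + Xᵏ *ₚ A *ₚ (rg + Xᵗ)        ≈⟨ +ₚ-cong (proj₂ (proj₂ rec)) (*ₚ-congˡ (Xᵏ *ₚ A) (≋.sym G-split)) ⟩
    (rQ *ₚ G + r) + Xᵏ *ₚ A *ₚ G             ≈⟨ solve 5 (λ rQ G r Xᵏ A → (rQ :* G :+ r) :+ Xᵏ :* A :* G := (rQ :+ Xᵏ :* A) :* G :+ r) ≋.refl rQ G r Xᵏ A ⟩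
    (rQ + Xᵏ *ₚ A) *ₚ G + r                  ≈⟨ +ₚ-cong (*ₚ-cong (≋.sym Q-split) (≋.refl {G})) (≋.refl {r}) ⟩
    reverse (c ∷ Q) *ₚ G + r                 ∎)
    where
    t = length gt
    F′ = F +ₚ scaleₚ (ℚ.- c) gt
    Q = divRev k F′ gt
    A = constant c
    Xᵏ = pow X k
    Xᵗ = pow X t
    rF = reverse F
    rg = reverse gt
    rQ = reverse Q
    G = reverse (1ℚ ∷ gt)
    e′ : length F ≡ k ℕ.+ t
    e′ = ℕₚ.suc-injective e
    length-scale : length (scaleₚ (ℚ.- c) gt) ≡ t
    length-scale = Listₚ.length-map _ gt
    F′-length : length F′ ≡ k ℕ.+ t
    F′-length = ≡.trans (length-+ₚ F (scaleₚ (ℚ.- c) gt) (ℕₚ.≤-trans (ℕₚ.≤-reflexive length-scale)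
       (ℕₚ.≤-trans (ℕₚ.m≤n+m t k) (ℕₚ.≤-reflexive (≡.sym e′))))) e′
    rec = divRev-division k F′ gt F′-length
    r = proj₁ rec
    r-below = proj₁ (proj₂ rec)
    rF′ : reverse F′ ≋ rF + Xᵏ *ₚ (- A *ₚ rg)
    rF′ = ≋.trans (reverse-+ₚ F (scaleₚ (ℚ.- c) gt) k (≡.trans e′ (≡.cong (k ℕ.+_) (≡.sym length-scale))))
      (+ₚ-cong (≋.refl {rF}) (*ₚ-congˡ Xᵏ (≋.trans (reverse-scale (ℚ.- c) gt)
        (*ₚ-cong (∷-cong (≡.trans (≡.cong ℚ.-_ (≡.sym (ℚₚ.*-identityˡ c))) (ℚₚ.neg-distribˡ-* 1ℚ c)) (≋.refl {[]})) (≋.refl {rg})))))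
    G-split : G ≋ rg + Xᵗ
    G-split = ≋.trans (reverse-∷ 1ℚ gt) (+ₚ-cong (≋.refl {rg}) (≋.trans (*ₚ-comm Xᵗ oneₚ) (*ₚ-identityˡ Xᵗ)))
    Q-split : reverse (c ∷ Q) ≋ rQ + Xᵏ *ₚ A
    Q-split = ≋.trans (reverse-∷ c Q) (+ₚ-cong (≋.refl {rQ})
      (≡⇒≋ (≡.cong (λ n → pow X n *ₚ A) (length-divRev k F′ gt F′-length))))

  trim-≋ : ∀ f → trim f ≋ f
  trim-≋ f = ≋.trans (drop (reverse f)) (≡⇒≋ (Listₚ.reverse-involutive f))
    where
    drop : ∀ F → reverse (dropWhile (λ c → c ℚ.≟ 0ℚ) F) ≋ reverse F
    drop []      = ≋.refl
    drop (c ∷ F) with c ℚ.≟ 0ℚ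
    ... | no _       = ≋.refl
    ... | yes ≡.refl = ≋.trans (drop F) (≋.sym (≋.trans (reverse-∷ 0ℚ F)
      (≋.trans (+ₚ-cong (≋.refl {reverse F}) (≋.trans (*ₚ-congˡ (pow X (length F)) 0∷[]) (*ₚ-zeroʳ (pow X (length F))))) (+ₚ-identityʳ _))))

  trim-head : ∀ f {c F} → reverse (trim f) ≡ c ∷ F → ¬ c ≡ 0ℚ
  trim-head f e = head (reverse f) (≡.trans (≡.sym (Listₚ.reverse-involutive _)) e)
    where
    head : ∀ F {c F′} → dropWhile (λ c → c ℚ.≟ 0ℚ) F ≡ c ∷ F′ → ¬ c ≡ 0ℚ
    head (c ∷ F) e with c ℚ.≟ 0ℚ
    head (c ∷ F) e      | yes _  = head F e
    head (c ∷ F) ≡.refl | no c≢0 = c≢0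

  -- Long division yields some quotient and a remainder of degree below d; uniqueness of the
  -- quotient by a monic polynomial then identifies it with h.
  divMonic-exact : ∀ f g {h d} → Monic g d → f ≋ h *ₚ g → divMonic f g ≋ h
  divMonic-exact f g {h} {d} mg f≋hg with reverse (trim f) in eF | reverse (trim g) in eG
  ... | F | [] = contradiction (≡.trans (≡.sym (Lead.leading mg)) (coefficients g≋[] d)) 1≢0
    where
    g≋[] : g ≋ []
    g≋[] = ≋.trans (≋.sym (trim-≋ g)) (≡⇒≋ (≡.trans (≡.sym (Listₚ.reverse-involutive (trim g))) (≡.cong reverse eG)))
  ... | F | c ∷ gt = ≋.sym (monic-quotient-unique h _ {g} {d} {r} mg
      (≡.subst (Below r) t≡d (proj₁ (proj₂ division)))
      (≋.trans (≋.sym f≋hg) (≋.trans rF≋f (≋.trans (proj₂ (proj₂ division))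
        (+ₚ-cong (*ₚ-congˡ (reverse (divRev k F gt)) (≋.trans (≡⇒≋ (≡.cong (λ a → reverse (a ∷ gt)) (≡.sym c≡1))) rG≋g)) (≋.refl {r}))))))
    where
    k = length F ∸ length gt
    rF≋f : f ≋ reverse F
    rF≋f = ≋.trans (≋.sym (trim-≋ f)) (≡⇒≋ (≡.trans (≡.sym (Listₚ.reverse-involutive (trim f))) (≡.cong reverse eF)))
    rG≋g : reverse (c ∷ gt) ≋ g
    rG≋g = ≋.trans (≡⇒≋ (≡.trans (≡.cong reverse (≡.sym eG)) (Listₚ.reverse-involutive (trim g)))) (trim-≋ g)
    rG-lead : Lead (reverse (c ∷ gt)) (length gt) c
    rG-lead = lead
      (≡.trans (≡.cong₂ at (Listₚ.unfold-reverse c gt) (≡.sym (Listₚ.length-reverse gt))) (at-end (reverse gt)))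
      (reverse-below (c ∷ gt))
      where
      at-end : ∀ f → at (f ++ c ∷ []) (length f) ≡ c
      at-end []      = ≡.refl
      at-end (a ∷ f) = at-end f
    -- `divMonic` discards the leading coefficient of g and proceeds as if it were 1. After trimming
    -- it is nonzero, hence it is the leading coefficient of the monic g.
    unique = lead-unique {g} (trim-head g eG) 1≢0 (lead-cong rG≋g rG-lead) mg
    t≡d = proj₁ unique
    c≡1 = proj₂ unique
    division : ∃ λ r → Below r (length gt) × reverse F ≋ reverse (divRev k F gt) *ₚ reverse (1ℚ ∷ gt) + r
    division with length gt ℕ.≤? length F
    ... | yes t≤F = divRev-division k F gt (≡.sym (ℕₚ.m∸n+n≡m t≤F))
    -- For a dividend shorter than the divisor the truncated difference asks for no digits, and the
    -- dividend is its own remainder.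
    ... | no t≰F  = reverse F
      , (λ n t≤n → reverse-below F n (ℕₚ.≤-trans (ℕₚ.<⇒≤ (ℕₚ.≰⇒> t≰F)) t≤n))
      , ≡⇒≋ (≡.cong (λ k → reverse (divRev k F gt) *ₚ reverse (1ℚ ∷ gt) + reverse F) (≡.sym (ℕₚ.m≤n⇒m∸n≡0 (ℕₚ.<⇒≤ (ℕₚ.≰⇒> t≰F)))))
    r = proj₁ division

-- A named copy of the recursion inside `newCyclo`; d is the index of the polynomial at the head of
-- the list.
divisorsAt : ℕ → ℕ → List Poly → List Poly
divisorsAt m d []       = []
divisorsAt m d (f ∷ fs) with d ∣? m
... | yes _ = f ∷ divisorsAt m (suc d) fs
... | no  _ = divisorsAt m (suc d) fs

-- The function local to newCyclo has no name here: abstracting the index 2 and the product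
-- puts it in a goal that is general enough for the type of newCyclo-local to be inferred from it.
mutual
  newCyclo-def : ∀ m fs → newCyclo m fs ≡ divMonic (qm-1 m) (prodₚ (divisorsAt m 1 fs))
  newCyclo-def m []       = ≡.refl
  newCyclo-def m (f ∷ fs) with 1 ∣? m
  ... | yes _ with foldr _*ₚ_ oneₚ | 2
  ...   | prod | d = ≡.cong (λ gs → divMonic (qm-1 m) (f *ₚ prod gs)) (newCyclo-local m f d fs)
  newCyclo-def m (f ∷ fs) | no _ with foldr _*ₚ_ oneₚ | 2
  ...   | prod | d = ≡.cong (λ gs → divMonic (qm-1 m) (prod gs)) (newCyclo-local m f d fs)

  newCyclo-local : ∀ m f d fs → _ ≡ divisorsAt m d fs
  newCyclo-local m f d []       = ≡.refl
  newCyclo-local m f d (g ∷ fs) with d ∣? m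
  ... | yes _ = ≡.cong (g ∷_) (newCyclo-local m f (suc d) fs)
  ... | no  _ = newCyclo-local m f (suc d) fs

fromℕ : ℕ → ℚ
fromℕ n = ℤ.+ n ℚ./ 1

fromℕ-suc : ∀ n → fromℕ (suc n) ≡ 1ℚ ℚ.+ fromℕ n
fromℕ-suc n = ℚₚ.toℚᵘ-injective (begin
  ℚ.toℚᵘ (fromℕ (suc n))                     ≈⟨ ℚₚ.toℚᵘ-fromℚᵘ (ℚᵘ.mkℚᵘ (ℤ.+ suc n) 0) ⟩
  ℚᵘ.mkℚᵘ (ℤ.+ suc n) 0                      ≈⟨ ℚᵘ.*≡* (≡.cong (λ k → ℤ.+ suc k ℤ.* ℤ.+ 1) (≡.sym (≡.trans (ℕₚ.+-identityʳ _) (ℕₚ.*-identityʳ n)))) ⟩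
  ℚᵘ.mkℚᵘ (ℤ.+ (1 ℕ.+ (n ℕ.* 1 ℕ.+ 0))) 0    ≈⟨ ℚᵘ.*≡* (≡.cong (ℤ._* ℤ.+ 1) (lemma n)) ⟩
  ℚ.toℚᵘ 1ℚ ℚᵘ.+ ℚᵘ.mkℚᵘ (ℤ.+ n) 0           ≈⟨ ℚᵘₚ.+-congʳ (ℚ.toℚᵘ 1ℚ) (ℚₚ.toℚᵘ-fromℚᵘ (ℚᵘ.mkℚᵘ (ℤ.+ n) 0)) ⟨
  ℚ.toℚᵘ 1ℚ ℚᵘ.+ ℚ.toℚᵘ (fromℕ n)            ≈⟨ ℚₚ.toℚᵘ-homo-+ 1ℚ (fromℕ n) ⟨
  ℚ.toℚᵘ (1ℚ ℚ.+ fromℕ n)                    ∎)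
  where
  open ℚᵘₚ.≃-Reasoning
  lemma : ∀ n → ℤ.+ (1 ℕ.+ (n ℕ.* 1 ℕ.+ 0)) ≡ ℤ.+ 1 ℤ.* ℤ.+ 1 ℤ.+ ℤ.+ n ℤ.* ℤ.+ 1
  lemma n = ≡.trans (≡.cong (λ k → ℤ.+ suc k) (≡.trans (ℕₚ.+-identityʳ (n ℕ.* 1)) (ℕₚ.*-identityʳ n)))
    (≡.cong (λ i → ℤ.+ 1 ℤ.+ i) (≡.sym (ℤₚ.*-identityʳ (ℤ.+ n))))

-- Divisibility and coprimality in a commutative ring

module Coprimality {c ℓ} (R : CommutativeRing c ℓ) where

  open RingTheory R

  infix 4 _∣_
  _∣_ : Carrier → Carrier → Set (c ⊔ ℓ)
  a ∣ b = ∃ λ d → b ≈ d * a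

  -- Bézout form: v is at once an inverse of b modulo a.
  Coprime : Carrier → Carrier → Set (c ⊔ ℓ)
  Coprime a b = ∃ λ u → ∃ λ v → u * a + v * b ≈ 1#

  ∣-refl : ∀ {a b} → a ≈ b → a ∣ b
  ∣-refl a≈b = 1# , trans (sym a≈b) (sym (*-identityˡ _))

  1∣ : ∀ a → 1# ∣ a
  1∣ a = a , sym (*-identityʳ a)

  ∣-trans : ∀ {a b d} → a ∣ b → b ∣ d → a ∣ d
  ∣-trans {a} (h , e) (k , e′) = k * h , trans e′ (trans (*-congˡ e) (sym (*-assoc k h a)))

  ∣-* : ∀ {a b a′ b′} → a ∣ b → a′ ∣ b′ → a * a′ ∣ b * b′
  ∣-* {a} {b} {a′} {b′} (h , e) (k , e′) = h * k , trans (*-cong e e′)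
    (solve 4 (λ h a k a′ → h :* a :* (k :* a′) := h :* k :* (a :* a′)) refl h a k a′)

  coprime-1 : ∀ a → Coprime a 1#
  coprime-1 a = 0# , 1# , solve 1 (λ a → con (ℤ.+ 0) :* a :+ con (ℤ.+ 1) :* con (ℤ.+ 1) := con (ℤ.+ 1)) refl a

  coprime-∣ʳ : ∀ {a b d} → Coprime a b → d ∣ b → Coprime a d
  coprime-∣ʳ {a} {b} {d} (u , v , e) (h , e′) = u , v * h , (begin
    u * a + v * h * d   ≈⟨ +-congˡ (trans (*-assoc v h d) (*-congˡ (sym e′))) ⟩
    u * a + v * b       ≈⟨ e ⟩
    1#                  ∎)

  coprime-* : ∀ {a b d} → Coprime a b → Coprime a d → Coprime a (b * d)
  coprime-* {a} {b} {d} (u , v , e) (u′ , v′ , e′) =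
    u * u′ * a + u * (v′ * d) + u′ * (v * b) , v * v′ , (begin
      (u * u′ * a + u * (v′ * d) + u′ * (v * b)) * a + v * v′ * (b * d)
        ≈⟨ solve 7 (λ u v u′ v′ a b d → (u :* u′ :* a :+ u :* (v′ :* d) :+ u′ :* (v :* b)) :* a :+ v :* v′ :* (b :* d)
             := (u :* a :+ v :* b) :* (u′ :* a :+ v′ :* d)) refl u v u′ v′ a b d ⟩
      (u * a + v * b) * (u′ * a + v′ * d)    ≈⟨ *-cong e e′ ⟩
      1# * 1#                                ≈⟨ *-identityˡ 1# ⟩
      1#                                     ∎)

  coprime-∣-∣ : ∀ {a b d} → Coprime a b → a ∣ d → b ∣ d → b * a ∣ d
  coprime-∣-∣ {a} {b} {d} (u , v , e) (h , ea) (k , eb) = u * k + v * h , (begin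
    d                                  ≈⟨ *-identityˡ d ⟨
    1# * d                             ≈⟨ *-congʳ e ⟨
    (u * a + v * b) * d                ≈⟨ solve 5 (λ u a v b d → (u :* a :+ v :* b) :* d := u :* a :* d :+ v :* b :* d) refl u a v b d ⟩
    u * a * d + v * b * d              ≈⟨ +-cong (*-congˡ eb) (*-congˡ ea) ⟩
    u * a * (k * b) + v * b * (h * a)  ≈⟨ solve 6 (λ u a v b h k → u :* a :* (k :* b) :+ v :* b :* (h :* a) := (u :* k :+ v :* h) :* (b :* a)) refl u a v b h k ⟩
    (u * k + v * h) * (b * a)          ∎)

  pow-1-∣ : ∀ z r n → pow z r - 1# ∣ pow z (r ℕ.* n) - 1#
  pow-1-∣ z r n = Σ< n (pow (pow z r)) , trans (+-congʳ (pow-* z r n))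
    (trans (sym (geometric (pow z r) n)) (*-comm (pow z r - 1#) _))

  Σpow-mod : ∀ z n → ∃ λ w → Σ< n (pow z) ≈ nat n + w * (z - 1#)
  Σpow-mod z zero    = 0# , solve 1 (λ z → con (ℤ.+ 0) := con (ℤ.+ 0) :+ con (ℤ.+ 0) :* (z :- con (ℤ.+ 1))) refl z
  Σpow-mod z (suc n) with Σpow-mod z n
  ... | w , e = w + Σ< n (pow z) , (begin
    Σ< (suc n) (pow z)                      ≈⟨ Σ-last n (pow z) ⟩
    Σ< n (pow z) + pow z n                  ≈⟨ solve 2 (λ s p → s :+ p := s :+ (p :- con (ℤ.+ 1)) :+ con (ℤ.+ 1)) refl (Σ< n (pow z)) (pow z n) ⟩
    Σ< n (pow z) + (pow z n - 1#) + 1#      ≈⟨ +-congʳ (+-cong e (sym (geometric z n))) ⟩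
    (nat n + w * (z - 1#)) + (z - 1#) * Σ< n (pow z) + 1#
      ≈⟨ solve 4 (λ n w z s → n :+ w :* (z :- con (ℤ.+ 1)) :+ (z :- con (ℤ.+ 1)) :* s :+ con (ℤ.+ 1)
           := con (ℤ.+ 1) :+ n :+ (w :+ s) :* (z :- con (ℤ.+ 1))) refl (nat n) w z (Σ< n (pow z)) ⟩
    nat (suc n) + (w + Σ< n (pow z)) * (z - 1#)  ∎)

  -- (z^n - 1) / (z - 1) is congruent to n modulo z - 1.
  Σpow-coprime : ∀ z n → Unit (nat n) → Coprime (Σ< n (pow z)) (z - 1#)
  Σpow-coprime z n (v , nv) with Σpow-mod z n
  ... | w , e = v , - (v * w) , (begin
    v * Σ< n (pow z) + - (v * w) * (z - 1#)   ≈⟨ +-congʳ (*-congˡ e) ⟩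
    v * (nat n + w * (z - 1#)) + - (v * w) * (z - 1#)
      ≈⟨ solve 4 (λ v n w z → v :* (n :+ w :* (z :- con (ℤ.+ 1))) :+ :- (v :* w) :* (z :- con (ℤ.+ 1)) := n :* v) refl v (nat n) w z ⟩
    nat n * v                                 ≈⟨ nv ⟩
    1#                                        ∎)

  -- Since w divides the complementary factor d of f in u = s w, cancelling w shows that f divides
  -- s; the Bézout identity of s and w then passes on to f.
  coprime-cofactor : ∀ {f d w u s} → (∀ {a b} → a * w ≈ b * w → a ≈ b) →
    u ≈ f * d → u ≈ s * w → w ∣ d → Coprime s w → Coprime f w
  coprime-cofactor {f} {d} {w} {u} {s} cancel ud us (h , e) (a , b , ab) = a * h , b , (begin
    a * h * f + b * w   ≈⟨ +-congʳ (trans (*-assoc a h f) (*-congˡ hf≈s)) ⟩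
    a * s + b * w       ≈⟨ ab ⟩
    1#                  ∎)
    where
    hf≈s : h * f ≈ s
    hf≈s = cancel (begin
      h * f * w     ≈⟨ solve 3 (λ h f w → h :* f :* w := f :* (h :* w)) refl h f w ⟩
      f * (h * w)   ≈⟨ *-congˡ e ⟨
      f * d         ≈⟨ ud ⟨
      u             ≈⟨ us ⟩
      s * w         ∎)

  coprime-pow-1-∣ : ∀ {f d} z r n → (∀ {a b} → a * (pow z r - 1#) ≈ b * (pow z r - 1#) → a ≈ b) → Unit (nat n) →
    pow z (r ℕ.* n) - 1# ≈ f * d → pow z r - 1# ∣ d → Coprime f (pow z r - 1#)
  coprime-pow-1-∣ z r n cancel n-unit e w∣d =
    coprime-cofactor cancel e (proj₂ (pow-1-∣ z r n)) w∣d (Σpow-coprime (pow z r) n n-unit)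

  -- One Euclidean step: z^s - 1 is z^(s+rn) - 1 minus z^s (z^(rn) - 1), where the first is a
  -- multiple of f and z^(rn) - 1 one of z^r - 1.
  coprime-pow-1-% : ∀ {f} z r n s → f ∣ pow z (s ℕ.+ r ℕ.* n) - 1# → Coprime f (pow z s - 1#) → Coprime f (pow z r - 1#)
  coprime-pow-1-% {f} z r n s (d , e) (u , v , uv) with pow-1-∣ z r n
  ... | h , e′ = u + v * d , - (v * pow z s * h) , (begin
    (u + v * d) * f + - (v * pow z s * h) * w
      ≈⟨ solve 7 (λ u v d f x h w → (u :+ v :* d) :* f :+ :- (v :* x :* h) :* w := u :* f :+ v :* (d :* f :- x :* (h :* w))) refl u v d f (pow z s) h w ⟩
    u * f + v * (d * f - pow z s * (h * w))
      ≈⟨ +-congˡ (*-congˡ (+-cong (trans (sym e) (+-congʳ (pow-+ z s (r ℕ.* n)))) (-‿cong (*-congˡ (sym e′))))) ⟩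
    u * f + v * ((pow z s * pow z (r ℕ.* n) - 1#) - pow z s * (pow z (r ℕ.* n) - 1#))
      ≈⟨ +-congˡ (*-congˡ (solve 2 (λ x y → x :* y :- con (ℤ.+ 1) :- x :* (y :- con (ℤ.+ 1)) := x :- con (ℤ.+ 1)) refl (pow z s) (pow z (r ℕ.* n)))) ⟩
    u * f + v * (pow z s - 1#)   ≈⟨ uv ⟩
    1#                           ∎)
    where w = pow z r - 1#

-- Gaussian binomials and cyclotomic polynomials as computed by division

module Cyclotomic where

  open RingTheory polynomialRing hiding (trans; refl; sym; Carrier)
  open GaussianBinomials polynomialRing
  open PolynomialDivision
  open Coprimality polynomialRing

  X^[_]-1 : ℕ → Poly
  X^[ n ]-1 = pow X n - oneₚ

  lead-+ : ∀ {f g d a} → Lead f d a → Below g d → Lead (f + g) d a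
  lead-+ {f} {g} {d} {a} (lead l u) b = lead
    (≡.trans (at-+ f g d) (≡.trans (≡.cong₂ ℚ._+_ l (b d ℕₚ.≤-refl)) (ℚₚ.+-identityʳ a)))
    (λ n d<n → ≡.trans (at-+ f g n) (≡.cong₂ ℚ._+_ (u n d<n) (b n (ℕₚ.<⇒≤ d<n))))

  monic-one : Monic oneₚ 0
  monic-one = lead ≡.refl λ { (suc n) _ → ≡.refl }

  monic-X : Monic X 1
  monic-X = lead ≡.refl λ { (suc (suc n)) _ → ≡.refl ; (suc zero) (s≤s ()) }

  monic-pow : ∀ n → Monic (pow X n) n
  monic-pow zero    = monic-one
  monic-pow (suc n) = monic-* {X} {pow X n} monic-X (monic-pow n)

  monic-X^-1 : ∀ n → Monic (X^[ suc n ]-1) (suc n)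
  monic-X^-1 n = lead-+ {pow X (suc n)} { - oneₚ} (monic-pow (suc n)) λ { (suc k) _ → ≡.refl }

  qint-X^-1 : ∀ n → qint n *ₚ X^[ 1 ]-1 ≋ X^[ n ]-1
  qint-X^-1 zero    = ≋.sym (+ₚ-inverseʳ oneₚ)
  qint-X^-1 (suc n) = ≋.trans (*ₚ-cong (∷-split 1ℚ (qint n)) (≋.refl {X^[ 1 ]-1})) (q-integer-suc X n {qint n} (qint-X^-1 n))

  monic-qint : ∀ n → Monic (qint (suc n)) n
  monic-qint n = lead (top n) (≡.subst (Below (qint (suc n))) (Listₚ.length-replicate (suc n)) (length-below (qint (suc n))))
    where
    top : ∀ n → at (qint (suc n)) n ≡ 1ℚ
    top zero    = ≡.refl
    top (suc n) = top n

  monic-qfact : ∀ n → ∃ λ d → Monic (qfact n) d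
  monic-qfact zero    = 0 , monic-one
  monic-qfact (suc n) = _ , monic-* {qint (suc n)} {qfact n} (monic-qint n) (proj₂ (monic-qfact n))

  qint-absorb : ∀ n k → qint (suc k) *ₚ qbin X (suc n) (suc k) ≋ qint (suc n) *ₚ qbin X n k
  qint-absorb n k = q-integer-absorb X n k {qint (suc k)} {qint (suc n)} (monic-cancelʳ _ _ (monic-X^-1 0)) (qint-X^-1 (suc k)) (qint-X^-1 (suc n))

  qfact-qbin : ∀ n k → k ℕ.≤ n → qfact n ≋ qbin X n k *ₚ (qfact k *ₚ qfact (n ∸ k))
  qfact-qbin n zero _ = ≋.sym (≋.trans (*ₚ-identityˡ _) (*ₚ-identityˡ (qfact n)))
  qfact-qbin (suc n) (suc k) (s≤s k≤n) = factorial-suc {qfact n} {qfact k} {qfact (n ∸ k)} {qbin X n k} {qbin X (suc n) (suc k)} {qint (suc k)} {qint (suc n)}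
    (qint-absorb n k) (qfact-qbin n k k≤n)

  qbinom-qbin : ∀ n k → qbinom n k ≋ qbin X n k
  qbinom-qbin n k with k ℕ.≤? n
  ... | yes k≤n = divMonic-exact (qfact n) (qfact k *ₚ qfact (n ∸ k))
    (monic-* {qfact k} {qfact (n ∸ k)} (proj₂ (monic-qfact k)) (proj₂ (monic-qfact (n ∸ k)))) (qfact-qbin n k k≤n)
  ... | no k≰n  = ≋.sym (qbin-> X (ℕₚ.≰⇒> k≰n))

  nat-constant : ∀ n → nat n ≋ constant (fromℕ n)
  nat-constant zero    = ≋.sym 0∷[]
  nat-constant (suc n) = ≋.trans (+ₚ-cong (≋.refl {oneₚ}) (nat-constant n)) (∷-cong (≡.sym (fromℕ-suc n)) (≋.refl {[]}))

  nat-unit : ∀ n → Unit (nat (suc n))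
  nat-unit n = constant (ℚ.1/ fromℕ (suc n)) , (begin
    nat (suc n) *ₚ constant (ℚ.1/ fromℕ (suc n))                     ≈⟨ *ₚ-cong (nat-constant (suc n)) (≋.refl {constant (ℚ.1/ fromℕ (suc n))}) ⟩
    constant (fromℕ (suc n)) *ₚ constant (ℚ.1/ fromℕ (suc n))        ≈⟨ const-* (fromℕ (suc n)) _ ⟩
    constant (fromℕ (suc n) ℚ.* (ℚ.1/ fromℕ (suc n)))                ≈⟨ ∷-cong (ℚₚ.*-inverseʳ (fromℕ (suc n))) (≋.refl {[]}) ⟩
    oneₚ                                                            ∎)
    where instance
      nonzero : ℚ.NonZero (fromℕ (suc n))
      nonzero = ℚₚ.pos⇒nonZero (fromℕ (suc n)) {{ℚₚ.normalize-pos (suc n) 1}}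

  replicate-pow : ∀ n f → replicate n 0ℚ ++ f ≋ pow X n *ₚ f
  replicate-pow zero    f = ≋.sym (*ₚ-identityˡ f)
  replicate-pow (suc n) f = ≋.trans (∷-cong ≡.refl (replicate-pow n f))
    (≋.trans (≋.sym (X-* (pow X n *ₚ f))) (≋.sym (*ₚ-assoc X (pow X n) f)))

  qm-1-X^-1 : ∀ p → qm-1 (suc p) ≋ X^[ suc p ]-1
  qm-1-X^-1 p = begin
    ℚ.- 1ℚ ∷ (replicate p 0ℚ ++ oneₚ)                  ≈⟨ ∷-split (ℚ.- 1ℚ) _ ⟩
    - oneₚ + X *ₚ (replicate p 0ℚ ++ oneₚ)             ≈⟨ +ₚ-cong (≋.refl { - oneₚ}) (*ₚ-congˡ X (replicate-pow p oneₚ)) ⟩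
    - oneₚ + X *ₚ (pow X p *ₚ oneₚ)                    ≈⟨ solve 2 (λ X P → :- con (ℤ.+ 1) :+ X :* (P :* con (ℤ.+ 1)) := X :* P :- con (ℤ.+ 1)) ≋.refl X (pow X p) ⟩
    X^[ suc p ]-1                                        ∎

  last-∷ʳ : ∀ (fs : List Poly) f → last (fs ++ f ∷ []) ≡ just f
  last-∷ʳ []            f = ≡.refl
  last-∷ʳ (g ∷ [])      f = ≡.refl
  last-∷ʳ (g ∷ h ∷ fs)  f = last-∷ʳ (h ∷ fs) f

  Φ-suc : ∀ n → Φ (suc n) ≡ newCyclo (suc n) (cycloTable n)
  Φ-suc n rewrite last-∷ʳ (cycloTable n) (newCyclo (suc n) (cycloTable n)) = ≡.refl

  length-cycloTable : ∀ n → length (cycloTable n) ≡ n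
  length-cycloTable zero    = ≡.refl
  length-cycloTable (suc n) = ≡.trans (Listₚ.length-++ (cycloTable n)) (≡.trans (ℕₚ.+-comm _ 1) (≡.cong suc (length-cycloTable n)))

  factorIf : ℕ → ℕ → Poly → Poly
  factorIf d m f with d ∣? m
  ... | yes _ = f
  ... | no  _ = oneₚ

  -- The product of Φ_d over the divisors d ≤ n of m. It grows at the upper end, as `cycloTable`
  -- does.
  ΠΦ : ℕ → ℕ → Poly
  ΠΦ m zero    = oneₚ
  ΠΦ m (suc n) = ΠΦ m n *ₚ factorIf (suc n) m (Φ (suc n))

  prodₚ-divisorsAt-∷ʳ : ∀ m d fs f →
    prodₚ (divisorsAt m d (fs ++ f ∷ [])) ≋ prodₚ (divisorsAt m d fs) *ₚ factorIf (length fs ℕ.+ d) m f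
  prodₚ-divisorsAt-∷ʳ m d [] f with d ∣? m
  ... | yes _ = *ₚ-comm f oneₚ
  ... | no  _ = ≋.refl
  prodₚ-divisorsAt-∷ʳ m d (g ∷ fs) f with d ∣? m
  ... | yes _ = ≋.trans (*ₚ-congˡ g (≋.trans (prodₚ-divisorsAt-∷ʳ m (suc d) fs f) (shift d fs f))) (≋.sym (*ₚ-assoc g (prodₚ (divisorsAt m (suc d) fs)) _))
    where
    shift : ∀ d fs f → prodₚ (divisorsAt m (suc d) fs) *ₚ factorIf (length fs ℕ.+ suc d) m f ≋
      prodₚ (divisorsAt m (suc d) fs) *ₚ factorIf (suc (length fs ℕ.+ d)) m f
    shift d fs f = ≡⇒≋ (≡.cong (λ k → prodₚ (divisorsAt m (suc d) fs) *ₚ factorIf k m f) (ℕₚ.+-suc (length fs) d))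
  ... | no  _ = ≋.trans (prodₚ-divisorsAt-∷ʳ m (suc d) fs f)
    (≡⇒≋ (≡.cong (λ k → prodₚ (divisorsAt m (suc d) fs) *ₚ factorIf k m f) (ℕₚ.+-suc (length fs) d)))

  prodₚ-ΠΦ : ∀ m n → prodₚ (divisorsAt m 1 (cycloTable n)) ≋ ΠΦ m n
  prodₚ-ΠΦ m zero    = ≋.refl
  prodₚ-ΠΦ m (suc n) = ≋.trans (prodₚ-divisorsAt-∷ʳ m 1 (cycloTable n) _) (*ₚ-cong (prodₚ-ΠΦ m n)
    (≡⇒≋ (≡.cong₂ (λ k f → factorIf k m f) (≡.trans (ℕₚ.+-comm _ 1) (≡.cong suc (length-cycloTable n))) (≡.sym (Φ-suc n)))))

  -- The facts that strong induction carries along, indexed by p = m - 1. `coprime` later makes q^r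
  -- - 1 invertible; `factorize` is what larger indices need about their divisors.
  record IsCyclotomic (p : ℕ) : Set where
    field
      degree    : ℕ
      monic     : Monic (Φ (suc p)) degree
      divides   : Φ (suc p) ∣ X^[ suc p ]-1
      coprime   : ∀ r → r ℕ.< p → Coprime (Φ (suc p)) (X^[ suc r ]-1)
      factorize : X^[ suc p ]-1 ≋ ΠΦ (suc p) (suc p)

  private
    coprime-ΠΦ : ∀ {f} m k → (∀ r → r ℕ.< k → IsCyclotomic r) → (∀ r → r ℕ.< k → Coprime f (X^[ suc r ]-1)) → Coprime f (ΠΦ m k)
    coprime-ΠΦ {f} m zero    facts c = coprime-1 f
    coprime-ΠΦ {f} m (suc k) facts c = coprime-* (coprime-ΠΦ m k (λ r r<k → facts r (ℕₚ.m<n⇒m<1+n r<k)) (λ r r<k → c r (ℕₚ.m<n⇒m<1+n r<k))) new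
      where
      new : Coprime f (factorIf (suc k) m (Φ (suc k)))
      new with suc k ∣? m
      ... | yes _ = coprime-∣ʳ (c k (ℕₚ.n<1+n k)) (IsCyclotomic.divides (facts k (ℕₚ.n<1+n k)))
      ... | no  _ = coprime-1 f

    -- Coprime divisors multiply: each new Φ_(k+1) is coprime to X^r - 1 for r ≤ k, hence to all
    -- earlier factors, and for k + 1 dividing m it divides X^m - 1.
    ΠΦ-∣ : ∀ m k → (∀ r → r ℕ.< k → IsCyclotomic r) → ΠΦ m k ∣ X^[ m ]-1
    ΠΦ-∣ m zero    facts = 1∣ (X^[ m ]-1)
    ΠΦ-∣ m (suc k) facts with suc k ∣? m | ΠΦ-∣ m k (λ r r<k → facts r (ℕₚ.m<n⇒m<1+n r<k))
    ... | no _  | rec = ∣-trans (∣-refl (*-identityʳ (ΠΦ m k))) rec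
    ... | yes (ℕ-Div.divides n m≡n*k) | rec = coprime-∣-∣
        (coprime-ΠΦ m k (λ r r<k → facts r (ℕₚ.m<n⇒m<1+n r<k)) K.coprime)
        (∣-trans K.divides (≡.subst (λ n → X^[ suc k ]-1 ∣ X^[ n ]-1) (≡.trans (ℕₚ.*-comm (suc k) n) (≡.sym m≡n*k)) (pow-1-∣ X (suc k) n)))
        rec
      where module K = IsCyclotomic (facts k (ℕₚ.n<1+n k))

    ΠΦ-monic : ∀ m k → (∀ r → r ℕ.< k → IsCyclotomic r) → ∃ λ d → Monic (ΠΦ m k) d
    ΠΦ-monic m zero    facts = 0 , monic-one
    ΠΦ-monic m (suc k) facts with ΠΦ-monic m k (λ r r<k → facts r (ℕₚ.m<n⇒m<1+n r<k))
    ... | d , mono with suc k ∣? m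
    ...   | yes _ = _ , monic-* {ΠΦ m k} {Φ (suc k)} mono (IsCyclotomic.monic (facts k (ℕₚ.n<1+n k)))
    ...   | no  _ = _ , monic-* {ΠΦ m k} {oneₚ} mono monic-one

    ΠΦ-mono : ∀ r m k → r ℕ-Div.∣ m → ΠΦ r k ∣ ΠΦ m k
    ΠΦ-mono r m zero    r∣m = 1∣ oneₚ
    ΠΦ-mono r m (suc k) r∣m = ∣-* {b = ΠΦ m k} (ΠΦ-mono r m k r∣m) new
      where
      new : factorIf (suc k) r (Φ (suc k)) ∣ factorIf (suc k) m (Φ (suc k))
      new with suc k ∣? r | suc k ∣? m
      ... | yes _   | yes _   = ∣-refl ≋.refl
      ... | yes k∣r | no k∤m  = contradiction (ℕ-Div.∣-trans k∣r r∣m) k∤m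
      ... | no _    | yes _   = 1∣ (Φ (suc k))
      ... | no _    | no _    = 1∣ oneₚ

    ΠΦ-≤ : ∀ m k d → ΠΦ m k ∣ ΠΦ m (d ℕ.+ k)
    ΠΦ-≤ m k zero    = ∣-refl ≋.refl
    ΠΦ-≤ m k (suc d) = ∣-trans (∣-refl (≋.sym (*-identityʳ (ΠΦ m k)))) (∣-* (ΠΦ-≤ m k d) (1∣ _))

    -- Divisibility makes the division in `newCyclo` exact, so the computed list is the true
    -- cofactor.
    cyclotomic-quotient : ∀ p → (∀ r → r ℕ.< p → IsCyclotomic r) → X^[ suc p ]-1 ≋ Φ (suc p) *ₚ ΠΦ (suc p) p
    cyclotomic-quotient p facts with ΠΦ-∣ (suc p) p facts
    ... | h , e = ≋.trans e (*ₚ-cong (≋.sym Φ≋h) (≋.refl {ΠΦ (suc p) p}))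
      where
      m = suc p
      Φ≋h : Φ m ≋ h
      Φ≋h = ≋.trans (≡⇒≋ (≡.trans (Φ-suc p) (newCyclo-def m (cycloTable p))))
        (divMonic-exact (qm-1 m) (prodₚ (divisorsAt m 1 (cycloTable p)))
          (lead-cong (≋.sym (prodₚ-ΠΦ m p)) (proj₂ (ΠΦ-monic m p facts)))
          (≋.trans (qm-1-X^-1 p) (≋.trans e (*ₚ-congˡ h (≋.sym (prodₚ-ΠΦ m p))))))

    X^-1-cancel : ∀ r {f g} → f *ₚ X^[ suc r ]-1 ≋ g *ₚ X^[ suc r ]-1 → f ≋ g
    X^-1-cancel r = monic-cancelʳ _ _ (monic-X^-1 r)

    -- For a proper divisor of m, X^(r+1) - 1 is the product of the Φ_d with d dividing r + 1. All
    -- of these occur among the factors complementary to f, so `coprime-cofactor` applies to X^m -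
    -- 1.
    coprime-divisor : ∀ {f} p r → (∀ r → r ℕ.< p → IsCyclotomic r) → X^[ suc p ]-1 ≋ f *ₚ ΠΦ (suc p) p →
      r ℕ.< p → suc r ℕ-Div.∣ suc p → Coprime f (X^[ suc r ]-1)
    coprime-divisor p r facts e r<p (ℕ-Div.divides zero ())
    coprime-divisor p r facts e r<p r∣m@(ℕ-Div.divides (suc n) m≡n*r) =
      coprime-pow-1-∣ X (suc r) (suc n) (X^-1-cancel r) (nat-unit n)
        (≋.trans (≡⇒≋ (≡.cong X^[_]-1 (≡.trans (ℕₚ.*-comm (suc r) (suc n)) (≡.sym m≡n*r)))) e)
        (∣-trans (∣-refl (IsCyclotomic.factorize (facts r r<p)))
          (∣-trans (ΠΦ-mono (suc r) (suc p) (suc r) r∣m)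
            (≡.subst (λ k → ΠΦ (suc p) (suc r) ∣ ΠΦ (suc p) k) (ℕₚ.m∸n+n≡m r<p) (ΠΦ-≤ (suc p) (suc r) (p ∸ suc r)))))

    -- Euclid's algorithm on the exponents.
    coprime-below : ∀ {f} p → (∀ r → r ℕ.< p → IsCyclotomic r) → X^[ suc p ]-1 ≋ f *ₚ ΠΦ (suc p) p →
      ∀ n r → r ℕ.< n → r ℕ.< p → Coprime f (X^[ suc r ]-1)
    coprime-below {f} p facts e (suc n) r (s≤s r≤n) r<p with suc r ∣? suc p
    ... | yes r∣m = coprime-divisor p r facts e r<p r∣m
    ... | no r∤m  with suc p ℕ.% suc r in s-def
    ...   | zero  = contradiction (ℕ-Div.m%n≡0⇒n∣m (suc p) (suc r) s-def) r∤m
    ...   | suc s = coprime-pow-1-% X (suc r) (suc p ℕ./ suc r) (suc s)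
        (ΠΦ (suc p) p , ≋.trans (≡⇒≋ (≡.cong X^[_]-1 (≡.sym m≡))) (≋.trans e (*ₚ-comm f (ΠΦ (suc p) p))))
        (coprime-below p facts e n s (ℕₚ.<-≤-trans s<r r≤n) (ℕₚ.<-trans s<r r<p))
      where
      s<r : s ℕ.< r
      s<r = ℕₚ.≤-pred (≡.subst (ℕ._< suc r) s-def (m%n<n (suc p) (suc r)))
      m≡ : suc p ≡ suc s ℕ.+ suc r ℕ.* (suc p ℕ./ suc r)
      m≡ = ≡.trans (m≡m%n+[m/n]*n (suc p) (suc r)) (≡.cong₂ ℕ._+_ s-def (ℕₚ.*-comm (suc p ℕ./ suc r) (suc r)))

    ΠΦ-last : ∀ p → ΠΦ (suc p) p *ₚ Φ (suc p) ≋ ΠΦ (suc p) (suc p)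
    ΠΦ-last p = *ₚ-congˡ (ΠΦ (suc p) p) (self (suc p) (Φ (suc p)))
      where
      self : ∀ m f → f ≋ factorIf m m f
      self m f with m ∣? m
      ... | yes _  = ≋.refl
      ... | no m∤m = contradiction ℕ-Div.∣-refl m∤m

    cyclotomic-step : ∀ p → (∀ r → r ℕ.< p → IsCyclotomic r) → IsCyclotomic p
    cyclotomic-step p facts = record
      { degree    = proj₁ Φ-monic
      ; monic     = proj₂ Φ-monic
      ; divides   = ΠΦ (suc p) p , e′
      ; coprime   = λ r r<p → coprime-below p facts e p r r<p r<p
      ; factorize = ≋.trans e′ (ΠΦ-last p)
      }
      where
      e : X^[ suc p ]-1 ≋ Φ (suc p) *ₚ ΠΦ (suc p) p
      e = cyclotomic-quotient p facts
      e′ : X^[ suc p ]-1 ≋ ΠΦ (suc p) p *ₚ Φ (suc p)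
      e′ = ≋.trans e (*ₚ-comm (Φ (suc p)) (ΠΦ (suc p) p))
      Φ-monic : ∃ λ d → Monic (Φ (suc p)) d
      Φ-monic = monic-factor {Φ (suc p)} {ΠΦ (suc p) p} e (monic-X^-1 p) (proj₂ (ΠΦ-monic (suc p) p facts))

    cyclotomic-below : ∀ n r → r ℕ.< n → IsCyclotomic r
    cyclotomic-below (suc n) r (s≤s r≤n) = cyclotomic-step r (λ s s<r → cyclotomic-below n s (ℕₚ.<-≤-trans s<r r≤n))

  Φ-isCyclotomic : ∀ p → IsCyclotomic p
  Φ-isCyclotomic p = cyclotomic-below (suc p) p (ℕₚ.n<1+n p)

-- Integer powers of units, exponents modulo m, and evaluation of Laurent polynomials

module IntegerPowers {c ℓ} (R : CommutativeRing c ℓ) where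

  open RingTheory R

  zpow-⊖ : ∀ {z w} → z * w ≈ 1# → ∀ m n → zpow z w (m ℤ.⊖ n) ≈ pow z m * pow w n
  zpow-⊖ zw m       zero    = sym (*-identityʳ _)
  zpow-⊖ zw zero    (suc n) = sym (*-identityˡ _)
  zpow-⊖ {z} {w} zw (suc m) (suc n) = begin
    zpow z w (suc m ℤ.⊖ suc n)      ≈⟨ ≡⇒≈ (≡.cong (zpow z w) (ℤₚ.[1+m]⊖[1+n]≡m⊖n m n)) ⟩
    zpow z w (m ℤ.⊖ n)              ≈⟨ zpow-⊖ zw m n ⟩
    pow z m * pow w n               ≈⟨ *-identityˡ _ ⟨
    1# * (pow z m * pow w n)        ≈⟨ *-congʳ zw ⟨
    z * w * (pow z m * pow w n)     ≈⟨ solve 4 (λ z w a b → z :* w :* (a :* b) := z :* a :* (w :* b)) refl z w _ _ ⟩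
    z * pow z m * (w * pow w n)     ∎

  zpow-+ : ∀ {z w} → z * w ≈ 1# → ∀ i j → zpow z w (i ℤ.+ j) ≈ zpow z w i * zpow z w j
  zpow-+ {z} zw (+ m)      (+ n)      = pow-+ z m n
  zpow-+     zw (+ m)      (-[1+ n ]) = zpow-⊖ zw m (suc n)
  zpow-+     zw (-[1+ m ]) (+ n)      = trans (zpow-⊖ zw n (suc m)) (*-comm _ _)
  zpow-+ {w = w} zw (-[1+ m ]) (-[1+ n ]) =
    trans (≡⇒≈ (≡.cong (pow w) (≡.cong suc (≡.sym (ℕₚ.+-suc m n))))) (pow-+ w (suc m) (suc n))

  zpow-* : ∀ z w M i → zpow z w (+ suc M ℤ.* i) ≈ zpow (pow z (suc M)) (pow w (suc M)) i
  zpow-* z w M (+ n)      = trans (≡⇒≈ (≡.cong (zpow z w) (≡.sym (ℤₚ.pos-* (suc M) n)))) (pow-* z (suc M) n)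
  zpow-* z w M (-[1+ n ]) = pow-* w (suc M) (suc n)

  zpow-1 : ∀ {z w} → z ≈ 1# → z * w ≈ 1# → ∀ i → zpow z w i ≈ 1#
  zpow-1 z≈1 zw (+ n)      = trans (pow-cong n z≈1) (pow-1 n)
  zpow-1 z≈1 zw (-[1+ n ]) = trans (pow-cong (suc n) (trans (sym (*-identityˡ _)) (trans (*-congʳ (sym z≈1)) zw))) (pow-1 (suc n))

  zpow-unit : ∀ {z w} → z * w ≈ 1# → ∀ i → Unit (zpow z w i)
  zpow-unit {z} {w} zw i = zpow z w (ℤ.- i) , trans (sym (zpow-+ zw i (ℤ.- i))) (≡⇒≈ (≡.cong (zpow z w) (ℤₚ.+-inverseʳ i)))

  pow-inverse : ∀ {z w} → z * w ≈ 1# → ∀ n → pow z n * pow w n ≈ 1#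
  pow-inverse {z} {w} zw n = trans (sym (pow-distrib z w n)) (trans (pow-cong n zw) (pow-1 n))

module EvaluationModulo (m : ℕ) where

  open Quotient ℤₚ.+-*-commutativeRing (+ m)
  open CommutativeRing quotient using (refl; *-cong; +-cong; *-congˡ)

  ^-cong : ∀ {i j} → i ∼ j → ∀ n → i ℤ.^ n ∼ j ℤ.^ n
  ^-cong i∼j zero    = refl
  ^-cong i∼j (suc n) = *-cong i∼j (^-cong i∼j n)

  eval5-cong : ∀ α {a b d f k a′ b′ d′ f′ k′} → a ∼ a′ → b ∼ b′ → d ∼ d′ → f ∼ f′ → k ∼ k′ →
    eval5 α a b d f k ∼ eval5 α a′ b′ d′ f′ k′
  eval5-cong [] _ _ _ _ _ = refl
  eval5-cong ((n , (e₁ ∷ e₂ ∷ e₃ ∷ e₄ ∷ e₅ ∷ [])) ∷ α) a b d f k =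
    +-cong (*-cong (*-cong (*-cong (*-cong (*-congˡ {n} (^-cong a e₁)) (^-cong b e₂)) (^-cong d e₃)) (^-cong f e₄)) (^-cong k e₅))
      (eval5-cong α a b d f k)

  multiple∼0 : ∀ n → + (m ℕ.* n) ∼ + 0
  multiple∼0 n = by (+ n) (≡.trans (ℤₚ.pos-* m n) (≡.sym (ℤₚ.+-identityˡ _)))

  -- Integer polynomials respect congruences: modulo m the arguments m n vanish and mj + i becomes
  -- i, so α takes the value α(0, i) = i².
  eval5-mod : ∀ α → BaseCond α → ∀ n₁ n₂ n₃ n₄ j i →
    ∃ λ h → eval5 α (+ (m ℕ.* n₁)) (+ (m ℕ.* n₂)) (+ (m ℕ.* n₃)) (+ (m ℕ.* n₄)) (+ (m ℕ.* j ℕ.+ i)) ≡ + (i ℕ.* i) ℤ.+ + m ℤ.* h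
  eval5-mod α base n₁ n₂ n₃ n₄ j i with eval5-cong α (multiple∼0 n₁) (multiple∼0 n₂) (multiple∼0 n₃) (multiple∼0 n₄) k∼i
    where
    k∼i : + (m ℕ.* j ℕ.+ i) ∼ + i
    k∼i = by (+ j) (≡.trans (ℤₚ.+-comm (+ (m ℕ.* j)) (+ i)) (≡.cong (λ k → + i ℤ.+ k) (ℤₚ.pos-* m j)))
  ... | by h e = h , ≡.trans e (≡.cong (λ k → k ℤ.+ + m ℤ.* h) (≡.trans (base (+ i)) (≡.sym (ℤₚ.pos-* i i))))

fromℕ-*-/ : ∀ d i → fromℕ (suc d) ℚ.* (i ℚ./ suc d) ≡ i ℚ./ 1
fromℕ-*-/ d i = ℚₚ.toℚᵘ-injective (begin
  ℚ.toℚᵘ (fromℕ (suc d) ℚ.* (i ℚ./ suc d))              ≈⟨ ℚₚ.toℚᵘ-homo-* (fromℕ (suc d)) (i ℚ./ suc d) ⟩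
  ℚ.toℚᵘ (fromℕ (suc d)) ℚᵘ.* ℚ.toℚᵘ (i ℚ./ suc d)      ≈⟨ ℚᵘₚ.*-cong (ℚₚ.toℚᵘ-fromℚᵘ (ℚᵘ.mkℚᵘ (+ suc d) 0)) (ℚₚ.toℚᵘ-fromℚᵘ (ℚᵘ.mkℚᵘ i d)) ⟩
  ℚᵘ.mkℚᵘ (+ suc d) 0 ℚᵘ.* ℚᵘ.mkℚᵘ i d                  ≈⟨ ℚᵘ.*≡* (≡.trans (ℤₚ.*-identityʳ _) (≡.trans (ℤₚ.*-comm (+ suc d) i) (≡.cong (λ k → i ℤ.* + suc k) (≡.sym (ℕₚ.+-identityʳ d))))) ⟩
  ℚᵘ.mkℚᵘ i 0                                           ≈⟨ ℚₚ.toℚᵘ-fromℚᵘ (ℚᵘ.mkℚᵘ i 0) ⟨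
  ℚ.toℚᵘ (i ℚ./ 1)                                      ∎)
  where open ℚᵘₚ.≃-Reasoning

module LaurentEvaluation {c ℓ} (R : CommutativeRing c ℓ) (ι : ℚ → CommutativeRing.Carrier R)
  (ι-+ : ∀ a b → CommutativeRing._≈_ R (ι (a ℚ.+ b)) (CommutativeRing._+_ R (ι a) (ι b)))
  (ι-* : ∀ a b → CommutativeRing._≈_ R (ι (a ℚ.* b)) (CommutativeRing._*_ R (ι a) (ι b)))
  (ι-0 : CommutativeRing._≈_ R (ι 0ℚ) (CommutativeRing.0# R))
  (ι-1 : CommutativeRing._≈_ R (ι 1ℚ) (CommutativeRing.1# R))
  where

  open RingTheory R
  open Evaluation R ι ι-+ ι-* ι-0 ι-1
  open IntegerPowers R

  ι-nat : ∀ n → ι (fromℕ n) ≈ nat n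
  ι-nat zero    = ι-0
  ι-nat (suc n) = trans (≡⇒≈ (≡.cong ι (fromℕ-suc n))) (trans (ι-+ 1ℚ (fromℕ n)) (+-cong ι-1 (ι-nat n)))

  ι-neg-1 : ι (ℚ.- 1ℚ) ≈ - 1#
  ι-neg-1 = begin
    ι (ℚ.- 1ℚ)                  ≈⟨ solve 1 (λ a → a := a :+ con (+ 1) :- con (+ 1)) refl _ ⟩
    ι (ℚ.- 1ℚ) + 1# - 1#        ≈⟨ +-congʳ (trans (+-congˡ (sym ι-1)) (trans (sym (ι-+ (ℚ.- 1ℚ) 1ℚ)) ι-0)) ⟩
    0# - 1#                     ≈⟨ +-identityˡ _ ⟩
    - 1#                        ∎

  evalL : Carrier → Carrier → LPoly → Carrier
  evalL z w (mkL s f) = zpow z w s * eval z f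

  -- The zeros that `⊕` puts in front of a body make up for lowering its starting exponent from s to
  -- u.
  evalL-pad : ∀ {z w} → z * w ≈ 1# → ∀ s u f → u ℤ.≤ s →
    zpow z w u * eval z (replicate ℤ.∣ s ℤ.- u ∣ 0ℚ ++ f) ≈ zpow z w s * eval z f
  evalL-pad {z} {w} zw s u f u≤s = begin
    zpow z w u * eval z (replicate ℤ.∣ s ℤ.- u ∣ 0ℚ ++ f)        ≈⟨ *-congˡ (eval-replicate z ℤ.∣ s ℤ.- u ∣ f) ⟩
    zpow z w u * (zpow z w (+ ℤ.∣ s ℤ.- u ∣) * eval z f)         ≈⟨ *-assoc _ _ _ ⟨
    zpow z w u * zpow z w (+ ℤ.∣ s ℤ.- u ∣) * eval z f           ≈⟨ *-congʳ (zpow-+ zw u (+ ℤ.∣ s ℤ.- u ∣)) ⟨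
    zpow z w (u ℤ.+ + ℤ.∣ s ℤ.- u ∣) * eval z f                  ≈⟨ *-congʳ (≡⇒≈ (≡.cong (zpow z w) shift)) ⟩
    zpow z w s * eval z f                                        ∎
    where
    shift : u ℤ.+ + ℤ.∣ s ℤ.- u ∣ ≡ s
    shift = ≡.trans (≡.cong (λ k → u ℤ.+ k) (ℤₚ.0≤i⇒+∣i∣≡i (ℤₚ.i≤j⇒0≤j-i u≤s)))
      (≡.trans (ℤₚ.+-comm u (s ℤ.- u)) (≡.trans (ℤₚ.+-assoc s (ℤ.- u) u)
        (≡.trans (≡.cong (λ k → s ℤ.+ k) (ℤₚ.+-inverseˡ u)) (ℤₚ.+-identityʳ s))))

  evalL-⊕ : ∀ {z w} → z * w ≈ 1# → ∀ f g → evalL z w (f ⊕ g) ≈ evalL z w f + evalL z w g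
  evalL-⊕ {z} {w} zw (mkL s f) (mkL t g) = trans (*-congˡ (eval-+ z (replicate ℤ.∣ s ℤ.- (s ℤ.⊓ t) ∣ 0ℚ ++ f) _))
    (trans (distribˡ _ _ _) (+-cong (evalL-pad zw s (s ℤ.⊓ t) f (ℤₚ.i⊓j≤i s t)) (evalL-pad zw t (s ℤ.⊓ t) g (ℤₚ.i⊓j≤j s t))))

  evalL-⊖ : ∀ {z w} → z * w ≈ 1# → ∀ f g → evalL z w (f ⊖ g) ≈ evalL z w f - evalL z w g
  evalL-⊖ {z} {w} zw f g@(mkL t b) = trans (evalL-⊕ zw f (negL g)) (+-congˡ (trans (*-congˡ (trans (eval-scale z (ℚ.- 1ℚ) b) (*-congʳ ι-neg-1)))
    (solve 2 (λ u e → u :* (:- con (+ 1) :* e) := :- (u :* e)) refl (zpow z w t) (eval z b))))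

  evalL-⊗ : ∀ {z w} → z * w ≈ 1# → ∀ f g → evalL z w (f ⊗ g) ≈ evalL z w f * evalL z w g
  evalL-⊗ {z} {w} zw (mkL s f) (mkL t g) = trans (*-cong (zpow-+ zw s t) (eval-* z f g))
    (solve 4 (λ u v a b → u :* v :* (a :* b) := u :* a :* (v :* b)) refl (zpow z w s) (zpow z w t) (eval z f) (eval z g))

  evalL-fromPoly : ∀ z w f → evalL z w (fromPoly f) ≈ eval z f
  evalL-fromPoly z w f = *-identityˡ _

  evalL-constL : ∀ z w a → evalL z w (constL a) ≈ ι a
  evalL-constL z w a = trans (*-identityˡ _) (eval-constant z a)

  evalL-qpow : ∀ z w e → evalL z w (qpow e) ≈ zpow z w e
  evalL-qpow z w e = trans (*-congˡ (trans (eval-constant z 1ℚ) ι-1)) (*-identityʳ _)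

  evalL-sum : ∀ {z w} → z * w ≈ 1# → ∀ (t : ℕ → LPoly) n → evalL z w (sumL (map t (upTo n))) ≈ Σ< n (λ k → evalL z w (t k))
  evalL-sum {z} {w} zw t n = go n (λ k → k)
    where
    go : ∀ n g → evalL z w (sumL (map t (applyUpTo g n))) ≈ Σ< n (λ k → evalL z w (t (g k)))
    go zero    g = *-identityˡ 0#
    go (suc n) g = trans (evalL-⊕ zw (t (g 0)) _) (+-congˡ (go n (λ k → g (suc k))))

  evalL-substL : ∀ z w M f → evalL z w (substL (suc M) f) ≈ evalL (pow z (suc M)) (pow w (suc M)) f
  evalL-substL z w M (mkL s f) = *-cong (zpow-* z w M s) (eval-spread z M f)

  -- The power of z in front is a unit, so vanishing can be tested on the ordinary polynomial behind
  -- it.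
  evalL-0 : ∀ {z w} → z * w ≈ 1# → ∀ f → evalL z w f ≈ 0# → eval z (body f) ≈ 0#
  evalL-0 zw (mkL s f) e = unit-cancel (zpow-unit zw s) (trans e (sym (zeroʳ _)))

  product : Carrier → (N₁ N₂ N₃ N₄ k : ℕ) → Carrier
  product z N₁ N₂ N₃ N₄ k =
    qbin z N₁ k * qbin z N₃ k * qbin z (N₁ ℕ.+ N₂ ∸ k) N₁ * qbin z (N₃ ℕ.+ N₄ ∸ k) N₃

  eval-qbinom : ∀ z n k → eval z (qbinom n k) ≈ qbin z n k
  eval-qbinom z n k = trans (eval-cong z (Cyclotomic.qbinom-qbin n k)) (eval-qbin z n k)

  evalL-Aq : ∀ {z w} → z * w ≈ 1# → ∀ α N₁ N₂ N₃ N₄ → evalL z w (Aq α N₁ N₂ N₃ N₄) ≈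
    Σ< (suc N₁) (λ k → zpow z w (eval5 α (+ N₁) (+ N₂) (+ N₃) (+ N₄) (+ k)) * product z N₁ N₂ N₃ N₄ k)
  evalL-Aq {z} {w} zw α N₁ N₂ N₃ N₄ = trans (evalL-sum zw (λ k → qpow (e k) ⊗ fromPoly (b₁ k *ₚ b₃ k *ₚ b₂ k *ₚ b₄ k)) (suc N₁)) (Σ-cong (suc N₁) (λ k _ →
    trans (evalL-⊗ zw (qpow (e k)) (fromPoly (b₁ k *ₚ b₃ k *ₚ b₂ k *ₚ b₄ k)))
      (*-cong (evalL-qpow z w (e k)) (trans (evalL-fromPoly z w (b₁ k *ₚ b₃ k *ₚ b₂ k *ₚ b₄ k)) (factors k)))))
    where
    e : ℕ → ℤ
    e k = eval5 α (+ N₁) (+ N₂) (+ N₃) (+ N₄) (+ k)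
    b₁ b₂ b₃ b₄ : ℕ → Poly
    b₁ k = qbinom N₁ k
    b₃ k = qbinom N₃ k
    b₂ k = qbinom (N₁ ℕ.+ N₂ ∸ k) N₁
    b₄ k = qbinom (N₃ ℕ.+ N₄ ∸ k) N₃
    factors : ∀ k → eval z (b₁ k *ₚ b₃ k *ₚ b₂ k *ₚ b₄ k) ≈ product z N₁ N₂ N₃ N₄ k
    factors k = trans (eval-* z (b₁ k *ₚ b₃ k *ₚ b₂ k) (b₄ k)) (*-cong (trans (eval-* z (b₁ k *ₚ b₃ k) (b₂ k))
      (*-cong (trans (eval-* z (b₁ k) (b₃ k)) (*-cong (eval-qbinom z N₁ k) (eval-qbinom z N₃ k)))
        (eval-qbinom z (N₁ ℕ.+ N₂ ∸ k) N₁))) (eval-qbinom z (N₃ ℕ.+ N₄ ∸ k) N₃))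

  nat-A1 : ∀ n₁ n₂ n₃ n₄ → nat (A1 n₁ n₂ n₃ n₄) ≈ Σ< (suc n₁) (λ k →
    nat (n₁ C k) * nat (n₃ C k) * nat ((n₁ ℕ.+ n₂ ∸ k) C n₁) * nat ((n₃ ℕ.+ n₄ ∸ k) C n₃))
  nat-A1 n₁ n₂ n₃ n₄ = trans (nat-sum (λ k → (n₁ C k) ℕ.* (n₃ C k) ℕ.* ((n₁ ℕ.+ n₂ ∸ k) C n₁) ℕ.* ((n₃ ℕ.+ n₄ ∸ k) C n₃)) (suc n₁)) (Σ-cong (suc n₁) (λ k _ →
    trans (nat-* ((n₁ C k) ℕ.* (n₃ C k) ℕ.* ((n₁ ℕ.+ n₂ ∸ k) C n₁)) ((n₃ ℕ.+ n₄ ∸ k) C n₃))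
      (*-congʳ (trans (nat-* ((n₁ C k) ℕ.* (n₃ C k)) ((n₁ ℕ.+ n₂ ∸ k) C n₁)) (*-congʳ (nat-* (n₁ C k) (n₃ C k)))))))
    where
    nat-sum : ∀ (t : ℕ → ℕ) n → nat (foldr ℕ._+_ 0 (map t (upTo n))) ≈ Σ< n (λ k → nat (t k))
    nat-sum t n = go n (λ k → k)
      where
      go : ∀ n g → nat (foldr ℕ._+_ 0 (map t (applyUpTo g n))) ≈ Σ< n (λ k → nat (t (g k)))
      go zero    g = refl
      go (suc n) g = trans (nat-+ (t (g 0)) _) (+-congˡ (go n (λ k → g (suc k))))

  -- Of the factor 24, 12 clears the denominator of (m² - 1)/12 and 2 that of R(n).
  correction : ∀ p n₁ n₂ n₃ n₄ →
    nat 24 * ι (((+ (suc p ℕ.* suc p) ℤ.- + 1) ℚ./ 12) ℚ.* Rn n₁ n₂ n₃ n₄) ≈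
      (nat (suc p) * nat (suc p) - 1#) * ((nat n₁ * nat n₂ + nat n₃ * nat n₄) * nat (A1 n₁ n₂ n₃ n₄))
  correction p n₁ n₂ n₃ n₄ = begin
    nat 24 * ι (i ℚ.* (h ℚ.* a))
      ≈⟨ *-cong (nat-* 12 2) (trans (ι-* i (h ℚ.* a)) (*-congˡ (ι-* h a))) ⟩
    nat 12 * nat 2 * (ι i * (ι h * ι a))
      ≈⟨ solve 5 (λ t d i h a → t :* d :* (i :* (h :* a)) := t :* i :* (d :* h :* a)) refl (nat 12) (nat 2) (ι i) (ι h) (ι a) ⟩
    nat 12 * ι i * (nat 2 * ι h * ι a)
      ≈⟨ *-cong (cancel 11 (+ (suc p ℕ.* suc p) ℤ.- + 1)) (*-cong (cancel 1 (+ N)) (ι-nat (A1 n₁ n₂ n₃ n₄))) ⟩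
    -- The integer m² - 1 computes to this natural number.
    ι (fromℕ (p ℕ.+ p ℕ.* suc p)) * (ι (fromℕ N) * nat (A1 n₁ n₂ n₃ n₄))
      ≈⟨ *-cong (trans (ι-nat (p ℕ.+ p ℕ.* suc p)) predecessor) (*-congʳ (trans (ι-nat N) (trans (nat-+ (n₁ ℕ.* n₂) (n₃ ℕ.* n₄)) (+-cong (nat-* n₁ n₂) (nat-* n₃ n₄))))) ⟩
    (nat (suc p) * nat (suc p) - 1#) * ((nat n₁ * nat n₂ + nat n₃ * nat n₄) * nat (A1 n₁ n₂ n₃ n₄))  ∎
    where
    N = n₁ ℕ.* n₂ ℕ.+ n₃ ℕ.* n₄
    i h a : ℚ
    i = (+ (suc p ℕ.* suc p) ℤ.- + 1) ℚ./ 12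
    h = + N ℚ./ 2
    a = fromℕ (A1 n₁ n₂ n₃ n₄)
    cancel : ∀ d j → nat (suc d) * ι (j ℚ./ suc d) ≈ ι (j ℚ./ 1)
    cancel d j = trans (*-congʳ (sym (ι-nat (suc d)))) (trans (sym (ι-* (fromℕ (suc d)) (j ℚ./ suc d))) (≡⇒≈ (≡.cong ι (fromℕ-*-/ d j))))
    predecessor : nat (p ℕ.+ p ℕ.* suc p) ≈ nat (suc p) * nat (suc p) - 1#
    predecessor = trans (solve 1 (λ n → n := (con (+ 1) :+ n) :- con (+ 1)) refl _) (+-congʳ (nat-* (suc p) (suc p)))

  module Apéry (α : IntPoly5) (homogeneous : Homogeneous2 α) (base : BaseCond α) (p n₁ n₂ n₃ n₄ : ℕ)
    (q w x : Carrier) (qw : q * w ≈ 1#)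
    (q^m≈1+x : pow q (suc p) ≈ 1# + x) (x³≈0 : x * (x * x) ≈ 0#)
    (y : ℕ → Carrier) (y-inverse : ∀ r → r ℕ.< p → (pow q (suc r) - 1#) * y r ≈ 1#)
    (nat-unit : ∀ n → Unit (nat (suc n)))
    where

    open Supercongruence R q p x q^m≈1+x x³≈0 y y-inverse nat-unit using (module Sum)
    open Quotient R x

    private
      m = suc p
      -- `suc M` is m * m by computation; `zpow-*` and `evalL-substL` expect the exponent as a
      -- successor.
      M = p ℕ.+ p ℕ.* m

      module S = RingTheory quotient
      module SZ = IntegerPowers quotient

      e e′ : ℕ → Carrier
      e k = zpow q w (eval5 α (+ (m ℕ.* n₁)) (+ (m ℕ.* n₂)) (+ (m ℕ.* n₃)) (+ (m ℕ.* n₄)) (+ k))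
      e′ k = zpow (pow q (suc M)) (pow w (suc M)) (eval5 α (+ n₁) (+ n₂) (+ n₃) (+ n₄) (+ k))

      q^m∼1 : pow q m ∼ 1#
      q^m∼1 = by 1# (trans q^m≈1+x (+-congˡ (sym (*-identityʳ x))))

      e-multiple : ∀ k → e (m ℕ.* k) ≈ e′ k
      e-multiple k = trans (≡⇒≈ (≡.cong (zpow q w) (≡.trans rewrite-args (≡.trans (homogeneous (+ m) (+ n₁) (+ n₂) (+ n₃) (+ n₄) (+ k))
          (≡.cong (λ j → j ℤ.* eval5 α (+ n₁) (+ n₂) (+ n₃) (+ n₄) (+ k)) (≡.sym (ℤₚ.pos-* m m)))))))
        (zpow-* q w M (eval5 α (+ n₁) (+ n₂) (+ n₃) (+ n₄) (+ k)))
        where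
        rewrite-args : eval5 α (+ (m ℕ.* n₁)) (+ (m ℕ.* n₂)) (+ (m ℕ.* n₃)) (+ (m ℕ.* n₄)) (+ (m ℕ.* k)) ≡
          eval5 α (+ m ℤ.* + n₁) (+ m ℤ.* + n₂) (+ m ℤ.* + n₃) (+ m ℤ.* + n₄) (+ m ℤ.* + k)
        rewrite-args rewrite ℤₚ.pos-* m n₁ | ℤₚ.pos-* m n₂ | ℤₚ.pos-* m n₃ | ℤₚ.pos-* m n₄ | ℤₚ.pos-* m k = ≡.refl

      e′∼1 : ∀ k → e′ k ∼ 1#
      e′∼1 k = SZ.zpow-1 (S.trans (S.pow-* q m m) (S.trans (S.pow-cong m q^m∼1) (S.pow-1 m))) (≈⇒∼ (pow-inverse qw (suc M)))
        (eval5 α (+ n₁) (+ n₂) (+ n₃) (+ n₄) (+ k))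

      e-square : ∀ j i → e (m ℕ.* j ℕ.+ i) ∼ pow q (i ℕ.* i)
      e-square j i with EvaluationModulo.eval5-mod m α base n₁ n₂ n₃ n₄ j i
      ... | h , eq = S.trans (≈⇒∼ (trans (≡⇒≈ (≡.cong (zpow q w) eq)) (trans (zpow-+ qw (+ (i ℕ.* i)) (+ m ℤ.* h)) (*-congˡ (zpow-* q w p h)))))
        (S.trans (S.*-congˡ (SZ.zpow-1 q^m∼1 (≈⇒∼ (pow-inverse qw m)) h)) (S.*-identityʳ _))

      qᵐ-1 : LPoly
      qᵐ-1 = qpow (+ m) ⊖ constL (+ 1 ℚ./ 1)

      evalL-qᵐ-1 : evalL q w qᵐ-1 ≈ x
      evalL-qᵐ-1 = trans (evalL-⊖ qw (qpow (+ m)) (constL (+ 1 ℚ./ 1)))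
        (trans (+-cong (trans (evalL-qpow q w (+ m)) q^m≈1+x) (-‿cong (trans (evalL-constL q w (+ 1 ℚ./ 1)) ι-1)))
          (solve 1 (λ x → con (+ 1) :+ x :- con (+ 1) := x) refl x))

    lhs rhs : LPoly
    lhs = Aq α (m ℕ.* n₁) (m ℕ.* n₂) (m ℕ.* n₃) (m ℕ.* n₄)
    rhs = substL (m ℕ.* m) (Aq α n₁ n₂ n₃ n₄) ⊖
      (constL (((+ (m ℕ.* m) ℤ.- + 1) ℚ./ 12) ℚ.* Rn n₁ n₂ n₃ n₄) ⊗ (qᵐ-1 ⊗ qᵐ-1))

    evalL-congruence : evalL q w (lhs ⊖ rhs) ≈ 0#
    -- The factor 24 carried through all expansions is removed here; `nat-unit 23` speaks of 24.
    evalL-congruence = unit-cancel (nat-unit 23) (begin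
      nat 24 * evalL q w (lhs ⊖ rhs)
        ≈⟨ *-congˡ (trans (evalL-⊖ qw lhs rhs) (+-cong (evalL-Aq qw α (m ℕ.* n₁) (m ℕ.* n₂) (m ℕ.* n₃) (m ℕ.* n₄)) (-‿cong rhs-value))) ⟩
      nat 24 * (A - (B - K * (x * x)))
        ≈⟨ solve 4 (λ A B K x² → con (+ 24) :* (A :- (B :- K :* x²)) := con (+ 24) :* A :- con (+ 24) :* B :+ con (+ 24) :* K :* x²) refl A B K (x * x) ⟩
      nat 24 * A - nat 24 * B + nat 24 * K * (x * x)
        ≈⟨ +-cong (+-congʳ supercongruence) (*-congʳ (trans (correction p n₁ n₂ n₃ n₄) (*-congˡ (*-congˡ (nat-A1 n₁ n₂ n₃ n₄))))) ⟩
      (nat 24 * B - μ * (x * x * (t * Σ< (suc n₁) coefficient))) - nat 24 * B + μ * (t * Σ< (suc n₁) coefficient) * (x * x)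
        ≈⟨ solve 4 (λ B μ x² T → (con (+ 24) :* B :- μ :* (x² :* T)) :- con (+ 24) :* B :+ μ :* T :* x² := con (+ 24) :* con (+ 0)) refl B μ (x * x) (t * Σ< (suc n₁) coefficient) ⟩
      nat 24 * 0#   ∎)
      where
      open Sum n₁ n₂ n₃ n₄ e e′ e-multiple e′∼1 e-square using (supercongruence; term; term′; coefficient)
      μ = nat m * nat m - 1#
      t = nat n₁ * nat n₂ + nat n₃ * nat n₄
      A = Σ< (suc (m ℕ.* n₁)) term
      B = Σ< (suc n₁) term′
      c₀ = ((+ (m ℕ.* m) ℤ.- + 1) ℚ./ 12) ℚ.* Rn n₁ n₂ n₃ n₄
      K = ι c₀
      rhs-value : evalL q w rhs ≈ B - K * (x * x)
      rhs-value = trans (evalL-⊖ qw (substL (m ℕ.* m) (Aq α n₁ n₂ n₃ n₄)) (constL c₀ ⊗ (qᵐ-1 ⊗ qᵐ-1)))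
        (+-cong (trans (evalL-substL q w M (Aq α n₁ n₂ n₃ n₄)) (evalL-Aq (pow-inverse qw (suc M)) α n₁ n₂ n₃ n₄))
          (-‿cong (trans (evalL-⊗ qw (constL c₀) (qᵐ-1 ⊗ qᵐ-1)) (*-cong (evalL-constL q w c₀)
            (trans (evalL-⊗ qw qᵐ-1 qᵐ-1) (*-cong evalL-qᵐ-1 evalL-qᵐ-1))))))

-- From the ring modulo Φ_m³ back to Laurent polynomials

atℤ : Poly → ℤ → ℚ
atℤ f (+ n)      = at f n
atℤ f (-[1+ _ ]) = 0ℚ

-- As for newCyclo, the function local to coeff is only reachable through an inferred type.
mutual
  coeff-at : ∀ s f i → coeff (mkL s f) i ≡ atℤ f (i ℤ.- s)
  coeff-at s f i with i ℤ.- s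
  ... | + n      = coeff-local s i f n
  ... | -[1+ _ ] = ≡.refl

  coeff-local : ∀ s i f n → _ ≡ at f n
  coeff-local s i []      n       = ≡.refl
  coeff-local s i (a ∷ f) zero    = ≡.refl
  coeff-local s i (a ∷ f) (suc n) = coeff-local s i f n

mkL-cong : ∀ {s t f g} → s ≡ t → f ≋ g → mkL s f ≈L mkL t g
mkL-cong {s} {_} {f} {g} ≡.refl f≋g i = ≡.trans (coeff-at s f i) (≡.trans (atℤ-cong (i ℤ.- s)) (≡.sym (coeff-at s g i)))
  where
  atℤ-cong : ∀ j → atℤ f j ≡ atℤ g j
  atℤ-cong (+ n)      = coefficients f≋g n
  atℤ-cong (-[1+ _ ]) = ≡.refl

multiple⇒CongMod : ∀ F G φ → (∃ λ h → body (F ⊖ G) ≋ h *ₚ φ) → CongMod F G (fromPoly φ)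
multiple⇒CongMod F G φ (h , e) = mkL (low (F ⊖ G)) h , mkL-cong (≡.sym (ℤₚ.+-identityʳ (low (F ⊖ G)))) e

module CubeQuotient {c ℓ} (R : CommutativeRing c ℓ) (φ : CommutativeRing.Carrier R) where

  open RingTheory R
  open Coprimality R

  cube : Carrier
  cube = φ * φ * φ

  module Cube = Quotient R cube
  open Cube using (_∼_; by; ≈⇒∼) public
  module Mod = RingTheory Cube.quotient

  a∼b+[a-b] : ∀ a b → a ∼ b + (a - b)
  a∼b+[a-b] a b = ≈⇒∼ (solve 2 (λ a b → a := b :+ (a :- b)) refl a b)

  φ³∼0 : φ * (φ * φ) ∼ 0#
  φ³∼0 = by 1# (solve 1 (λ φ → φ :* (φ :* φ) := con (+ 0) :+ φ :* φ :* φ :* con (+ 1)) refl φ)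

  ∣⇒cube∼0 : ∀ {x} → φ ∣ x → x * (x * x) ∼ 0#
  ∣⇒cube∼0 {x} (d , e) = by (d * (d * d)) (trans (*-cong e (*-cong e e))
    (solve 2 (λ d φ → d :* φ :* (d :* φ :* (d :* φ)) := con (+ 0) :+ φ :* φ :* φ :* (d :* (d :* d))) refl d φ))

  -- Bézout gives an inverse modulo φ. In the quotient by φ³ the element φ has cube zero, so
  -- `unit-lift`, applied to a quotient of that quotient, makes u a unit there.
  coprime⇒unit : ∀ {u} → Coprime φ u → Mod.Unit u
  coprime⇒unit {u} (a , b , e) = Quotient.Nilpotent.unit-lift Cube.quotient φ φ³∼0 b
    (Quotient.by (- a) (≈⇒∼ (trans (solve 4 (λ a φ b u → u :* b := a :* φ :+ b :* u :+ φ :* :- a) refl a φ b u) (+-congʳ e))))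

module CyclotomicQuotient (p : ℕ) where

  open RingTheory polynomialRing using (pow; nat; _-_)
  open Cyclotomic
  open CubeQuotient polynomialRing (Φ (suc p))
  open IsCyclotomic (Φ-isCyclotomic p)

  x : Poly
  x = X^[ suc p ]-1

  x³∼0 : x *ₚ (x *ₚ x) ∼ []
  x³∼0 = ∣⇒cube∼0 divides

  X^m∼1+x : pow X (suc p) ∼ oneₚ +ₚ x
  X^m∼1+x = a∼b+[a-b] (pow X (suc p)) oneₚ

  nat-unit-mod : ∀ n → Mod.Unit (nat (suc n))
  nat-unit-mod n = proj₁ (nat-unit n) , ≈⇒∼ (proj₂ (nat-unit n))

  -- X times X^p is 1 + x with x nilpotent.
  X-unit : Mod.Unit X
  X-unit = Quotient.Nilpotent.unit-lift Cube.quotient x x³∼0 {X} (pow X p)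
    (Quotient.by oneₚ (Mod.trans X^m∼1+x (Mod.+-congˡ (Mod.sym (Mod.*-identityʳ x)))))

  -- A total function, because the sums are indexed by bare naturals; the empty list is the filler
  -- outside r < p.
  y : ℕ → Poly
  y r with r ℕ.<? p
  ... | yes r<p = proj₁ (coprime⇒unit (coprime r r<p))
  ... | no  _   = []

  y-inverse : ∀ r → r ℕ.< p → (pow X (suc r) - oneₚ) *ₚ y r ∼ oneₚ
  y-inverse r r<p with r ℕ.<? p
  ... | yes r<p′ = proj₂ (coprime⇒unit (coprime r r<p′))
  ... | no  r≮p  = contradiction r<p r≮p

  constant-+ : ∀ a b → constant (a ℚ.+ b) ∼ constant a +ₚ constant b
  constant-+ a b = ≈⇒∼ ≋.refl

  constant-* : ∀ a b → constant (a ℚ.* b) ∼ constant a *ₚ constant b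
  constant-* a b = ≈⇒∼ (≋.sym (const-* a (constant b)))

  open LaurentEvaluation Cube.quotient constant constant-+ constant-* (≈⇒∼ 0∷[]) Mod.refl
  open Evaluation Cube.quotient constant constant-+ constant-* (≈⇒∼ 0∷[]) Mod.refl using (eval)

  -- The quotient ring computes with the list operations themselves, so evaluation at X rebuilds f
  -- exactly and not just modulo the cube. Hence a vanishing value is a genuine multiple of Φ_m³.
  eval-X≋ : ∀ f → eval X f ≋ f
  eval-X≋ []      = ≋.refl
  eval-X≋ (a ∷ f) = ≋.trans (+ₚ-cong (≋.refl {constant a}) (*ₚ-congˡ X (eval-X≋ f))) (≋.sym (∷-split a f))

  evalL≋0⇒multiple : ∀ f → evalL X (proj₁ X-unit) f ∼ [] → ∃ λ h → body f ≋ h *ₚ (Φ (suc p) *ₚ Φ (suc p) *ₚ Φ (suc p))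
  evalL≋0⇒multiple f e = multiple (evalL-0 (proj₂ X-unit) f e)
    where
    multiple : ∀ {g} → eval X g ∼ [] → ∃ λ h → g ≋ h *ₚ cube
    multiple {g} (by h e′) = h , ≋.trans (≋.sym (eval-X≋ g)) (≋.trans e′ (*ₚ-comm cube h))

  congruence : (α : IntPoly5) → Homogeneous2 α → BaseCond α → (n₁ n₂ n₃ n₄ : ℕ) →
    CongMod
      (Aq α (suc p ℕ.* n₁) (suc p ℕ.* n₂) (suc p ℕ.* n₃) (suc p ℕ.* n₄))
      (substL (suc p ℕ.* suc p) (Aq α n₁ n₂ n₃ n₄)
        ⊖ (constL (((+ (suc p ℕ.* suc p) ℤ.- + 1) ℚ./ 12) ℚ.* Rn n₁ n₂ n₃ n₄)
           ⊗ ((qpow (+ suc p) ⊖ constL (+ 1 ℚ./ 1)) ⊗ (qpow (+ suc p) ⊖ constL (+ 1 ℚ./ 1)))))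
      (fromPoly (Φ (suc p) *ₚ Φ (suc p) *ₚ Φ (suc p)))
  congruence α homogeneous base n₁ n₂ n₃ n₄ =
    multiple⇒CongMod A.lhs A.rhs (Φ (suc p) *ₚ Φ (suc p) *ₚ Φ (suc p)) (evalL≋0⇒multiple (A.lhs ⊖ A.rhs) A.evalL-congruence)
    where
    module A = Apéry α homogeneous base p n₁ n₂ n₃ n₄ X (proj₁ X-unit) x (proj₂ X-unit) X^m∼1+x x³∼0 y y-inverse nat-unit-mod

open import Data.Nat using (ℕ; _*_; _≤_)
open import Data.Integer using (+_) renaming (_-_ to _-ℤ_)
open import Data.Rational using (_/_) renaming (_*_ to _*ℚ_)

theorem10 : (α : IntPoly5) → Homogeneous2 α → BaseCond α →
    (m : ℕ) → 1 ≤ m → (n₁ n₂ n₃ n₄ : ℕ) →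
    CongMod
      (Aq α (m * n₁) (m * n₂) (m * n₃) (m * n₄))
      (substL (m * m) (Aq α n₁ n₂ n₃ n₄)
        ⊖ (constL (((+ (m * m) -ℤ + 1) / 12) *ℚ Rn n₁ n₂ n₃ n₄)
           ⊗ ((qpow (+ m) ⊖ constL (+ 1 / 1)) ⊗ (qpow (+ m) ⊖ constL (+ 1 / 1)))))
      (fromPoly (Φ m *ₚ Φ m *ₚ Φ m))
theorem10 α homogeneous base (suc p) _ n₁ n₂ n₃ n₄ = CyclotomicQuotient.congruence p α homogeneous base n₁ n₂ n₃ n₄
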